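{- Let $f$ be a function defined by a non-deterministic register transducer $T$. Then $f$ is continuous if and only if $f$ is computable.
   Context: Fix finite alphabets $\Sigma,\Gamma$, a countably infinite set $\mathcal{D}$ of data values with an effective representation (e.g. $\mathcal{D}=\mathbb{N}$) and a distinguished $d_0\in\mathcal{D}$. A test over a finite register set $R$ is a Boolean combination of $\top,\bot,r^{=},r^{\neq}$ ($r\in R$); for $\tau:R\to\mathcal{D}$ and $d\in\mathcal{D}$, $\tau,d\models r^{=}$ iff $\tau(r)=d$, $\tau,d\models r^{\neq}$ iff $\tau(r)\neq d$. A non-deterministic register transducer (NRT) is $T=(Q,R,i_0,F,\Delta)$ with finite states $Q$, initial $i_0$, accepting $F\subseteq Q$, finite register set $R$, and finite $\Delta\subseteq Q\times\Sigma\times\mathrm{Tests}_R\times2^R\times(\Gamma\times R)^*\times Q$. From configuration $(q,\tau)$, reading $(\sigma,d)$, a transition $(q,\sigma,\phi,\mathrm{asgn},o,q')$ with $\tau,d\models\phi$ leads to $(q',\tau')$ with $\tau'(r)=d$ if $r\in\mathrm{asgn}$ and $\tau'(r)=\tau(r)$ otherwise, outputting $(\gamma_1,\tau'(r_1))\cdots(\gamma_m,\tau'(r_m))$ where $o=(\gamma_1,r_1)\cdots(\gamma_m,r_m)$. An accepting run starts in $i_0$ with all registers equal to $d_0$ and visits $F$ infinitely often; standing assumption: accepting runs produce infinite outputs. $T$ defines $f$ if the set of (input, output) pairs of accepting runs is the graph of the partial function $f:(\Sigma\times\mathcal{D})^\omega\to(\Gamma\times\mathcal{D})^\omega$. Continuity: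 $f$ is continuous at $x\in\mathrm{dom}(f)$ if for all $i\geq0$ there is $j\geq0$ such that for all $y\in\mathrm{dom}(f)$, $|x\wedge y|\geq j$ implies $|f(x)\wedge f(y)|\geq i$ (where $\wedge$ is longest common prefix); $f$ is continuous if it is continuous at every $x\in\mathrm{dom}(f)$. Computability: consider deterministic Turing machines $M$ with a read-only one-way input tape holding an infinite data word, a two-way working tape, and a write-only one-way output tape; $M(x,k)$ denotes the content written on the output tape after $M$ has read the first $k$ cells of the input $x$. $f$ is computable if there is such an $M$ such that for all $x\in\mathrm{dom}(f)$ the sequence $(M(x,k))_{k\geq0}$ converges to $f(x)$, where a sequence $(w_n)$ of words converges to an infinite word $w$ if $|w_n\wedge w|\to\infty$ (equivalently, for the distance $d(u,v)=2^{ -|u\wedge v|}$ for $u\neq v$, $d(w_n,w)\to0$). -}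

module Defs where

open import Data.Nat using (ℕ; zero; suc; _+_; _∸_; _≤_; _<_; _≡ᵇ_)
open import Data.Bool using (Bool; true; false; not; _∧_; _∨_; if_then_else_; T)
open import Data.Fin using (Fin)
open import Data.List using (List; []; _∷_; _++_; map; length; concat; _∷ʳ_)
open import Data.List.Membership.Propositional using (_∈_)
open import Data.Maybe using (Maybe; just; nothing)
open import Data.Product using (Σ; ∃; _×_; _,_; proj₁; proj₂)
open import Relation.Binary.PropositionalEquality using (_≡_)

nth : {A : Set} → List A → ℕ → Maybe A
nth []       _       = nothing
nth (a ∷ as) zero    = just a
nth (a ∷ as) (suc n) = nth as n

Agree : {A : Set} → ℕ → List A → (ℕ → A) → Set
Agree i l s = (i ≤ length l) × (∀ m → m < i → nth l m ≡ just (s m))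

-- Data words.  Σ = Fin nΣ, Γ = Fin nΓ (arbitrary finite alphabets),
-- 𝒟 = ℕ.  Infinite words are streams ℕ → letter.

DataWord : ℕ → Set
DataWord n = ℕ → Fin n × ℕ

data Test (k : ℕ) : Set where
  tt ff   : Test k
  req rneq : Fin k → Test k
  neg     : Test k → Test k
  and or  : Test k → Test k → Test k

sat : {k : ℕ} → (Fin k → ℕ) → ℕ → Test k → Bool
sat τ d tt         = true
sat τ d ff         = false
sat τ d (req r)    = τ r ≡ᵇ d
sat τ d (rneq r)   = not (τ r ≡ᵇ d)
sat τ d (neg φ)    = not (sat τ d φ)
sat τ d (and φ ψ)  = sat τ d φ ∧ sat τ d ψ
sat τ d (or φ ψ)   = sat τ d φ ∨ sat τ d ψ

record Trans (nΣ nΓ nQ k : ℕ) : Set where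
  field
    src  : Fin nQ
    lab  : Fin nΣ
    test : Test k
    asgn : Fin k → Bool
    out  : List (Fin nΓ × Fin k)
    tgt  : Fin nQ

record NRT (nΣ nΓ : ℕ) : Set where
  field
    nQ  : ℕ
    k   : ℕ
    i₀  : Fin nQ
    acc : Fin nQ → Bool
    Δ   : List (Trans nΣ nΓ nQ k)

module _ {nΣ nΓ : ℕ} (A : NRT nΣ nΓ) where
  open NRT A

  update : (Fin k → ℕ) → (Fin k → Bool) → ℕ → (Fin k → ℕ)
  update τ as d r = if as r then d else τ r

  record Run (d₀ : ℕ) (x : DataWord nΣ) : Set where
    field
      st   : ℕ → Fin nQ
      reg  : ℕ → (Fin k → ℕ)
      tr   : ℕ → Trans nΣ nΓ nQ k
      st0  : st 0 ≡ i₀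
      reg0 : ∀ r → reg 0 r ≡ d₀
      trΔ  : ∀ n → tr n ∈ Δ
      trSrc : ∀ n → Trans.src (tr n) ≡ st n
      trLab : ∀ n → Trans.lab (tr n) ≡ proj₁ (x n)
      trTest : ∀ n → T (sat (reg n) (proj₂ (x n)) (Trans.test (tr n)))
      trReg : ∀ n r → reg (suc n) r ≡ update (reg n) (Trans.asgn (tr n)) (proj₂ (x n)) r
      trTgt : ∀ n → Trans.tgt (tr n) ≡ st (suc n)

    -- output of step n (uses the updated valuation τ')
    stepOut : ℕ → List (Fin nΓ × ℕ)
    stepOut n = map (λ p → proj₁ p , reg (suc n) (proj₂ p)) (Trans.out (tr n))

    outPrefix : ℕ → List (Fin nΓ × ℕ)
    outPrefix zero    = []
    outPrefix (suc n) = outPrefix n ++ stepOut n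

    Accepting : Set
    Accepting = ∀ n → ∃ λ m → n ≤ m × T (acc (st m))

    InfiniteOutput : Set
    InfiniteOutput = ∀ i → ∃ λ n → i ≤ length (outPrefix n)

    Produces : DataWord nΓ → Set
    Produces y = ∀ i → ∃ λ n → Agree i (outPrefix n) y

  AcceptingRunsInfinite : ℕ → Set
  AcceptingRunsInfinite d₀ = ∀ x (ρ : Run d₀ x) → Run.Accepting ρ → Run.InfiniteOutput ρ

  Graph : ℕ → DataWord nΣ → DataWord nΓ → Set
  Graph d₀ x y = Σ (Run d₀ x) λ ρ → Run.Accepting ρ × Run.Produces ρ y

Functional : {nΣ nΓ : ℕ} → (DataWord nΣ → DataWord nΓ → Set) → Set
Functional G = ∀ x y y' → G x y → G x y' → ∀ m → y m ≡ y' m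

Continuous : {nΣ nΓ : ℕ} → (DataWord nΣ → DataWord nΓ → Set) → Set
Continuous G =
  ∀ x y → G x y → ∀ i → ∃ λ j → ∀ x' y' → G x' y' →
    (∀ m → m < j → x m ≡ x' m) → (∀ m → m < i → y m ≡ y' m)

-- Effective representation of data words over a finite alphabet:
-- a letter (a , d) is written as the symbol a, followed by d copies of
-- 'one', followed by 'sep' (unary encoding of d).

data Sym (n : ℕ) : Set where
  lt  : Fin n → Sym n
  one : Sym n
  sep : Sym n

replicateOne : {n : ℕ} → ℕ → List (Sym n)
replicateOne zero    = []
replicateOne (suc d) = one ∷ replicateOne d

encLetter : {n : ℕ} → Fin n × ℕ → List (Sym n)
encLetter (a , d) = lt a ∷ (replicateOne d ∷ʳ sep)

encPrefix : {n : ℕ} → DataWord n → ℕ → List (Sym n)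
encPrefix x zero    = []
encPrefix x (suc j) = encPrefix x j ++ encLetter (x j)

fromMaybe : {A : Set} → A → Maybe A → A
fromMaybe a nothing  = a
fromMaybe a (just b) = b

-- the encoding of an infinite data word, as an infinite word over Sym n
-- (each letter has encoding of length ≥ 1, so the first m+1 letters
-- suffice to determine position m)
enc : {n : ℕ} → DataWord n → ℕ → Sym n
enc x m = fromMaybe sep (nth (encPrefix x (suc m)) m)

-- Deterministic Turing machines with a read-only one-way input tape,
-- a two-way working tape and a write-only one-way output tape.

data Move : Set where
  left right stay : Move

record TM (nΣ nΓ : ℕ) : Set where
  field
    nS    : ℕ
    nW    : ℕ                 -- work alphabet Fin (suc nW), blank = zero
    start : Fin nS
    -- transition: state, input symbol under input head, work symbol under
    -- work head  ↦  (new state, written work symbol, work-head move,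
    --                 advance input head?, symbol appended to output)
    -- nothing = halt
    δ : Fin nS → Sym nΣ → Fin (suc nW) →
        Maybe (Fin nS × Fin (suc nW) × Move × Bool × Maybe (Sym nΓ))

module _ {nΣ nΓ : ℕ} (M : TM nΣ nΓ) where
  open TM M

  W : Set
  W = Fin (suc nW)

  blank : W
  blank = Fin.zero

  record Config : Set where
    constructor cfg
    field
      state : Fin nS
      ihead : ℕ
      wleft : List W          -- work tape left of head (nearest first)
      wcur  : W
      wright : List W         -- work tape right of head (nearest first)
      otape : List (Sym nΓ)

  moveW : Move → List W → W → List W → List W × W × List W
  moveW left  []       c rs = [] , blank , c ∷ rs
  moveW left  (l ∷ ls) c rs = ls , l , c ∷ rs
  moveW right ls c []       = c ∷ ls , blank , []
  moveW right ls c (r ∷ rs) = c ∷ ls , r , rs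
  moveW stay  ls c rs       = ls , c , rs

  appendOut : List (Sym nΓ) → Maybe (Sym nΓ) → List (Sym nΓ)
  appendOut o nothing  = o
  appendOut o (just s) = o ∷ʳ s

  step : (ℕ → Sym nΣ) → Config → Config
  step u c with δ (Config.state c) (u (Config.ihead c)) (Config.wcur c)
  ... | nothing = c
  ... | just (q' , w , mv , adv , o) with moveW mv (Config.wleft c) w (Config.wright c)
  ...   | (ls , cur , rs) =
          cfg q' (if adv then suc (Config.ihead c) else Config.ihead c)
              ls cur rs (appendOut (Config.otape c) o)

  initial : Config
  initial = cfg start 0 [] blank [] []

  conf : (ℕ → Sym nΣ) → ℕ → Config
  conf u zero    = initial
  conf u (suc t) = step u (conf u t)

  -- |M(x,k) ∧ w| ≥ i : the output written while M has read only (within)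
  -- the first k cells of the (encoded) input x agrees with w on i positions.
  -- Step s reads input cell ihead(conf s); output is append-only.
  OutAgree : DataWord nΣ → ℕ → ℕ → (ℕ → Sym nΓ) → Set
  OutAgree x k i w =
    ∃ λ t → (∀ s → s < t → Config.ihead (conf (enc x) s) < k) ×
            Agree i (Config.otape (conf (enc x) t)) w

Computable : {nΣ nΓ : ℕ} → (DataWord nΣ → DataWord nΓ → Set) → Set
Computable {nΣ} {nΓ} G =
  Σ (TM nΣ nΓ) λ M → ∀ x y → G x y →
    ∀ i → ∃ λ k₀ → ∀ k → k₀ ≤ k → OutAgree M x k i (enc y)

{-# OPTIONS --safe #-}
-- Computable implies continuous because an output prefix is written after reading finitely many input cells.
-- Conversely, after each input letter the machine looks for a letter c such that every accepting run over an extension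
-- of the input u read so far produces the output v written so far followed by c, and then writes c.  That some
-- accepting run deviates from v c is decidable: up to a renaming of data values such a run only uses values from a
-- finite set computed from u and v c, so it lives in a finite graph and exists exactly if that graph has a lasso.
-- Soundness of the written letters is immediate, and continuity says that every output letter is eventually written.
-- The decision procedure is a primitive recursive function on codes, which is compiled into counter programs and then
-- into a Turing machine with one track per counter.
module Submission where

open import Defs
open import Data.Bool using (Bool; T; _∧_; _∨_; false; if_then_else_; not; true)
open import Data.Bool.Properties using (T-≡)
open import Data.Empty using (⊥; ⊥-elim)
open import Data.Fin using (Fin; _↑ʳ_; _↑ˡ_; combine; finToFun; fromℕ<; funToFin; splitAt; suc; toℕ; zero)
open import Data.Fin.Patterns
open import Data.Fin.Properties using (all?; any?; combine-injective; finToFun-funToFin; fromℕ<-injective; pigeonhole; splitAt-↑ʳ; splitAt-↑ˡ; toℕ-fromℕ<; toℕ-injective; toℕ<n; ¬∀⟶∃¬)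
open import Data.List using (List; []; _++_; _∷_; _∷ʳ_; allFin; foldl; length; map)
open import Data.List.Membership.Propositional using (_∈_)
open import Data.List.Membership.Propositional.Properties using (∈-allFin)
open import Data.List.Properties using (++-assoc; ++-identityʳ; foldl-++; length-++)
open import Data.List.Relation.Unary.Any using (here; there)
open import Data.Maybe using (Maybe; just; nothing)
open import Data.Maybe.Properties using (just-injective)
open import Data.Nat
open import Data.Nat.Induction using (<-rec)
open import Data.Nat.Properties
open import Data.Product using (_,_; _×_; proj₁; proj₂; ∃; ∃₂)
open import Data.Product.Properties using (≡-dec)
open import Data.Sum using ([_,_]′; _⊎_; inj₁; inj₂)
open import Data.Unit using (⊤)
open import Function using (_∘_; id)
open import Function.Bundles using (Equivalence; _⇔_; mk⇔)
open import Relation.Binary.Definitions using (tri<; tri>; tri≈)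
open import Relation.Binary.PropositionalEquality
open import Relation.Nullary using (Dec; decidable-stable; no; yes; ¬?)
import Data.Maybe as Maybe
import Data.Sum as Sum

-- The target of the search is a finite word, so deviating from it is a finite event: a single
-- number follows the output along the target and stays fixed once a mismatch has occurred. A
-- deviating accepting run is then a Büchi condition on a finite graph: an accepting node with the
-- mismatch already recorded, reachable and lying on a cycle. The run on the actual input is among
-- the runs searched for, so a wrong letter is always refuted. Conversely, an unrolled lasso is an
-- accepting run. By the standing assumption its output is infinite, so it gives a point of the
-- graph that shares the input read so far and has a different output; continuity excludes this once
-- enough input has been read. A candidate letter carries one of infinitely many data values. Its
-- datum is therefore sought only below the number of letters read. Every round is thus a bounded,
-- primitive recursive computation, and each datum still comes into reach after finitely many
-- rounds. At most one letter is written per input letter; the resulting lag is harmless because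
-- only convergence is asked for.

-- Infinite words and their encoding by symbols.

nth-++ˡ : {A : Set} (as bs : List A) (m : ℕ) → m < length as → nth (as ++ bs) m ≡ nth as m
nth-++ˡ (a ∷ as) bs zero    m<l       = refl
nth-++ˡ (a ∷ as) bs (suc m) (s≤s m<l) = nth-++ˡ as bs m m<l

nth-++ʳ : {A : Set} (as bs : List A) (m : ℕ) → nth (as ++ bs) (length as + m) ≡ nth bs m
nth-++ʳ []       bs m = refl
nth-++ʳ (a ∷ as) bs m = nth-++ʳ as bs m

nth-just : {A : Set} (as : List A) (m : ℕ) → m < length as → ∃ λ a → nth as m ≡ just a
nth-just (a ∷ as) zero    m<l       = a , refl
nth-just (a ∷ as) (suc m) (s≤s m<l) = nth-just as m m<l

nth-<length : {A : Set} (as : List A) (m : ℕ) {a : A} → nth as m ≡ just a → m < length as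
nth-<length (a ∷ as) zero    eq = s≤s z≤n
nth-<length (a ∷ as) (suc m) eq = s≤s (nth-<length as m eq)

Agree-++ : {A : Set} {i : ℕ} {as : List A} {s : ℕ → A} (bs : List A) → Agree i as s → Agree i (as ++ bs) s
Agree-++ {as = as} bs (i≤l , p) =
  ≤-trans i≤l (≤-trans (m≤m+n _ _) (≤-reflexive (sym (length-++ as)))) ,
  λ m m<i → trans (nth-++ˡ as bs m (<-≤-trans m<i i≤l)) (p m m<i)

module _ {n : ℕ} where

  encPrefix-+ : (x : DataWord n) (i j : ℕ) → ∃ λ rest → encPrefix x (i + j) ≡ encPrefix x i ++ rest
  encPrefix-+ x i zero rewrite +-identityʳ i = [] , sym (++-identityʳ _)
  encPrefix-+ x i (suc j) rewrite +-suc i j with encPrefix-+ x i j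
  ... | rest , eq = rest ++ encLetter (x (i + j)) ,
                    trans (cong (_++ encLetter (x (i + j))) eq) (++-assoc (encPrefix x i) rest _)

  encPrefix-length : (x : DataWord n) (i : ℕ) → i ≤ length (encPrefix x i)
  encPrefix-length x zero    = z≤n
  encPrefix-length x (suc i) rewrite length-++ (encPrefix x i) {encLetter (x i)} | +-comm 1 i =
    +-mono-≤ (encPrefix-length x i) (s≤s z≤n)

  nth-encPrefix-≤ : (x : DataWord n) {i j : ℕ} (m : ℕ) → i ≤ j → m < length (encPrefix x i) →
                    nth (encPrefix x j) m ≡ nth (encPrefix x i) m
  nth-encPrefix-≤ x {i} m i≤j m<l with m≤n⇒∃[o]m+o≡n i≤j
  ... | d , refl with encPrefix-+ x i d
  ...   | rest , eq rewrite eq = nth-++ˡ (encPrefix x i) rest m m<l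

  -- `enc` reads cell `m` from the prefix of `suc m` letters, which is long enough since each letter
  -- fills at least one cell. Of two prefixes one extends the other, so any prefix reaching cell `m`
  -- shows the same symbol.
  enc-encPrefix : (x : DataWord n) (i m : ℕ) → m < length (encPrefix x i) → nth (encPrefix x i) m ≡ just (enc x m)
  enc-encPrefix x i m m<l
    with nth (encPrefix x (suc m)) m
       | nth-just (encPrefix x (suc m)) m (encPrefix-length x (suc m))
       | ≤-total i (suc m)
       | nth-encPrefix-≤ x {i} {suc m} m
       | nth-encPrefix-≤ x {suc m} {i} m
  ... | .(just a) | a , refl | inj₁ le | p | q = sym (p le m<l)
  ... | .(just a) | a , refl | inj₂ ge | p | q = q ge (encPrefix-length x (suc m))

  encPrefix-cong : (x x' : DataWord n) (i : ℕ) → (∀ m → m < i → x m ≡ x' m) → encPrefix x i ≡ encPrefix x' i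
  encPrefix-cong x x' zero    p = refl
  encPrefix-cong x x' (suc i) p =
    cong₂ _++_ (encPrefix-cong x x' i (λ m m<i → p m (m<n⇒m<1+n m<i))) (cong encLetter (p i ≤-refl))

  -- Cell `m` depends only on the first `suc m` letters. A bound on the cells read can therefore
  -- serve unchanged as a modulus counted in letters.
  enc-cong : (x x' : DataWord n) (i : ℕ) → (∀ m → m < i → x m ≡ x' m) → ∀ m → m < i → enc x m ≡ enc x' m
  enc-cong x x' i p m m<i =
    cong (λ l → fromMaybe sep (nth l m)) (encPrefix-cong x x' (suc m) (λ m' m'<1+m → p m' (<-≤-trans m'<1+m m<i)))

  enc-letter : (x : DataWord n) (i m : ℕ) → m < length (encLetter (x i)) →
               just (enc x (length (encPrefix x i) + m)) ≡ nth (encLetter (x i)) m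
  enc-letter x i m m<l =
    trans (sym (enc-encPrefix x (suc i) (length (encPrefix x i) + m)
                 (<-≤-trans (+-monoʳ-< (length (encPrefix x i)) m<l) (≤-reflexive (sym (length-++ (encPrefix x i)))))))
          (nth-++ʳ (encPrefix x i) (encLetter (x i)) m)

  lt-injective : {a b : Fin n} → lt a ≡ lt b → a ≡ b
  lt-injective refl = refl

  ones-nth : ∀ d m → m < d → nth (replicateOne {n} d ∷ʳ sep) m ≡ just one
  ones-nth (suc d) zero    p       = refl
  ones-nth (suc d) (suc m) (s≤s p) = ones-nth d m p

  ones-sep : ∀ d → nth (replicateOne {n} d ∷ʳ sep) d ≡ just sep
  ones-sep zero    = refl
  ones-sep (suc d) = ones-sep d

  ones-length : ∀ d → length (replicateOne {n} d ∷ʳ sep) ≡ suc d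
  ones-length zero    = refl
  ones-length (suc d) = cong suc (ones-length d)

  one≢sep : just (one {n}) ≡ just sep → ⊥
  one≢sep ()

  -- If the data differ, the code of the smaller one has `sep` where the other still has `one`. The
  -- hypothesis is restricted to positions inside both codes because a caller may control the cells
  -- of only one of them.
  encLetter-prefix-free : (p q : Fin n × ℕ) →
    (∀ m → m < length (encLetter p) → m < length (encLetter q) → nth (encLetter p) m ≡ nth (encLetter q) m) → p ≡ q
  encLetter-prefix-free (a , d) (b , e) h = cong₂ _,_ (lt-injective (just-injective (h 0 (s≤s z≤n) (s≤s z≤n)))) d≡e
    where
    in-range : ∀ {m} d' → m ≤ d' → suc m < suc (length (replicateOne {n} d' ∷ʳ sep))
    in-range d' m≤d' = s≤s (subst (suc _ ≤_) (sym (ones-length d')) (s≤s m≤d'))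
    d≡e : d ≡ e
    d≡e with <-cmp d e
    ... | tri≈ _ eq _ = eq
    ... | tri< d<e _ _ = ⊥-elim (one≢sep (trans (sym (ones-nth e d d<e))
            (trans (sym (h (suc d) (in-range d ≤-refl) (in-range e (<⇒≤ d<e)))) (ones-sep d))))
    ... | tri> _ _ e<d = ⊥-elim (one≢sep (trans (sym (ones-nth d e e<d))
            (trans (h (suc e) (in-range d (<⇒≤ e<d)) (in-range e ≤-refl)) (ones-sep e))))

  -- Once the earlier letters are known to be equal, the codes of letter `i` begin at the same cell
  -- in both words, and prefix-freeness applies.
  enc-injective : (y y' : DataWord n) (i : ℕ) → (∀ m → m < length (encPrefix y i) → enc y m ≡ enc y' m) →
                  ∀ m → m < i → y m ≡ y' m
  enc-injective y y' (suc i) h m m<1+i with m<1+n⇒m<n∨m≡n m<1+i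
  ... | inj₁ m<i = enc-injective y y' i (λ m m<l → h m (<-≤-trans m<l shorter)) m m<i
    where
    shorter : length (encPrefix y i) ≤ length (encPrefix y (suc i))
    shorter = ≤-trans (m≤m+n _ _) (≤-reflexive (sym (length-++ (encPrefix y i))))
  ... | inj₂ refl = encLetter-prefix-free (y i) (y' i) λ k k<l k<l' →
      trans (sym (enc-letter y i k k<l))
     (trans (cong just (h (length (encPrefix y i) + k)
               (<-≤-trans (+-monoʳ-< (length (encPrefix y i)) k<l) (≤-reflexive (sym (length-++ (encPrefix y i)))))))
     (trans (cong (λ l → just (enc y' (length l + k))) same)
            (enc-letter y' i k k<l')))
    where
    same : encPrefix y i ≡ encPrefix y' i
    same = encPrefix-cong y y' i (enc-injective y y' i (λ m m<l → h m (<-≤-trans m<l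
             (≤-trans (m≤m+n _ _) (≤-reflexive (sym (length-++ (encPrefix y i))))))))

-- Locality and monotonicity of Turing machine computations; computability implies continuity.

module _ {nΣ nΓ : ℕ} (M : TM nΣ nΓ) where

  open TM M

  step-cong : (u u' : ℕ → Sym nΣ) (c : Config M) → u (Config.ihead c) ≡ u' (Config.ihead c) → step M u c ≡ step M u' c
  step-cong u u' c eq rewrite eq = refl

  conf-cong : (u u' : ℕ → Sym nΣ) (k t : ℕ) → (∀ m → m < k → u m ≡ u' m) →
              (∀ s → s < t → Config.ihead (conf M u s) < k) → conf M u t ≡ conf M u' t
  conf-cong u u' k zero    eq rd = refl
  conf-cong u u' k (suc t) eq rd =
    trans (step-cong u u' (conf M u t) (eq _ (rd t ≤-refl)))
          (cong (step M u') (conf-cong u u' k t eq (λ s s<t → rd s (m<n⇒m<1+n s<t))))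

  step-otape : (u : ℕ → Sym nΣ) (c : Config M) → ∃ λ rest → Config.otape (step M u c) ≡ Config.otape c ++ rest
  step-otape u c with δ (Config.state c) (u (Config.ihead c)) (Config.wcur c)
  ... | nothing = [] , sym (++-identityʳ _)
  ... | just (q , w , mv , adv , o) with moveW M mv (Config.wleft c) w (Config.wright c)
  ...   | (ls , cur , rs) with o
  ...     | nothing = [] , sym (++-identityʳ _)
  ...     | just s  = s ∷ [] , refl

  step-ihead : (u : ℕ → Sym nΣ) (c : Config M) → Config.ihead c ≤ Config.ihead (step M u c)
  step-ihead u c with δ (Config.state c) (u (Config.ihead c)) (Config.wcur c)
  ... | nothing = ≤-refl
  ... | just (q , w , mv , adv , o) with moveW M mv (Config.wleft c) w (Config.wright c)
  ...   | (ls , cur , rs) with adv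
  ...     | true  = n≤1+n _
  ...     | false = ≤-refl

  conf-otape : (u : ℕ → Sym nΣ) (s d : ℕ) → ∃ λ rest → Config.otape (conf M u (d + s)) ≡ Config.otape (conf M u s) ++ rest
  conf-otape u s zero = [] , sym (++-identityʳ _)
  conf-otape u s (suc d) with conf-otape u s d | step-otape u (conf M u (d + s))
  ... | r , eq | r' , eq' = r ++ r' , trans eq' (trans (cong (_++ r') eq) (++-assoc (Config.otape (conf M u s)) r r'))

  conf-ihead : (u : ℕ → Sym nΣ) (s d : ℕ) → Config.ihead (conf M u s) ≤ Config.ihead (conf M u (d + s))
  conf-ihead u s zero    = ≤-refl
  conf-ihead u s (suc d) = ≤-trans (conf-ihead u s d) (step-ihead u (conf M u (d + s)))

  otape-Agree-≤ : (u : ℕ → Sym nΣ) {i s t : ℕ} {w : ℕ → Sym nΓ} → s ≤ t →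
                  Agree i (Config.otape (conf M u s)) w → Agree i (Config.otape (conf M u t)) w
  otape-Agree-≤ u {i} {s} {t} {w} s≤t ag with m≤n⇒∃[o]m+o≡n s≤t
  ... | d , refl rewrite +-comm s d with conf-otape u s d
  ...   | r , eq = subst (λ l → Agree i l w) (sym eq) (Agree-++ {as = Config.otape (conf M u s)} r ag)

  -- The input head never moves back, so every step before `t` reads below one more than the head
  -- position at `t`; that number is `k₀`.
  eventually-OutAgree : (x : DataWord nΣ) {i : ℕ} {l : List (Sym nΓ)} {w : ℕ → Sym nΓ} → Agree i l w →
    (∃ λ t → Config.otape (conf M (enc x) t) ≡ l) → ∃ λ k₀ → ∀ k → k₀ ≤ k → OutAgree M x k i w
  eventually-OutAgree x {i} {w = w} ag (t , out) = suc (Config.ihead (conf M (enc x) t)) , λ k k₀≤k →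
    t , (λ s s<t → <-≤-trans (s≤s (reads s (<⇒≤ s<t))) k₀≤k) , subst (λ l → Agree i l w) (sym out) ag
    where
    reads : ∀ s → s ≤ t → Config.ihead (conf M (enc x) s) ≤ Config.ihead (conf M (enc x) t)
    reads s s≤t = subst (λ t' → Config.ihead (conf M (enc x) s) ≤ Config.ihead (conf M (enc x) t'))
                        (m∸n+n≡m s≤t) (conf-ihead (enc x) s (t ∸ s))

Agree-unique : {A : Set} {i : ℕ} {l : List A} {s s' : ℕ → A} → Agree i l s → Agree i l s' → ∀ m → m < i → s m ≡ s' m
Agree-unique (_ , p) (_ , q) m m<i = just-injective (trans (sym (p m m<i)) (q m m<i))

computable⇒continuous : {nΣ nΓ : ℕ} (G : DataWord nΣ → DataWord nΓ → Set) → Computable G → Continuous G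
computable⇒continuous G (M , compute) x y Gxy i with compute x y Gxy (length (encPrefix y i))
... | k , outs with outs k ≤-refl
...   | t , reads , agree = k , λ x' y' Gx'y' x≡x' → enc-injective y y' i (outputs-agree x' y' Gx'y' x≡x')
  where
  len = length (encPrefix y i)
  outputs-agree : ∀ x' y' → G x' y' → (∀ m → m < k → x m ≡ x' m) → ∀ m → m < len → enc y m ≡ enc y' m
  outputs-agree x' y' Gx'y' x≡x' with compute x' y' Gx'y' len
  ... | k' , outs' with outs' k' ≤-refl
  -- The first `t` steps on `x'` are those on `x`. The output at the later of the times `t` and `t'`
  -- extends both known outputs, so it agrees with both encodings.
  ...   | t' , _ , agree' = Agree-unique {l = Config.otape (conf M (enc x') (t ⊔ t'))}
            (otape-Agree-≤ M (enc x') (m≤m⊔n t t') (subst (λ c → Agree len (Config.otape c) (enc y))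
               (conf-cong M (enc x) (enc x') k t (enc-cong x x' k x≡x') reads) agree))
            (otape-Agree-≤ M (enc x') (m≤n⊔m t t') agree')

-- Turing machines compiled from counter programs

<ᵇ-true : ∀ {m n} → m < n → (m <ᵇ n) ≡ true
<ᵇ-true {zero}  {suc n} p       = refl
<ᵇ-true {suc m} {suc n} (s≤s p) = <ᵇ-true p

<ᵇ-false : ∀ {m n} → n ≤ m → (m <ᵇ n) ≡ false
<ᵇ-false {m}     {zero}  p       = refl
<ᵇ-false {suc m} {suc n} (s≤s p) = <ᵇ-false p

<ᵇ-suc : ∀ {j n} → j ≢ n → (j <ᵇ n) ≡ (j <ᵇ suc n)
<ᵇ-suc {zero}  {zero}  j≢n = ⊥-elim (j≢n refl)
<ᵇ-suc {zero}  {suc n} j≢n = refl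
<ᵇ-suc {suc j} {zero}  j≢n = refl
<ᵇ-suc {suc j} {suc n} j≢n = <ᵇ-suc (j≢n ∘ cong suc)

≡ᵇ-refl : ∀ n → (n ≡ᵇ n) ≡ true
≡ᵇ-refl zero    = refl
≡ᵇ-refl (suc n) = ≡ᵇ-refl n

≡ᵇ-false : ∀ m n → m ≢ n → (m ≡ᵇ n) ≡ false
≡ᵇ-false zero    zero    m≢n = ⊥-elim (m≢n refl)
≡ᵇ-false zero    (suc n) m≢n = refl
≡ᵇ-false (suc m) zero    m≢n = refl
≡ᵇ-false (suc m) (suc n) m≢n = ≡ᵇ-false m n (m≢n ∘ cong suc)

bit : Bool → Fin 2
bit false = 0F
bit true  = 1F

unbit : Fin 2 → Bool
unbit 0F = false
unbit 1F = true

unbit-bit : ∀ b → unbit (bit b) ≡ b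
unbit-bit false = refl
unbit-bit true  = refl

-- Work symbols carry K Boolean tracks.  The blank symbol is kept apart from the 2 ^ K explicit vectors of marks
-- and is read as the unmarked vector.
Cell : ℕ → Set
Cell K = Fin (suc (2 ^ K))

mark : (K : ℕ) → Cell K → ℕ → Bool
mark K zero    r = false
mark K (suc c) r with r <? K
... | yes r<K = unbit (finToFun c (fromℕ< r<K))
... | no  _   = false

setMark : (K : ℕ) → ℕ → Bool → Cell K → Cell K
setMark K r b c = suc (funToFin {K} {2} λ i → bit (if toℕ i ≡ᵇ r then b else mark K c (toℕ i)))

mark-setMark : ∀ K r b c r' → r' < K → mark K (setMark K r b c) r' ≡ (if r' ≡ᵇ r then b else mark K c r')
mark-setMark K r b c r' p with r' <? K
... | no ¬p = ⊥-elim (¬p p)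
... | yes q = trans (cong unbit (finToFun-funToFin {K} {2} _ (fromℕ< q)))
                    (trans (unbit-bit _) (cong (λ j → if j ≡ᵇ r then b else mark K c j) (toℕ-fromℕ< q)))

mark-set-same : ∀ K r b c → r < K → mark K (setMark K r b c) r ≡ b
mark-set-same K r b c r<K rewrite mark-setMark K r b c r r<K | ≡ᵇ-refl r = refl

mark-set-other : ∀ K r b c {r'} → r' < K → r' ≢ r → mark K (setMark K r b c) r' ≡ mark K c r'
mark-set-other K r b c {r'} r'<K r'≢r rewrite mark-setMark K r b c r' r'<K | ≡ᵇ-false r' r r'≢r = refl

Store : Set
Store = ℕ → ℕ

-- Stores are functions, so the effect of an update is stated pointwise, with a frame condition;
-- equality of stores would need extensionality.
Upd : ℕ → ℕ → Store → Store → Set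
Upd r v s s' = (s' r ≡ v) × (∀ x → x ≢ r → s' x ≡ s x)

module _ (nΣ nΓ : ℕ) where

  data Cond : Set where
    input    : (Sym nΣ → Bool) → Cond
    positive : ℕ → Cond

  infixr 5 _⨾_

  data Prog : Set where
    inc dec : ℕ → Prog
    adv     : Prog
    write   : Sym nΓ → Prog
    _⨾_     : Prog → Prog → Prog
    branch  : Cond → Prog → Prog → Prog
    while   : Cond → Prog → Prog

module _ {nΣ nΓ : ℕ} where

  -- Track 0 is reserved for the home mark, so slot `r` lies on track `suc r` and needs
  -- `suc (suc r)` tracks in all.
  condTracks : Cond nΣ nΓ → ℕ
  condTracks (input f)    = 0
  condTracks (positive r) = suc (suc r)

  tracks : Prog nΣ nΓ → ℕ
  tracks (inc r)        = suc (suc r)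
  tracks (dec r)        = suc (suc r)
  tracks adv            = 0
  tracks (write x)      = 0
  tracks (p ⨾ q)        = tracks p ⊔ tracks q
  tracks (branch e p q) = condTracks e ⊔ (tracks p ⊔ tracks q)
  tracks (while e p)    = condTracks e ⊔ tracks p

  -- Control states follow the syntax, so that a run of a subprogram embeds into a run of the whole
  -- by `lift`. Numbers are assigned to them afterwards by `index`.
  State : Prog nΣ nΓ → Set
  State (inc r)        = Fin 2
  State (dec r)        = Fin 4
  State adv            = Fin 1
  State (write x)      = Fin 1
  State (p ⨾ q)        = State p ⊎ State q
  State (branch e p q) = Fin 1 ⊎ (State p ⊎ State q)
  State (while e p)    = Fin 1 ⊎ State p

  states : Prog nΣ nΓ → ℕ
  states (inc r)        = 2
  states (dec r)        = 4
  states adv            = 1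
  states (write x)      = 1
  states (p ⨾ q)        = states p + states q
  states (branch e p q) = 1 + (states p + states q)
  states (while e p)    = 1 + states p

  entry : (p : Prog nΣ nΓ) → State p
  entry (inc r)        = 0F
  entry (dec r)        = 0F
  entry adv            = 0F
  entry (write x)      = 0F
  entry (p ⨾ q)        = inj₁ (entry p)
  entry (branch e p q) = inj₁ 0F
  entry (while e p)    = inj₁ 0F

  joinSum : ∀ {A B : Set} {m n} → (A → Fin m) → (B → Fin n) → A ⊎ B → Fin (m + n)
  joinSum {m = m} {n} f g = [ (λ a → f a ↑ˡ n) , (λ b → m ↑ʳ g b) ]′

  splitSum : ∀ {A B : Set} m {n} → (Fin m → A) → (Fin n → B) → Fin (m + n) → A ⊎ B
  splitSum m f g i = Sum.map f g (splitAt m i)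

  splitSum-joinSum : ∀ {A B : Set} {m n} (f : A → Fin m) (g : B → Fin n) f' g' →
    (∀ a → f' (f a) ≡ a) → (∀ b → g' (g b) ≡ b) → ∀ x → splitSum m f' g' (joinSum f g x) ≡ x
  splitSum-joinSum {m = m} {n} f g f' g' p q (inj₁ a) rewrite splitAt-↑ˡ m (f a) n = cong inj₁ (p a)
  splitSum-joinSum {m = m} {n} f g f' g' p q (inj₂ b) rewrite splitAt-↑ʳ m n (g b) = cong inj₂ (q b)

  index : (p : Prog nΣ nΓ) → State p → Fin (states p)
  index (inc r)        = id
  index (dec r)        = id
  index adv            = id
  index (write x)      = id
  index (p ⨾ q)        = joinSum (index p) (index q)
  index (branch e p q) = joinSum id (joinSum (index p) (index q))
  index (while e p)    = joinSum id (index p)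

  unindex : (p : Prog nΣ nΓ) → Fin (states p) → State p
  unindex (inc r)        = id
  unindex (dec r)        = id
  unindex adv            = id
  unindex (write x)      = id
  unindex (p ⨾ q)        = splitSum (states p) (unindex p) (unindex q)
  unindex (branch e p q) = splitSum 1 id (splitSum (states p) (unindex p) (unindex q))
  unindex (while e p)    = splitSum 1 id (unindex p)

  unindex-index : ∀ p s → unindex p (index p s) ≡ s
  unindex-index (inc r)        s = refl
  unindex-index (dec r)        s = refl
  unindex-index adv            s = refl
  unindex-index (write x)      s = refl
  unindex-index (p ⨾ q)        s =
    splitSum-joinSum (index p) (index q) (unindex p) (unindex q) (unindex-index p) (unindex-index q) s
  unindex-index (branch e p q) s =
    splitSum-joinSum id (joinSum (index p) (index q)) id (splitSum (states p) (unindex p) (unindex q)) (λ _ → refl)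
      (splitSum-joinSum (index p) (index q) (unindex p) (unindex q) (unindex-index p) (unindex-index q)) s
  unindex-index (while e p)    s = splitSum-joinSum id (index p) id (unindex p) (λ _ → refl) (unindex-index p) s

module _ {nΣ nΓ : ℕ} (K : ℕ) where

  Action : Set
  Action = Cell K × Move × Bool × Maybe (Sym nΓ)

  test : Cond nΣ nΓ → Sym nΣ → Cell K → Bool
  test (input f)    σ c = f σ
  test (positive r) σ c = mark K c (suc r)

  -- The state nothing means that control leaves the program.  Slot r lives on track suc r; the home cell is the
  -- one marked on track 0.
  goHome : {S : Set} → S → Cell K → Maybe S × Action
  goHome s c = if mark K c 0 then nothing , c , stay , false , nothing else just s , c , left , false , nothing

  seek : {S : Set} → ℕ → S → Maybe S × Action → Cell K → Maybe S × Action
  seek r s done c = if mark K c (suc r) then just s , c , right , false , nothing else done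

  -- Embeds an instruction of a subprogram into the surrounding program; `e` is the place where
  -- control continues when the subprogram is left.
  exit : {S S' : Set} → (S → S') → Maybe S' → Maybe S × Action → Maybe S' × Action
  exit ι e (m , a) = Maybe.maybe (just ∘ ι) e m , a

  act : (p : Prog nΣ nΓ) → State p → Sym nΣ → Cell K → Maybe (State p) × Action
  act (inc r) 0F σ c = seek r 0F (just 1F , setMark K (suc r) true c , stay , false , nothing) c
  act (inc r) 1F σ c = goHome 1F c
  act (dec r) 0F σ c = if mark K c (suc r) then just 1F , c , stay , false , nothing else nothing , c , stay , false , nothing
  act (dec r) 1F σ c = seek r 1F (just 2F , c , left , false , nothing) c
  act (dec r) 2F σ c = just 3F , setMark K (suc r) false c , stay , false , nothing
  act (dec r) 3F σ c = goHome 3F c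
  act adv       s σ c = nothing , c , stay , true , nothing
  act (write x) s σ c = nothing , c , stay , false , just x
  act (p ⨾ q) (inj₁ s) σ c = exit inj₁ (just (inj₂ (entry q))) (act p s σ c)
  act (p ⨾ q) (inj₂ s) σ c = exit inj₂ nothing (act q s σ c)
  act (branch e p q) (inj₁ _)        σ c =
    just (inj₂ (if test e σ c then inj₁ (entry p) else inj₂ (entry q))) , c , stay , false , nothing
  act (branch e p q) (inj₂ (inj₁ s)) σ c = exit (inj₂ ∘ inj₁) nothing (act p s σ c)
  act (branch e p q) (inj₂ (inj₂ s)) σ c = exit (inj₂ ∘ inj₂) nothing (act q s σ c)
  act (while e p) (inj₁ _) σ c =
    (if test e σ c then just (inj₂ (entry p)) else nothing) , c , stay , false , nothing
  act (while e p) (inj₂ s) σ c = exit inj₂ (just (inj₁ 0F)) (act p s σ c)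

  record Tape : Set where
    constructor tape
    field
      ihead : ℕ
      lefts : List (Cell K)
      cur : Cell K
      rights : List (Cell K)
      otape : List (Sym nΓ)
  open Tape

  shift : Move → List (Cell K) → Cell K → List (Cell K) → List (Cell K) × Cell K × List (Cell K)
  shift left  []       c rs = [] , zero , c ∷ rs
  shift left  (l ∷ ls) c rs = ls , l , c ∷ rs
  shift right ls c []       = c ∷ ls , zero , []
  shift right ls c (r ∷ rs) = c ∷ ls , r , rs
  shift stay  ls c rs       = ls , c , rs

  perform : Action → Tape → Tape
  perform (w , mv , ad , o) (tape i ls c rs ot) =
    let (ls' , c' , rs') = shift mv ls w rs in
    tape (if ad then suc i else i) ls' c' rs' (Maybe.maybe (ot ∷ʳ_) ot o)

  record World : Set where
    constructor world
    field
      store : Store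
      pos   : ℕ
      outs  : List (Sym nΓ)
  open World

  -- Counters are kept in unary: a slot of value `v` marks exactly the cells with numbers below `v`
  -- on its track.
  CellOK : Store → Cell K → ℕ → Set
  CellOK s c i = (mark K c 0 ≡ (i ≡ᵇ 0)) × (∀ r → suc r < K → mark K c (suc r) ≡ (i <ᵇ s r))

  LeftOK : Store → List (Cell K) → ℕ → Set
  LeftOK s []       i       = i ≡ 0
  LeftOK s (c ∷ ls) zero    = ⊥
  LeftOK s (c ∷ ls) (suc i) = CellOK s c i × LeftOK s ls i

  RightOK : Store → List (Cell K) → ℕ → Set
  -- Cells beyond the stored list are blank, which is correct only if no slot reaches them.
  RightOK s []       i = ∀ r → suc r < K → s r ≤ i
  RightOK s (c ∷ rs) i = CellOK s c i × RightOK s rs (suc i)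

  At : ℕ → World → Tape → Set
  At i w t = (ihead t ≡ pos w) × (otape t ≡ outs w) ×
             LeftOK (store w) (lefts t) i × CellOK (store w) (cur t) i × RightOK (store w) (rights t) (suc i)

  CellOK-cong : ∀ s s' c i → (∀ r → (i <ᵇ s r) ≡ (i <ᵇ s' r)) → CellOK s c i → CellOK s' c i
  CellOK-cong s s' c i h (p , q) = p , λ r r<K → trans (q r r<K) (h r)

  LeftOK-cong : ∀ s s' ls i → (∀ j r → j < i → (j <ᵇ s r) ≡ (j <ᵇ s' r)) → LeftOK s ls i → LeftOK s' ls i
  LeftOK-cong s s' []       i       h p       = p
  LeftOK-cong s s' (c ∷ ls) (suc i) h (p , q) =
    CellOK-cong s s' c i (λ r → h i r ≤-refl) p , LeftOK-cong s s' ls i (λ j r j<i → h j r (m<n⇒m<1+n j<i)) q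

  RightOK-cong : ∀ s s' rs i → (∀ j r → i ≤ j → (j <ᵇ s r) ≡ (j <ᵇ s' r)) → RightOK s rs i → RightOK s' rs i
  RightOK-cong s s' [] i h p r r<K with s' r ≤? i
  ... | yes q = q
  ... | no ¬q with trans (sym (<ᵇ-true (≰⇒> ¬q))) (trans (sym (h i r ≤-refl)) (<ᵇ-false (p r r<K)))
  ...   | ()
  RightOK-cong s s' (c ∷ rs) i h (p , q) =
    CellOK-cong s s' c i (λ r → h i r ≤-refl) p , RightOK-cong s s' rs (suc i) (λ j r i<j → h j r (<⇒≤ i<j)) q

  At-cong : ∀ {w w'} i t → (∀ r → store w r ≡ store w' r) → pos w ≡ pos w' → outs w ≡ outs w' → At i w t → At i w' t
  At-cong {w} {w'} i t h refl refl (p , q , l , c , r) =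
    p , q , LeftOK-cong (store w) (store w') (lefts t) i (λ j r _ → cong (j <ᵇ_) (h r)) l ,
    CellOK-cong (store w) (store w') (cur t) i (λ r → cong (i <ᵇ_) (h r)) c ,
    RightOK-cong (store w) (store w') (rights t) (suc i) (λ j r _ → cong (j <ᵇ_) (h r)) r

  At-right : ∀ {w} i t → At i w t → At (suc i) w (perform (cur t , right , false , nothing) t)
  At-right i (tape ih ls c []       ot) (p , q , l , cc , r) =
    p , q , (cc , l) , (refl , λ x x<K → sym (<ᵇ-false (r x x<K))) , λ x x<K → m≤n⇒m≤1+n (r x x<K)
  At-right i (tape ih ls c (_ ∷ rs) ot) (p , q , l , cc , (c' , r)) = p , q , (cc , l) , c' , r

  At-left : ∀ {w} i t → At (suc i) w t → At i w (perform (cur t , left , false , nothing) t)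
  At-left i (tape ih (_ ∷ ls) c rs ot) (p , q , (c' , l) , cc , r) = p , q , l , c' , (cc , r)

  -- inc and dec move a slot between n and suc n, which only changes the mark of cell n.
  At-toggle : ∀ {w} {s'} n r b t → suc r < K → (∀ j x → j ≢ n → (j <ᵇ store w x) ≡ (j <ᵇ s' x)) →
    (∀ x → x ≢ r → s' x ≡ store w x) → b ≡ (n <ᵇ s' r) → At n w t →
    At n (world s' (pos w) (outs w)) (perform (setMark K (suc r) b (cur t) , stay , false , nothing) t)
  At-toggle {w} {s'} n r b t r<K h frame b≡ (p , q , l , (c₀ , cc) , rr) =
    p , q , LeftOK-cong _ s' (lefts t) n (λ j x j<n → h j x (<⇒≢ j<n)) l ,
    (trans (mark-set-other K (suc r) b (cur t) (≤-trans (s≤s z≤n) r<K) (λ ())) c₀ , marks) ,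
    RightOK-cong _ s' (rights t) (suc n) (λ j x n<j → h j x (≢-sym (<⇒≢ n<j))) rr
    where
    marks : ∀ x → suc x < K → mark K (setMark K (suc r) b (cur t)) (suc x) ≡ (n <ᵇ s' x)
    marks x x<K with x ≟ r
    ... | yes refl = trans (mark-set-same K (suc r) b (cur t) r<K) b≡
    ... | no x≢r   = trans (mark-set-other K (suc r) b (cur t) x<K (x≢r ∘ suc-injective))
                           (trans (cc x x<K) (cong (n <ᵇ_) (sym (frame x x≢r))))

  module _ (u : ℕ → Sym nΣ) where

    stepP : (p : Prog nΣ nΓ) → State p → Tape → Maybe (State p) × Tape
    stepP p s t = proj₁ (act p s (u (ihead t)) (cur t)) , perform (proj₂ (act p s (u (ihead t)) (cur t))) t

    data Steps (p : Prog nΣ nΓ) : Maybe (State p) × Tape → Maybe (State p) × Tape → Set where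
      ε   : ∀ {x} → Steps p x x
      _◅_ : ∀ {s t x y} → stepP p s t ≡ x → Steps p x y → Steps p (just s , t) y

    infixr 5 _◅_ _◅◅_

    _◅◅_ : ∀ {p x y z} → Steps p x y → Steps p y z → Steps p x z
    ε        ◅◅ st' = st'
    (e ◅ st) ◅◅ st' = e ◅ (st ◅◅ st')

    lift : ∀ {p q} (ι : State p → State q) (e : Maybe (State q)) →
      (∀ s σ c → act q (ι s) σ c ≡ exit ι e (act p s σ c)) →
      ∀ {m t m' t'} → Steps p (m , t) (m' , t') → Steps q (Maybe.maybe (just ∘ ι) e m , t) (Maybe.maybe (just ∘ ι) e m' , t')
    lift ι e h ε = ε
    lift {p} {q} ι e h (_◅_ {s} {t} refl st) =
      cong (λ a → proj₁ a , perform (proj₂ a) t) (h s (u (ihead t)) (cur t)) ◅ lift {p} {q} ι e h st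

    step≡ : ∀ p s t {x} → act p s (u (ihead t)) (cur t) ≡ x → stepP p s t ≡ (proj₁ x , perform (proj₂ x) t)
    step≡ p s t refl = refl

    home : ∀ p (h : State p) → (∀ σ c → act p h σ c ≡ goHome h c) → ∀ {w} i t → At i w t →
           ∃ λ t' → Steps p (just h , t) (nothing , t') × At 0 w t'
    home p h eq {w} zero t@(tape ih ls c rs ot) at@(_ , _ , _ , (c₀ , _) , _) =
      t , step≡ p h t (trans (eq _ _) (cong (λ b → if b then (nothing , c , stay , false , nothing) else just h , c , left , false , nothing) c₀)) ◅ ε , at
    home p h eq (suc i) t@(tape ih ls c rs ot) at@(_ , _ , _ , (c₀ , _) , _) with home p h eq i _ (At-left i t at)
    ... | t' , st , at' =
      t' , step≡ p h t (trans (eq _ _) (cong (λ b → if b then (nothing , c , stay , false , nothing) else just h , c , left , false , nothing) c₀)) ◅ st , at'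

    -- The scan stops at the first unmarked cell, whose number is the value of the slot; `d` is the
    -- distance still to go.
    seekEnd : ∀ p (h : State p) r (done : Cell K → Maybe (State p) × Action) → suc r < K →
      (∀ σ c → act p h σ c ≡ seek r h (done c) c) → ∀ {w} d i t → d + i ≡ store w r → At i w t →
      ∃ λ t' → Steps p (just h , t) (proj₁ (done (cur t')) , perform (proj₂ (done (cur t'))) t') × At (store w r) w t'
    seekEnd p h r done r<K eq {w} zero t tp refl at@(_ , _ , _ , (_ , cc) , _) =
      tp , step≡ p h tp (trans (eq _ _) (cong (λ b → if b then _ else done (cur tp)) (trans (cc r r<K) (<ᵇ-false {t} ≤-refl)))) ◅ ε , at
    seekEnd p h r done r<K eq {w} (suc d) i t e at@(_ , _ , _ , (_ , cc) , _)
      with seekEnd p h r done r<K eq d (suc i) _ (trans (+-suc d i) e) (At-right i t at)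
    ... | t' , st , at' =
      t' , step≡ p h t (trans (eq _ _) (cong (λ b → if b then _ else done (cur t))
             (trans (cc r r<K) (<ᵇ-true (subst (i <_) e (s≤s (m≤n+m i d))))))) ◅ st , at'

    -- The work head is at the home cell at both ends, which is what lets executions be composed.
    record Exec (p : Prog nΣ nΓ) (w w' : World) : Set where
      constructor exec
      field
        run : tracks p ≤ K → ∀ t → At 0 w t → ∃ λ t' → Steps p (just (entry p) , t) (nothing , t') × At 0 w' t'
    open Exec

    exec-inc : ∀ {w s'} r → Upd r (suc (store w r)) (store w) s' → Exec (inc r) w (world s' (pos w) (outs w))
    run (exec-inc {w} {s'} r (new , frame)) r<K t at
      with seekEnd (inc r) 0F r (λ c → just 1F , setMark K (suc r) true c , stay , false , nothing) r<K (λ _ _ → refl)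
             (store w r) 0 t (+-identityʳ _) at
    ... | t₁ , st₁ , at₁
      with home (inc r) 1F (λ _ _ → refl) (store w r) _
             (At-toggle (store w r) r true t₁ r<K unchanged frame (sym (<ᵇ-true (≤-reflexive (sym new)))) at₁)
      where
      unchanged : ∀ j x → j ≢ store w r → (j <ᵇ store w x) ≡ (j <ᵇ s' x)
      unchanged j x j≢ with x ≟ r
      ... | yes refl = trans (<ᵇ-suc j≢) (cong (j <ᵇ_) (sym new))
      ... | no x≢r   = cong (j <ᵇ_) (sym (frame x x≢r))
    ... | t₂ , st₂ , at₂ = t₂ , st₁ ◅◅ st₂ , at₂

    -- The scan ends on cell `suc n`, one past the last mark, so the head steps left once before
    -- erasing. The initial test on the home cell, which would leave a zero slot alone, succeeds
    -- here.
    exec-dec : ∀ {w s'} r n → store w r ≡ suc n → Upd r n (store w) s' → Exec (dec r) w (world s' (pos w) (outs w))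
    run (exec-dec {w} {s'} r n old (new , frame)) r<K t at@(_ , _ , _ , (_ , cc) , _)
      with seekEnd (dec r) 1F r (λ c → just 2F , c , left , false , nothing) r<K (λ _ _ → refl)
             (store w r) 0 t (+-identityʳ _) at
    ... | t₁ , st₁ , at₁
      with home (dec r) 3F (λ _ _ → refl) n _
             (At-toggle n r false (perform (cur t₁ , left , false , nothing) t₁) r<K unchanged frame (sym (<ᵇ-false (≤-reflexive new)))
               (At-left n t₁ (subst (λ i → At i w t₁) old at₁)))
      where
      unchanged : ∀ j x → j ≢ n → (j <ᵇ store w x) ≡ (j <ᵇ s' x)
      unchanged j x j≢ with x ≟ r
      ... | yes refl = trans (cong (j <ᵇ_) old) (trans (sym (<ᵇ-suc j≢)) (cong (j <ᵇ_) (sym new)))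
      ... | no x≢r   = cong (j <ᵇ_) (sym (frame x x≢r))
    ... | t₂ , st₂ , at₂ =
      t₂ , step≡ (dec r) 0F t (cong (λ b → if b then (just 1F , cur t , stay , false , nothing) else nothing , cur t , stay , false , nothing)
               (trans (cc r r<K) (cong (0 <ᵇ_) old)))
           ◅ (st₁ ◅◅ (refl ◅ st₂)) , at₂

    exec-adv : ∀ {w} → Exec adv w (world (store w) (suc (pos w)) (outs w))
    run exec-adv _ t (p , q , rest) = _ , refl ◅ ε , cong suc p , q , rest

    exec-write : ∀ {w} x → Exec (write x) w (world (store w) (pos w) (outs w ∷ʳ x))
    run (exec-write x) _ t (p , q , rest) = _ , refl ◅ ε , p , cong (_∷ʳ x) q , rest

    exec-⨾ : ∀ {p q w w' w''} → Exec p w w' → Exec q w' w'' → Exec (p ⨾ q) w w''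
    run (exec-⨾ {p} {q} f g) fit t at with run f (m⊔n≤o⇒m≤o _ _ fit) t at
    ... | t₁ , st₁ , at₁ with run g (m⊔n≤o⇒n≤o (tracks p) _ fit) t₁ at₁
    ...   | t₂ , st₂ , at₂ =
      t₂ , lift {p} {p ⨾ q} inj₁ (just (inj₂ (entry q))) (λ _ _ _ → refl) st₁
           ◅◅ lift {q} {p ⨾ q} inj₂ nothing (λ _ _ _ → refl) st₂ , at₂

    testW : Cond nΣ nΓ → World → Bool
    testW (input f)    w = f (u (pos w))
    testW (positive r) w = 0 <ᵇ store w r

    test-At : ∀ e {w} t → condTracks e ≤ K → At 0 w t → test e (u (ihead t)) (cur t) ≡ testW e w
    test-At (input f)    t fit (p , _)                    = cong (f ∘ u) p
    test-At (positive r) t fit (_ , _ , _ , (_ , cc) , _) = cc r fit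

    exec-branch-true : ∀ {e p q w w'} → testW e w ≡ true → Exec p w w' → Exec (branch e p q) w w'
    run (exec-branch-true {e} {p} {q} c f) fit t at
      with run f (m⊔n≤o⇒m≤o _ _ (m⊔n≤o⇒n≤o (condTracks e) _ fit)) t at
    ... | t' , st , at' =
      t' , cong (λ b → just (inj₂ (if b then inj₁ (entry p) else inj₂ (entry q))) , t)
                (trans (test-At e t (m⊔n≤o⇒m≤o _ _ fit) at) c)
           ◅ lift {p} {branch e p q} (inj₂ ∘ inj₁) nothing (λ _ _ _ → refl) st , at'

    exec-branch-false : ∀ {e p q w w'} → testW e w ≡ false → Exec q w w' → Exec (branch e p q) w w'
    run (exec-branch-false {e} {p} {q} c f) fit t at
      with run f (m⊔n≤o⇒n≤o (tracks p) _ (m⊔n≤o⇒n≤o (condTracks e) _ fit)) t at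
    ... | t' , st , at' =
      t' , cong (λ b → just (inj₂ (if b then inj₁ (entry p) else inj₂ (entry q))) , t)
                (trans (test-At e t (m⊔n≤o⇒m≤o _ _ fit) at) c)
           ◅ lift {q} {branch e p q} (inj₂ ∘ inj₂) nothing (λ _ _ _ → refl) st , at'

    -- Kept apart from `exec-while` because the outer loop of the machine never ends: there each
    -- round is used on its own, from one test to the next.
    while-round : ∀ {e p w w'} → testW e w ≡ true → Exec p w w' → tracks (while e p) ≤ K → ∀ t → At 0 w t →
                  ∃ λ t' → Steps (while e p) (just (inj₁ 0F) , t) (just (inj₁ 0F) , t') × At 0 w' t'
    while-round {e} {p} c f fit t at with run f (m⊔n≤o⇒n≤o (condTracks e) _ fit) t at
    ... | t' , st , at' =
      t' , cong (λ b → (if b then just (inj₂ (entry p)) else nothing) , t) (trans (test-At e t (m⊔n≤o⇒m≤o _ _ fit) at) c)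
           ◅ lift {p} {while e p} inj₂ (just (inj₁ 0F)) (λ _ _ _ → refl) st , at'

    -- The index of `Inv` is the number of rounds still to come, so induction on it replaces a
    -- separate termination argument.
    exec-while : ∀ {e p} (Inv : ℕ → World → Set) →
      (∀ n w → Inv n w → testW e w ≡ (0 <ᵇ n)) →
      (∀ n w → Inv (suc n) w → ∃ λ w' → Exec p w w' × Inv n w') →
      ∀ n w → Inv n w → ∃ λ w' → Exec (while e p) w w' × Inv 0 w'
    exec-while {e} {p} Inv cond body zero w inv =
      w , exec (λ fit t at → t , cong (λ b → (if b then just (inj₂ (entry p)) else nothing) , t)
             (trans (test-At e t (m⊔n≤o⇒m≤o _ _ fit) at) (cond 0 w inv)) ◅ ε , at) , inv
    exec-while {e} {p} Inv cond body (suc n) w inv with body n w inv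
    ... | w₁ , f , inv₁ with exec-while {e} {p} Inv cond body n w₁ inv₁
    ...   | w₂ , g , inv₂ = w₂ , exec rounds , inv₂
      where
      rounds : tracks (while e p) ≤ K → ∀ t → At 0 w t →
               ∃ λ t' → Steps (while e p) (just (inj₁ 0F) , t) (nothing , t') × At 0 w₂ t'
      rounds fit t at with while-round {e} {p} (cond (suc n) w inv) f fit t at
      ... | t₁ , st₁ , at₁ with run g fit t₁ at₁
      ...   | t₂ , st₂ , at₂ = t₂ , st₁ ◅◅ st₂ , at₂

    exec-cong : ∀ {p w w'} {w''} → (∀ r → store w' r ≡ store w'' r) → pos w' ≡ pos w'' → outs w' ≡ outs w'' →
                Exec p w w' → Exec p w w''
    run (exec-cong h e e' f) fit t at with run f fit t at
    ... | t' , st , at' = t' , st , At-cong 0 t' h e e' at'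

-- The Turing machine of a program that loops forever.

module _ {nΣ nΓ : ℕ} (pre body : Prog nΣ nΓ) where

  loop : Prog nΣ nΓ
  loop = pre ⨾ while (input (λ _ → true)) body

  private
    K : ℕ
    K = suc (tracks loop)

    instruction : Maybe (State loop) × Action {nΣ} {nΓ} K →
                  Maybe (Fin (suc (states loop)) × Cell K × Move × Bool × Maybe (Sym nΓ))
    instruction (nothing , a) = nothing
    instruction (just s  , a) = just (suc (index loop s) , a)

  machine : TM nΣ nΓ
  machine = record
    { nS    = suc (states loop)
    ; nW    = 2 ^ K
    ; start = zero
    ; δ     = λ { zero    σ c → just (suc (index loop (entry loop)) , setMark K 0 true c , stay , false , nothing)
                ; (suc q) σ c → instruction (act K loop (unindex loop q) σ c) } }

  private
    config : Fin (suc (states loop)) → Tape {nΣ} {nΓ} K → Config machine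
    config q (tape ih ls c rs ot) = cfg q ih ls c rs ot

    moveW-shift : ∀ mv ls c rs → moveW machine mv ls c rs ≡ shift {nΣ} {nΓ} K mv ls c rs
    moveW-shift left  []       c rs       = refl
    moveW-shift left  (l ∷ ls) c rs       = refl
    moveW-shift right ls       c []       = refl
    moveW-shift right ls       c (r ∷ rs) = refl
    moveW-shift stay  ls       c rs       = refl

    appendOut-maybe : ∀ ot o → appendOut machine ot o ≡ Maybe.maybe (ot ∷ʳ_) ot o
    appendOut-maybe ot nothing  = refl
    appendOut-maybe ot (just x) = refl

    step-instruction : ∀ u q t {q' a} → TM.δ machine q (u (Tape.ihead t)) (Tape.cur t) ≡ just (q' , a) →
                       step machine u (config q t) ≡ config q' (perform {nΣ} {nΓ} K a t)
    step-instruction u q (tape ih ls c rs ot) {q'} {w , mv , ad , o} eq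
      rewrite eq | moveW-shift mv ls w rs | appendOut-maybe ot o = refl

    -- Nothing follows once control has left the program, so a sequence of steps that ends inside it
    -- never meets the halting case of `instruction`.
    conf-Steps : ∀ u {s t s' t'} k → conf machine u k ≡ config (suc (index loop s)) t →
                 Steps K u loop (just s , t) (just s' , t') →
                 ∃ λ k' → conf machine u k' ≡ config (suc (index loop s')) t'
    conf-Steps u k e ε = k , e
    conf-Steps u {s} {t} k e (_◅_ {x = just s₁ , t₁} st sts) = conf-Steps u (suc k)
      (trans (cong (step machine u) e)
        (trans (step-instruction u (suc (index loop s)) t
                  (trans (cong (λ z → instruction (act K loop z (u (Tape.ihead t)) (Tape.cur t))) (unindex-index loop s))
                         (cong (λ m → instruction (m , proj₂ (act K loop s (u (Tape.ihead t)) (Tape.cur t)))) (cong proj₁ st))))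
               (cong (config (suc (index loop s₁))) (cong proj₂ st))))
      sts

  machine-outs : (u : ℕ → Sym nΣ) (w : ℕ → World {nΣ} {nΓ} K) →
    Exec K u pre (world (λ _ → 0) 0 []) (w 0) → (∀ n → Exec K u body (w n) (w (suc n))) →
    ∀ n → ∃ λ k → Config.otape (conf machine u k) ≡ World.outs (w n)
  machine-outs u w f g n with rounds n
    where
    initial-tape : Tape {nΣ} {nΓ} K
    initial-tape = tape 0 [] (setMark K 0 true zero) [] []
    initial-At : At K 0 (world (λ _ → 0) 0 []) initial-tape
    initial-At = refl , refl , refl ,
      (mark-set-same K 0 true zero (s≤s z≤n) ,
       λ r r<K → trans (mark-set-other K 0 true zero r<K (λ ())) refl) , λ _ _ → z≤n
    rounds : ∀ n → ∃ λ t → Steps K u loop (just (entry loop) , initial-tape) (just (inj₂ (inj₁ 0F)) , t) × At K 0 (w n) t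
    rounds zero with Exec.run f (≤-trans (m≤m⊔n _ _) (n≤1+n _)) initial-tape initial-At
    ... | t , st , at = t , lift K u {pre} {loop} inj₁ _ (λ _ _ _ → refl) st , at
    rounds (suc n) with rounds n
    ... | t , st , at with while-round K u {input (λ _ → true)} {body} refl (g n) (≤-trans (m≤n⊔m (tracks pre) _) (n≤1+n _)) t at
    ...   | t' , st' , at' = t' , _◅◅_ K u st (lift K u {while (input (λ _ → true)) body} {loop} inj₂ nothing (λ _ _ _ → refl) st') , at'
  ... | t , st , (_ , o , _) =
    -- The count starts at 1 because the first machine step only marks the home cell.
    let k , e = conf-Steps u {t' = t} 1 refl st in k , trans (cong Config.otape e) o

-- Primitive recursive terms

natrec : {A : Set} → A → (ℕ → A → A) → ℕ → A
natrec z s zero    = z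
natrec z s (suc n) = s n (natrec z s n)

infixl 5 _▸_

_▸_ : {A : Set} {n : ℕ} → (Fin n → A) → A → Fin (suc n) → A
(v ▸ a) zero    = a
(v ▸ a) (suc i) = v i

-- `bind` shares a value instead of substituting it. `ren` is a constructor because it compiles to
-- nothing: only the slots assigned to the variables change. In the step of `rec`, variable zero is
-- the accumulator and the next one the index.
data Tm : ℕ → Set where
  var  : ∀ {n} → Fin n → Tm n
  ze   : ∀ {n} → Tm n
  su   : ∀ {n} → Tm n → Tm n
  bind : ∀ {n} → Tm n → Tm (suc n) → Tm n
  rec  : ∀ {n} → Tm n → Tm n → Tm (2 + n) → Tm n
  ren  : ∀ {k n} → (Fin k → Fin n) → Tm k → Tm n

eval : ∀ {n} → Tm n → (Fin n → ℕ) → ℕ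
eval (var i)     v = v i
eval ze          v = 0
eval (su t)      v = suc (eval t v)
eval (bind t b)  v = eval b (v ▸ eval t v)
eval (rec c z s) v = natrec (eval z v) (λ i a → eval s (v ▸ i ▸ a)) (eval c v)
eval (ren σ t)   v = eval t (v ∘ σ)

upd : Store → ℕ → ℕ → Store
upd s r v x = if x ≡ᵇ r then v else s x

upd-Upd : ∀ s r v → Upd r v s (upd s r v)
upd-Upd s r v = cong (λ b → if b then v else s r) (≡ᵇ-refl r) ,
                λ x x≢r → cong (λ b → if b then v else s x) (≡ᵇ-false x r x≢r)

module _ {nΣ nΓ : ℕ} where

  clear : ℕ → Prog nΣ nΓ
  clear r = while (positive r) (dec r)

  move : ℕ → ℕ → Prog nΣ nΓ
  move a b = while (positive a) (dec a ⨾ inc b)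

  -- Reading a counter destroys it, so `a` is drained into both the target and a scratch slot and
  -- then restored from the latter.
  copy : ℕ → ℕ → ℕ → Prog nΣ nΓ
  copy a b c = while (positive a) (dec a ⨾ inc b ⨾ inc c) ⨾ move c a

  -- The variables occupy slots below `m`, all slots from `m` on start empty, and the value is left
  -- in `m` with everything above cleared again. For `rec`, slot `m` counts the remaining rounds,
  -- `suc m` holds the index, `2 + m` the accumulator, and `3 + m` receives the result of each step.
  compile : ∀ {n} → Tm n → (Fin n → ℕ) → ℕ → Prog nΣ nΓ
  compile (var i)     ρ m = copy (ρ i) m (suc m)
  compile ze          ρ m = clear m
  compile (su t)      ρ m = compile t ρ m ⨾ inc m
  compile (bind t b)  ρ m = compile t ρ m ⨾ compile b (ρ ▸ m) (suc m) ⨾ clear m ⨾ move (suc m) m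
  compile (rec c z s) ρ m =
    compile c ρ m ⨾ compile z ρ (2 + m) ⨾
    while (positive m)
      (dec m ⨾ compile s (ρ ▸ suc m ▸ 2 + m) (3 + m) ⨾ (clear (2 + m) ⨾ move (3 + m) (2 + m)) ⨾ inc (suc m)) ⨾
    clear (suc m) ⨾ move (2 + m) m
  compile (ren σ t)   ρ m = compile t (ρ ∘ σ) m

  module _ (K : ℕ) (u : ℕ → Sym nΣ) (po : ℕ) (ou : List (Sym nΓ)) where

    ExecS : Prog nΣ nΓ → Store → Store → Set
    ExecS p s s' = Exec K u p (world s po ou) (world s' po ou)

    while-slot : ∀ {p} r (Inv : ℕ → Store → Set) → (∀ n s → Inv n s → s r ≡ n) →
      (∀ n s → Inv (suc n) s → ∃ λ s' → ExecS p s s' × Inv n s') →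
      ∀ n s → Inv n s → ∃ λ s' → ExecS (while (positive r) p) s s' × Inv 0 s'
    while-slot {p} r Inv cond body n s inv
      with exec-while K u {positive r} {p} (λ n w → ∃ λ s → w ≡ world s po ou × Inv n s)
             (λ { n _ (s , refl , i) → cong (0 <ᵇ_) (cond n s i) })
             (λ { n _ (s , refl , i) → let (s' , ex , i') = body n s i in world s' po ou , ex , s' , refl , i' })
             n (world s po ou) (s , refl , inv)
    ... | _ , ex , s' , refl , inv' = s' , ex , inv'

    clear-ok : ∀ r s → ∃ λ s' → ExecS (clear r) s s' × Upd r 0 s s'
    clear-ok r s = while-slot {dec r} r (λ n → Upd r n s) (λ n _ → proj₁)
      (λ n s₁ (e , f) → let (e' , f') = upd-Upd s₁ r n in
         upd s₁ r n , exec-dec K u {world s₁ po ou} {upd s₁ r n} r n e (e' , f') ,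
         e' , λ x x≢r → trans (f' x x≢r) (f x x≢r))
      (s r) s (refl , λ _ _ → refl)

    move-ok : ∀ a b s → a ≢ b → s b ≡ 0 →
      ∃ λ s' → ExecS (move a b) s s' × s' a ≡ 0 × s' b ≡ s a × (∀ x → x ≢ a → x ≢ b → s' x ≡ s x)
    move-ok a b s a≢b sb
      with while-slot {dec a ⨾ inc b} a
             (λ n s' → s' a ≡ n × s' b + n ≡ s a × (∀ x → x ≢ a → x ≢ b → s' x ≡ s x)) (λ n _ → proj₁) body
             (s a) s (refl , cong (_+ s a) sb , λ _ _ _ → refl)
      where
      body : ∀ n s₁ → s₁ a ≡ suc n × s₁ b + suc n ≡ s a × (∀ x → x ≢ a → x ≢ b → s₁ x ≡ s x) →
             ∃ λ s₃ → ExecS (dec a ⨾ inc b) s₁ s₃ × s₃ a ≡ n × s₃ b + n ≡ s a × (∀ x → x ≢ a → x ≢ b → s₃ x ≡ s x)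
      body n s₁ (e , h , f) =
        let s₂ = upd s₁ a n ; s₃ = upd s₂ b (suc (s₂ b))
            (e₂ , f₂) = upd-Upd s₁ a n ; (e₃ , f₃) = upd-Upd s₂ b (suc (s₂ b))
        in s₃ , exec-⨾ K u {dec a} {inc b} {w' = world s₂ po ou} (exec-dec K u a n e (e₂ , f₂)) (exec-inc K u b (e₃ , f₃)) ,
           trans (f₃ a a≢b) e₂ ,
           trans (cong (_+ n) (trans e₃ (cong suc (f₂ b (a≢b ∘ sym))))) (trans (sym (+-suc (s₁ b) n)) h) ,
           λ x x≢a x≢b → trans (f₃ x x≢b) (trans (f₂ x x≢a) (f x x≢a x≢b))
    ... | s' , ex , e , h , f = s' , ex , e , trans (sym (+-identityʳ _)) h , f

    copy-ok : ∀ a b c s → a ≢ b → a ≢ c → b ≢ c → s b ≡ 0 → s c ≡ 0 →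
              ∃ λ s' → ExecS (copy a b c) s s' × Upd b (s a) s s'
    copy-ok a b c s a≢b a≢c b≢c sb sc
      with while-slot {dec a ⨾ inc b ⨾ inc c} a
             (λ n s' → s' a ≡ n × s' b + n ≡ s a × s' c + n ≡ s a × (∀ x → x ≢ a → x ≢ b → x ≢ c → s' x ≡ s x))
             (λ n _ → proj₁) body (s a) s (refl , cong (_+ s a) sb , cong (_+ s a) sc , λ _ _ _ _ → refl)
      where
      body : ∀ n s₁ → s₁ a ≡ suc n × s₁ b + suc n ≡ s a × s₁ c + suc n ≡ s a × (∀ x → x ≢ a → x ≢ b → x ≢ c → s₁ x ≡ s x) →
             ∃ λ s₄ → ExecS (dec a ⨾ inc b ⨾ inc c) s₁ s₄ × s₄ a ≡ n × s₄ b + n ≡ s a × s₄ c + n ≡ s a ×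
               (∀ x → x ≢ a → x ≢ b → x ≢ c → s₄ x ≡ s x)
      body n s₁ (e , hb , hc , f) =
        let s₂ = upd s₁ a n ; s₃ = upd s₂ b (suc (s₂ b)) ; s₄ = upd s₃ c (suc (s₃ c))
            (e₂ , f₂) = upd-Upd s₁ a n ; (e₃ , f₃) = upd-Upd s₂ b (suc (s₂ b)) ; (e₄ , f₄) = upd-Upd s₃ c (suc (s₃ c))
        in s₄ ,
           exec-⨾ K u {dec a} {inc b ⨾ inc c} {w' = world s₂ po ou} (exec-dec K u a n e (e₂ , f₂))
             (exec-⨾ K u {inc b} {inc c} {w' = world s₃ po ou} (exec-inc K u b (e₃ , f₃)) (exec-inc K u c (e₄ , f₄))) ,
           trans (f₄ a a≢c) (trans (f₃ a a≢b) e₂) ,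
           trans (cong (_+ n) (trans (f₄ b b≢c) (trans e₃ (cong suc (f₂ b (a≢b ∘ sym)))))) (trans (sym (+-suc (s₁ b) n)) hb) ,
           trans (cong (_+ n) (trans e₄ (cong suc (trans (f₃ c (b≢c ∘ sym)) (f₂ c (a≢c ∘ sym)))))) (trans (sym (+-suc (s₁ c) n)) hc) ,
           λ x x≢a x≢b x≢c → trans (f₄ x x≢c) (trans (f₃ x x≢b) (trans (f₂ x x≢a) (f x x≢a x≢b x≢c)))
    ... | s₁ , ex₁ , e₁ , hb , hc , f with move-ok c a s₁ (a≢c ∘ sym) e₁
    ...   | s₂ , ex₂ , ec , ea , f₂ =
      s₂ , exec-⨾ K u {while (positive a) (dec a ⨾ inc b ⨾ inc c)} {move c a} {w' = world s₁ po ou} ex₁ ex₂ ,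
      trans (f₂ b b≢c (a≢b ∘ sym)) (trans (sym (+-identityʳ _)) hb) , frame
      where
      frame : ∀ x → x ≢ b → s₂ x ≡ s x
      frame x x≢b with x ≟ a | x ≟ c
      ... | yes refl | _        = trans ea (trans (sym (+-identityʳ _)) hc)
      ... | no _     | yes refl = trans ec (sym sc)
      ... | no x≢a   | no x≢c   = trans (f₂ x x≢c x≢a) (f x x≢a x≢b x≢c)

    replace-ok : ∀ r m s → r ≢ m →
      ∃ λ s' → ExecS (clear m ⨾ move r m) s s' × s' r ≡ 0 × s' m ≡ s r × (∀ x → x ≢ r → x ≢ m → s' x ≡ s x)
    replace-ok r m s r≢m with clear-ok m s
    ... | s₁ , ex₁ , e₁ , f₁ with move-ok r m s₁ r≢m e₁
    ...   | s₂ , ex₂ , er , em , f₂ =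
      s₂ , exec-⨾ K u {clear m} {move r m} {w' = world s₁ po ou} ex₁ ex₂ , er , trans em (f₁ r r≢m) ,
      λ x x≢r x≢m → trans (f₂ x x≢r x≢m) (f₁ x x≢m)

    record Ready {n} (ρ : Fin n → ℕ) (v : Fin n → ℕ) (m : ℕ) (s : Store) : Set where
      field
        below : ∀ i → ρ i < m
        agree : ∀ i → s (ρ i) ≡ v i
        free  : ∀ x → m ≤ x → s x ≡ 0
    open Ready

    ready-▸ : ∀ {n} {ρ : Fin n → ℕ} {v m s s' a} → Ready ρ v m s → Upd m a s s' → Ready (ρ ▸ m) (v ▸ a) (suc m) s'
    ready-▸ {ρ = ρ} {m = m} R (e , f) = record
      { below = λ { zero → ≤-refl ; (suc i) → m<n⇒m<1+n (below R i) }
      ; agree = λ { zero → e ; (suc i) → trans (f (ρ i) (<⇒≢ (below R i))) (agree R i) }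
      ; free  = λ x m<x → trans (f x (>⇒≢ m<x)) (free R x (<⇒≤ m<x)) }

    compile-ok : ∀ {n} (t : Tm n) ρ v m s → Ready ρ v m s → ∃ λ s' → ExecS (compile t ρ m) s s' × Upd m (eval t v) s s'
    compile-ok (var i) ρ v m s R
      with copy-ok (ρ i) m (suc m) s (<⇒≢ (below R i)) (<⇒≢ (m<n⇒m<1+n (below R i))) (<⇒≢ ≤-refl)
             (free R m ≤-refl) (free R (suc m) (n≤1+n m))
    ... | s' , ex , e , f = s' , ex , trans e (agree R i) , f
    compile-ok ze ρ v m s R = clear-ok m s
    compile-ok (su t) ρ v m s R with compile-ok t ρ v m s R
    ... | s₁ , ex , e , f =
      let (e₂ , f₂) = upd-Upd s₁ m (suc (s₁ m)) in
      upd s₁ m (suc (s₁ m)) ,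
      exec-⨾ K u {compile t ρ m} {inc m} {w' = world s₁ po ou} ex (exec-inc K u m (e₂ , f₂)) ,
      trans e₂ (cong suc e) , λ x x≢m → trans (f₂ x x≢m) (f x x≢m)
    compile-ok (bind t b) ρ v m s R with compile-ok t ρ v m s R
    ... | s₁ , ex₁ , U₁@(e₁ , f₁) with compile-ok b (ρ ▸ m) (v ▸ eval t v) (suc m) s₁ (ready-▸ R U₁)
    ...   | s₂ , ex₂ , e₂ , f₂ with replace-ok (suc m) m s₂ 1+n≢n
    ...     | s₃ , ex₃ , er , em , f₃ =
      s₃ ,
      exec-⨾ K u {compile t ρ m} {w' = world s₁ po ou} ex₁
        (exec-⨾ K u {compile b (ρ ▸ m) (suc m)} {clear m ⨾ move (suc m) m} {w' = world s₂ po ou} ex₂ ex₃) ,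
      trans em e₂ , frame
      where
      frame : ∀ x → x ≢ m → s₃ x ≡ s x
      frame x x≢m with x ≟ suc m
      ... | yes refl = trans er (sym (free R (suc m) (n≤1+n m)))
      ... | no x≢    = trans (f₃ x x≢ x≢m) (trans (f₂ x x≢) (f₁ x x≢m))
    compile-ok (rec c z b) ρ v m s R with compile-ok c ρ v m s R
    ... | s₁ , ex₁ , e₁ , f₁ with compile-ok z ρ v (2 + m) s₁ record
            { below = λ i → m<n⇒m<1+n (m<n⇒m<1+n (below R i))
            ; agree = λ i → trans (f₁ (ρ i) (<⇒≢ (below R i))) (agree R i)
            ; free  = λ x m<x → trans (f₁ x (>⇒≢ (<-trans ≤-refl m<x))) (free R x (<⇒≤ (<-trans ≤-refl m<x))) }
    ... | s₂ , ex₂ , e₂ , f₂ with while-slot {dec m ⨾ compile b ρ' (3 + m) ⨾ (clear (2 + m) ⨾ move (3 + m) (2 + m)) ⨾ inc (suc m)}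
                                     m Inv (λ n _ → proj₁) body (eval c v) s₂ init
      where
      ρ' = ρ ▸ suc m ▸ 2 + m
      value = natrec (eval z v) (λ i a → eval b (v ▸ i ▸ a))
      Inv : ℕ → Store → Set
      Inv n s' = s' m ≡ n × s' (suc m) + n ≡ eval c v × s' (2 + m) ≡ value (s' (suc m)) ×
                 (∀ x → x ≢ m → x ≢ suc m → x ≢ 2 + m → s' x ≡ s x)
      s₂-idx : s₂ (suc m) ≡ 0
      s₂-idx = trans (f₂ (suc m) (<⇒≢ ≤-refl)) (trans (f₁ (suc m) 1+n≢n) (free R (suc m) (n≤1+n m)))
      init : Inv (eval c v) s₂
      init = trans (f₂ m (<⇒≢ (n≤1+n _))) e₁ , cong (_+ eval c v) s₂-idx , trans e₂ (cong value (sym s₂-idx)) ,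
             λ x x≢m _ x≢2+m → trans (f₂ x x≢2+m) (f₁ x x≢m)
      body : ∀ n s' → Inv (suc n) s' → ∃ λ s'' →
        ExecS (dec m ⨾ compile b ρ' (3 + m) ⨾ (clear (2 + m) ⨾ move (3 + m) (2 + m)) ⨾ inc (suc m)) s' s'' × Inv n s''
      body n s' (em , hi , ha , f) with upd-Upd s' m n
      ... | g₁ , h₁ with compile-ok b ρ' (v ▸ s' (suc m) ▸ s' (2 + m)) (3 + m) (upd s' m n) record
              { below = λ { zero → ≤-refl ; (suc zero) → n≤1+n _
                          ; (suc (suc i)) → m<n⇒m<1+n (m<n⇒m<1+n (m<n⇒m<1+n (below R i))) }
              ; agree = λ { zero → h₁ (2 + m) (>⇒≢ (n≤1+n _)) ; (suc zero) → h₁ (suc m) 1+n≢n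
                          ; (suc (suc i)) → trans (h₁ (ρ i) (<⇒≢ (below R i)))
                              (trans (f (ρ i) (<⇒≢ (below R i)) (<⇒≢ (m<n⇒m<1+n (below R i)))
                                 (<⇒≢ (m<n⇒m<1+n (m<n⇒m<1+n (below R i))))) (agree R i)) }
              ; free  = λ x m<x → trans (h₁ x (>⇒≢ (<⇒≤ (<⇒≤ m<x))))
                  (trans (f x (>⇒≢ (<⇒≤ (<⇒≤ m<x))) (>⇒≢ (<⇒≤ m<x)) (>⇒≢ m<x))
                         (free R x (<⇒≤ (<⇒≤ (<⇒≤ m<x))))) }
      ...   | s'₂ , x₂ , g₂ , h₂ with replace-ok (3 + m) (2 + m) s'₂ 1+n≢n
      ...     | s'₃ , x₃ , gr , gm , h₃ with upd-Upd s'₃ (suc m) (suc (s'₃ (suc m)))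
      ...       | g₄ , h₄ =
        s'₄ ,
        exec-⨾ K u {dec m} {w' = world (upd s' m n) po ou} (exec-dec K u m n em (g₁ , h₁))
          (exec-⨾ K u {compile b ρ' (3 + m)} {w' = world s'₂ po ou} x₂
            (exec-⨾ K u {clear (2 + m) ⨾ move (3 + m) (2 + m)} {w' = world s'₃ po ou} x₃ (exec-inc K u (suc m) (g₄ , h₄)))) ,
        trans (h₄ m (<⇒≢ ≤-refl)) (trans (low m (<⇒≢ (n≤1+n _)) (<⇒≢ (<⇒≤ (n≤1+n _)))) g₁) ,
        trans (cong (_+ n) idx) (trans (sym (+-suc (s' (suc m)) n)) hi) ,
        trans (h₄ (2 + m) 1+n≢n) (trans gm (trans g₂ (trans (cong (λ a → eval b (v ▸ s' (suc m) ▸ a)) ha) (cong value (sym idx))))) ,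
        frame
        where
        s'₄ = upd s'₃ (suc m) (suc (s'₃ (suc m)))
        low : ∀ x → x ≢ 2 + m → x ≢ 3 + m → s'₃ x ≡ upd s' m n x
        low x p q = trans (h₃ x q p) (h₂ x q)
        idx : s'₄ (suc m) ≡ suc (s' (suc m))
        idx = trans g₄ (cong suc (trans (low (suc m) (<⇒≢ ≤-refl) (<⇒≢ (n≤1+n _))) (h₁ (suc m) 1+n≢n)))
        frame : ∀ x → x ≢ m → x ≢ suc m → x ≢ 2 + m → s'₄ x ≡ s x
        frame x p q r with x ≟ 3 + m
        ... | yes refl = trans (h₄ x q) (trans gr (sym (free R x (<⇒≤ (<⇒≤ (n≤1+n _))))))
        ... | no y     = trans (h₄ x q) (trans (low x r y) (trans (h₁ x p) (f x p q r)))
    ... | s₃ , ex₃ , e₃ , h₃ , a₃ , f₃ with clear-ok (suc m) s₃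
    ... | s₄ , ex₄ , e₄ , f₄ with move-ok (2 + m) m s₄ (>⇒≢ (n≤1+n _)) (trans (f₄ m (<⇒≢ ≤-refl)) e₃)
    ... | s₅ , ex₅ , er , em , f₅ =
      s₅ ,
      exec-⨾ K u {compile c ρ m} {w' = world s₁ po ou} ex₁
        (exec-⨾ K u {compile z ρ (2 + m)} {w' = world s₂ po ou} ex₂
          (exec-⨾ K u {while (positive m) _} {w' = world s₃ po ou} ex₃
            (exec-⨾ K u {clear (suc m)} {w' = world s₄ po ou} ex₄ ex₅))) ,
      trans em (trans (f₄ (2 + m) 1+n≢n) (trans a₃
        (cong (natrec (eval z v) (λ i a → eval b (v ▸ i ▸ a))) (trans (sym (+-identityʳ _)) h₃)))) ,
      frame
      where
      frame : ∀ x → x ≢ m → s₅ x ≡ s x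
      frame x x≢m with x ≟ suc m | x ≟ 2 + m
      ... | _        | yes refl = trans er (sym (free R x (≤-trans (n≤1+n _) (n≤1+n _))))
      ... | yes refl | no p     = trans (f₅ x p x≢m) (trans e₄ (sym (free R x (n≤1+n _))))
      ... | no q     | no p     = trans (f₅ x p x≢m) (trans (f₄ x q) (f₃ x x≢m q p))
    compile-ok (ren σ t) ρ v m s R = compile-ok t (ρ ∘ σ) (v ∘ σ) m s record
      { below = below R ∘ σ ; agree = agree R ∘ σ ; free = free R }

-- Gödel numbering of lists and pairs

-- The square separates different sums, and the summand `a` separates pairs of equal sum. The
-- successor keeps 0 free for the empty list and makes both components strictly smaller than the
-- code, which bounds the search in `unpair`.
pairing : ℕ → ℕ → ℕ
pairing a b = suc ((a + b) * (a + b) + a)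

left<pairing : ∀ a b → a < pairing a b
left<pairing a b = s≤s (m≤n+m a _)

right<pairing : ∀ a b → b < pairing a b
right<pairing a b = s≤s (≤-trans (m≤n+m b a) (≤-trans (square (a + b)) (m≤m+n _ a)))
  where
  square : ∀ n → n ≤ n * n
  square zero    = z≤n
  square (suc n) = m≤m*n (suc n) (suc n)

-- (a + b)² ≤ pairing a b − 1 < (a + b + 1)², so the sum a + b is determined by the code.
pairing-sum-≤ : ∀ {a b a' b'} → a + b < a' + b' → pairing a b < pairing a' b'
pairing-sum-≤ {a} {b} {a'} {b'} s<s' = s≤s (begin-strict
  (a + b) * (a + b) + a         ≤⟨ +-monoʳ-≤ _ (m≤m+n a b) ⟩
  (a + b) * (a + b) + (a + b)   ≡⟨ +-comm _ (a + b) ⟩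
  suc (a + b) * (a + b)         <⟨ *-monoʳ-< (suc (a + b)) (n<1+n (a + b)) ⟩
  suc (a + b) * suc (a + b)     ≤⟨ *-mono-≤ s<s' s<s' ⟩
  (a' + b') * (a' + b')         ≤⟨ m≤m+n _ a' ⟩
  (a' + b') * (a' + b') + a'    ∎)
  where open ≤-Reasoning

pairing-injective : ∀ {a b a' b'} → pairing a b ≡ pairing a' b' → a ≡ a' × b ≡ b'
pairing-injective {a} {b} {a'} {b'} eq with <-cmp (a + b) (a' + b')
... | tri< l _ _ = ⊥-elim (<⇒≢ (pairing-sum-≤ {a} {b} {a'} {b'} l) eq)
... | tri> _ _ l = ⊥-elim (<⇒≢ (pairing-sum-≤ {a'} {b'} {a} {b} l) (sym eq))
... | tri≈ _ e _ = a≡a' , +-cancelˡ-≡ a b b' (trans e (cong (_+ b') (sym a≡a')))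
  where
  a≡a' : a ≡ a'
  a≡a' = +-cancelˡ-≡ ((a + b) * (a + b)) a a'
           (trans (suc-injective eq) (cong (λ n → n * n + a') (sym e)))

natrec-search : {A : Set} (P : ℕ → Bool) (f : ℕ → A → A) (N i : ℕ) (z : A) →
  (∀ j → j ≢ i → P j ≡ false) → P i ≡ true → i < N →
  natrec z (λ j a → if P j then f j a else a) N ≡ f i z
natrec-search P f (suc N) i z off on i<N with m<1+n⇒m<n∨m≡n i<N
... | inj₁ i<N' rewrite off N (>⇒≢ i<N') = natrec-search P f N i z off on i<N'
... | inj₂ refl rewrite on = cong (f i) (idle N ≤-refl)
  where
  idle : ∀ M → M ≤ N → natrec z (λ j a → if P j then f j a else a) M ≡ z
  idle zero    _   = refl
  idle (suc M) M<i rewrite off M (<⇒≢ M<i) = idle M (<⇒≤ M<i)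

natrec-idle : {A : Set} (f : ℕ → A → A) (N : ℕ) (z : A) → (∀ j a → f j a ≡ a) → natrec z f N ≡ z
natrec-idle f zero    z h = refl
natrec-idle f (suc N) z h = trans (h N _) (natrec-idle f N z h)

-- Decoding by bounded double search: both components lie below the code and only one pair has it.
-- The argument `f` selects what to return for the pair found.
unpair : (ℕ → ℕ → ℕ) → ℕ → ℕ
unpair f n = natrec 0 (λ a r → natrec r (λ b r' → if pairing a b ≡ᵇ n then f a b else r') n) n

natrec-cong : {A : Set} (f g : ℕ → A → A) (N : ℕ) (z : A) → (∀ j a → f j a ≡ g j a) → natrec z f N ≡ natrec z g N
natrec-cong f g zero    z h = refl
natrec-cong f g (suc N) z h = trans (h N _) (cong (g N) (natrec-cong f g N z h))

unpair-pairing : ∀ f a b → unpair f (pairing a b) ≡ f a b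
unpair-pairing f a b = trans
  (natrec-cong _ (λ j r → if j ≡ᵇ a then f a b else r) n 0 inner)
  (natrec-search (_≡ᵇ a) (λ _ _ → f a b) n a 0 (λ j → ≡ᵇ-false j a) (≡ᵇ-refl a) (left<pairing a b))
  where
  n = pairing a b
  inner : ∀ j r → natrec r (λ b' r' → if pairing j b' ≡ᵇ n then f j b' else r') n ≡ (if j ≡ᵇ a then f a b else r)
  inner j r with j ≟ a
  ... | yes refl rewrite ≡ᵇ-refl j =
    natrec-search (λ b' → pairing j b' ≡ᵇ n) (λ b' _ → f j b') n b r
      (λ b' b'≢b → ≡ᵇ-false (pairing j b') n (λ e → b'≢b (proj₂ (pairing-injective {j} {b'} {a} {b} e))))
      (≡ᵇ-refl n) (right<pairing a b)
  ... | no j≢a rewrite ≡ᵇ-false j a j≢a =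
    natrec-idle _ n r (λ b' r' → cong (λ c → if c then f j b' else r')
      (≡ᵇ-false (pairing j b') n (λ e → j≢a (proj₁ (pairing-injective {j} {b'} {a} {b} e)))))

-- Typed primitive recursive functions on codes.

data Ty : Set where
  bool nat : Ty
  _⊗_      : Ty → Ty → Ty
  list     : Ty → Ty

infixr 6 _⊗_

⟦_⟧ : Ty → Set
⟦ bool ⟧  = Bool
⟦ nat ⟧   = ℕ
⟦ A ⊗ B ⟧ = ⟦ A ⟧ × ⟦ B ⟧
⟦ list A ⟧ = List ⟦ A ⟧

gödel : (A : Ty) → ⟦ A ⟧ → ℕ
gödel bool     false    = 0
gödel bool     true     = 1
gödel nat      n        = n
gödel (A ⊗ B)  (a , b)  = pairing (gödel A a) (gödel B b)
gödel (list A) []       = 0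
gödel (list A) (a ∷ as) = pairing (gödel A a) (gödel (list A) as)

gödel-injective : ∀ A {a a'} → gödel A a ≡ gödel A a' → a ≡ a'
gödel-injective bool {false} {false} e = refl
gödel-injective bool {true}  {true}  e = refl
gödel-injective nat e = e
gödel-injective (A ⊗ B) {a , b} {a' , b'} e =
  let (p , q) = pairing-injective {gödel A a} {gödel B b} {gödel A a'} {gödel B b'} e
  in cong₂ _,_ (gödel-injective A p) (gödel-injective B q)
gödel-injective (list A) {[]} {[]} e = refl
gödel-injective (list A) {a ∷ as} {a' ∷ as'} e =
  let (p , q) = pairing-injective {gödel A a} {gödel (list A) as} {gödel A a'} {gödel (list A) as'} e
  in cong₂ _∷_ (gödel-injective A p) (gödel-injective (list A) q)

length≤gödel : ∀ A l → length l ≤ gödel (list A) l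
length≤gödel A []       = z≤n
length≤gödel A (a ∷ as) = ≤-<-trans (length≤gödel A as) (right<pairing (gödel A a) _)

Env : List Ty → Set
Env []      = ⊤
Env (A ∷ Γ) = ⟦ A ⟧ × Env Γ

Codes : {Γ : List Ty} → Env Γ → (Fin (length Γ) → ℕ) → Set
Codes {[]}    _       v = ⊤
Codes {A ∷ Γ} (a , γ) v = (v zero ≡ gödel A a) × Codes γ (v ∘ suc)

-- A function travels together with a term computing it on codes, so correctness of the code comes
-- by construction. `as` exchanges the function for a pointwise equal one that is easier to reason
-- about.
record PR (Γ : List Ty) (A : Ty) : Set where
  field
    fun  : Env Γ → ⟦ A ⟧
    code : Tm (length Γ)
    ok   : ∀ γ v → Codes γ v → eval code v ≡ gödel A (fun γ)
open PR public

module _ where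

  private variable
    Γ Γ' : List Ty
    A B C : Ty

  as : (t : PR Γ A) (g : Env Γ → ⟦ A ⟧) → (∀ γ → fun t γ ≡ g γ) → PR Γ A
  as {A = A} t g h = record { fun = g ; code = code t ; ok = λ γ v e → trans (ok t γ v e) (cong (gödel A) (h γ)) }

  gödelᵖ : PR Γ A → PR Γ nat
  gödelᵖ {A = A} t = record { fun = gödel A ∘ fun t ; code = code t ; ok = ok t }

  renᵖ : (σ : Fin (length Γ) → Fin (length Γ')) (g : Env Γ' → Env Γ) → (∀ δ v → Codes δ v → Codes (g δ) (v ∘ σ)) →
         PR Γ A → PR Γ' A
  renᵖ σ g h t = record { fun = fun t ∘ g ; code = ren σ (code t) ; ok = λ δ v e → ok t (g δ) (v ∘ σ) (h δ v e) }

  wk : PR Γ A → PR (B ∷ Γ) A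
  wk = renᵖ suc proj₂ (λ _ _ → proj₂)

  wk₁ : PR (B ∷ Γ) A → PR (B ∷ C ∷ Γ) A
  wk₁ = renᵖ (λ { zero → zero ; (suc i) → suc (suc i) }) (λ (b , _ , γ) → b , γ) (λ _ _ (p , _ , q) → p , q)

  v₀ : PR (A ∷ Γ) A
  v₀ = record { fun = proj₁ ; code = var zero ; ok = λ _ _ → proj₁ }

  v₁ : PR (A ∷ B ∷ Γ) B
  v₁ = wk v₀

  v₂ : PR (A ∷ B ∷ C ∷ Γ) C
  v₂ = wk v₁

  letᵖ : PR Γ A → PR (A ∷ Γ) B → PR Γ B
  letᵖ t b = record
    { fun  = λ γ → fun b (fun t γ , γ)
    ; code = bind (code t) (code b)
    ; ok   = λ γ v e → ok b _ _ (ok t γ v e , e) }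

  zeroᵖ : PR Γ nat
  zeroᵖ = record { fun = λ _ → 0 ; code = ze ; ok = λ _ _ _ → refl }

  sucᵖ : PR Γ nat → PR Γ nat
  sucᵖ t = record { fun = suc ∘ fun t ; code = su (code t) ; ok = λ γ v e → cong suc (ok t γ v e) }

  litᵖ : ℕ → PR Γ nat
  litᵖ n = record { fun = λ _ → n ; code = numeral n ; ok = λ γ v _ → numeral-ok n v }
    where
    numeral : ∀ {k} → ℕ → Tm k
    numeral zero    = ze
    numeral (suc n) = su (numeral n)
    numeral-ok : ∀ {k} n (v : Fin k → ℕ) → eval (numeral n) v ≡ n
    numeral-ok zero    v = refl
    numeral-ok (suc n) v = cong suc (numeral-ok n v)

  recᵖ : PR Γ nat → PR Γ A → PR (A ∷ nat ∷ Γ) A → PR Γ A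
  recᵖ {Γ} {A} c z s = record
    { fun  = λ γ → natrec (fun z γ) (λ i a → fun s (a , i , γ)) (fun c γ)
    ; code = rec (code c) (code z) (code s)
    ; ok   = λ γ v e → subst (λ n → eval (rec (code c) (code z) (code s)) v ≡ gödel A (natrec (fun z γ) (λ i a → fun s (a , i , γ)) n))
                         (ok c γ v e) (go γ v e (eval (code c) v)) }
    where
    go : ∀ γ v → Codes γ v → ∀ n →
         natrec (eval (code z) v) (λ i a → eval (code s) (v ▸ i ▸ a)) n ≡
         gödel A (natrec (fun z γ) (λ i a → fun s (a , i , γ)) n)
    go γ v e zero    = ok z γ v e
    go γ v e (suc n) = ok s _ _ (go γ v e n , refl , e)

  falseᵖ trueᵖ : PR Γ bool
  falseᵖ = record { fun = λ _ → false ; code = ze ; ok = λ _ _ _ → refl }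
  trueᵖ  = record { fun = λ _ → true ; code = su ze ; ok = λ _ _ _ → refl }

  -- Truth values have codes 0 and 1, so a recursion of at most one round selects the branch; the
  -- renaming skips its index and accumulator.
  ifᵖ : PR Γ bool → PR Γ A → PR Γ A → PR Γ A
  ifᵖ {Γ} {A} b t e = record
    { fun  = λ γ → if fun b γ then fun t γ else fun e γ
    ; code = rec (code b) (code e) (ren (λ i → suc (suc i)) (code t))
    ; ok   = λ γ v c → trans (cong (natrec (eval (code e) v) (λ _ _ → eval (code t) v)) (ok b γ v c)) (cases γ v c (fun b γ)) }
    where
    cases : ∀ γ v → Codes γ v → ∀ x → natrec (eval (code e) v) (λ _ _ → eval (code t) v) (gödel bool x) ≡
                                     gödel A (if x then fun t γ else fun e γ)
    cases γ v c false = ok e γ v c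
    cases γ v c true  = ok t γ v c

  addᵖ mulᵖ monusᵖ : PR Γ nat → PR Γ nat → PR Γ nat
  addᵖ a b = as (recᵖ b a (sucᵖ v₀)) (λ γ → fun a γ + fun b γ) (λ γ → lemma (fun a γ) (fun b γ))
    where
    lemma : ∀ a b → natrec a (λ _ → suc) b ≡ a + b
    lemma a zero    = sym (+-identityʳ a)
    lemma a (suc b) = trans (cong suc (lemma a b)) (sym (+-suc a b))
  mulᵖ a b = as (recᵖ a zeroᵖ (addᵖ (wk (wk b)) v₀)) (λ γ → fun a γ * fun b γ) (λ γ → lemma (fun a γ) (fun b γ))
    where
    lemma : ∀ a b → natrec 0 (λ _ x → b + x) a ≡ a * b
    lemma zero    b = refl
    lemma (suc a) b = cong (b +_) (lemma a b)
  monusᵖ a b = as (recᵖ b a (recᵖ v₀ zeroᵖ v₁)) (λ γ → fun a γ ∸ fun b γ) (λ γ → lemma (fun a γ) (fun b γ))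
    where
    predecessor : ∀ n → natrec 0 (λ i _ → i) n ≡ pred n
    predecessor zero    = refl
    predecessor (suc n) = refl
    lemma : ∀ a b → natrec a (λ _ x → natrec 0 (λ i _ → i) x) b ≡ a ∸ b
    lemma a zero    = refl
    lemma a (suc b) = trans (predecessor (natrec a _ b)) (trans (cong pred (lemma a b)) (pred[m∸n]≡m∸[1+n] a b))

  eqᵖ : PR Γ A → PR Γ A → PR Γ bool
  eqᵖ {A = A} s t = as (recᵖ (addᵖ (monusᵖ (gödelᵖ s) (gödelᵖ t)) (monusᵖ (gödelᵖ t) (gödelᵖ s))) trueᵖ falseᵖ)
                       (λ γ → gödel A (fun s γ) ≡ᵇ gödel A (fun t γ)) (λ γ → lemma (gödel A (fun s γ)) (gödel A (fun t γ)))
    where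
    lemma : ∀ m n → natrec true (λ _ _ → false) ((m ∸ n) + (n ∸ m)) ≡ (m ≡ᵇ n)
    lemma zero    zero    = refl
    lemma zero    (suc n) = refl
    lemma (suc m) zero    = refl
    lemma (suc m) (suc n) = lemma m n

  pairingᵖ : PR Γ nat → PR Γ nat → PR Γ nat
  pairingᵖ a b = sucᵖ (addᵖ (mulᵖ (addᵖ a b) (addᵖ a b)) a)

  unpairᵖ : PR (nat ∷ nat ∷ nat ∷ nat ∷ Γ) nat → PR Γ nat → PR Γ nat
  unpairᵖ f n = recᵖ n zeroᵖ (recᵖ (wk (wk n)) v₀ (ifᵖ (eqᵖ (pairingᵖ (wk (wk v₁)) v₁) (wk (wk (wk (wk n))))) f v₀))

  fstᵖ : PR Γ (A ⊗ B) → PR Γ A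
  fstᵖ {A = A} {B} p = record
    { fun  = proj₁ ∘ fun p
    ; code = code (unpairᵖ (wk (wk v₁)) (gödelᵖ p))
    ; ok   = λ γ v e → trans (ok (unpairᵖ (wk (wk v₁)) (gödelᵖ p)) γ v e)
                             (unpair-pairing (λ a b → a) (gödel A (proj₁ (fun p γ))) (gödel B (proj₂ (fun p γ)))) }

  sndᵖ : PR Γ (A ⊗ B) → PR Γ B
  sndᵖ {A = A} {B} p = record
    { fun  = proj₂ ∘ fun p
    ; code = code (unpairᵖ v₁ (gödelᵖ p))
    ; ok   = λ γ v e → trans (ok (unpairᵖ v₁ (gödelᵖ p)) γ v e)
                             (unpair-pairing (λ a b → b) (gödel A (proj₁ (fun p γ))) (gödel B (proj₂ (fun p γ)))) }

  pairᵖ : PR Γ A → PR Γ B → PR Γ (A ⊗ B)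
  pairᵖ s t = record
    { fun  = λ γ → fun s γ , fun t γ
    ; code = code (pairingᵖ (gödelᵖ s) (gödelᵖ t))
    ; ok   = ok (pairingᵖ (gödelᵖ s) (gödelᵖ t)) }

  nilᵖ : PR Γ (list A)
  nilᵖ = record { fun = λ _ → [] ; code = ze ; ok = λ _ _ _ → refl }

  consᵖ : PR Γ A → PR Γ (list A) → PR Γ (list A)
  consᵖ s t = record
    { fun  = λ γ → fun s γ ∷ fun t γ
    ; code = code (pairingᵖ (gödelᵖ s) (gödelᵖ t))
    ; ok   = ok (pairingᵖ (gödelᵖ s) (gödelᵖ t)) }

  listcase : {X Y : Set} → List X → Y → (X → List X → Y) → Y
  listcase []       n c = n
  listcase (x ∷ xs) n c = c x xs

  -- A non-empty list has the same code as the pair of its head and its tail.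
  caseᵖ : PR Γ (list A) → PR Γ B → PR (A ∷ list A ∷ Γ) B → PR Γ B
  caseᵖ {Γ} {A} {B} l n c = record
    { fun  = λ γ → listcase (fun l γ) (fun n γ) (λ a as → fun c (a , as , γ))
    ; code = rec (code l) (code n) (ren (λ i → suc (suc i)) (bind (code tail) (bind (ren suc (code head)) (code c))))
    ; ok   = λ γ v e → cases γ v e (fun l γ) (ok l γ v e) }
    where
    head tail : PR Γ nat
    head = unpairᵖ (wk (wk v₁)) (gödelᵖ l)
    tail = unpairᵖ v₁ (gödelᵖ l)
    cases : ∀ γ v → Codes γ v → ∀ xs → eval (code l) v ≡ gödel (list A) xs →
      natrec (eval (code n) v) (λ _ _ → eval (code c) (v ▸ eval (code tail) v ▸ eval (code head) v)) (eval (code l) v) ≡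
      gödel B (listcase xs (fun n γ) (λ a as → fun c (a , as , γ)))
    cases γ v e [] q rewrite q = ok n γ v e
    cases γ v e (x ∷ xs) q =
      trans (cong (natrec (eval (code n) v) (λ _ _ → eval (code c) (v ▸ eval (code tail) v ▸ eval (code head) v))) q)
        (ok c (x , xs , γ) _
           ( trans (ok head γ v e) (trans (cong (unpair (λ a b → a)) whole) (unpair-pairing (λ a b → a) (gödel A x) _))
           , trans (ok tail γ v e) (trans (cong (unpair (λ a b → b)) whole) (unpair-pairing (λ a b → b) (gödel A x) _))
           , e))
      where
      whole : gödel (list A) (fun l γ) ≡ pairing (gödel A x) (gödel (list A) xs)
      whole = trans (sym (ok l γ v e)) q

  -- A recursion on numbers carries the rest of the list and the accumulator and pops one element
  -- per round. The code of the list serves as the number of rounds: it is at least the length, and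
  -- surplus rounds on the empty list change nothing.
  foldᵖ : PR Γ (list A) → PR Γ B → PR (A ∷ B ∷ Γ) B → PR Γ B
  foldᵖ {Γ} {A} {B} l z s =
    as (sndᵖ (recᵖ (gödelᵖ l) (pairᵖ l z)
                (caseᵖ (fstᵖ v₀) v₀ (pairᵖ v₁ (letᵖ (sndᵖ v₂) (renᵖ σ (λ (b , a , _ , _ , _ , γ) → a , b , γ)
                   (λ _ _ (p , q , _ , _ , _ , r) → q , p , r) s))))))
       (λ γ → foldl (λ b a → fun s (a , b , γ)) (fun z γ) (fun l γ))
       (λ γ → cong proj₂ (run (λ b a → fun s (a , b , γ)) (gödel (list A) (fun l γ)) (fun l γ) (fun z γ) (length≤gödel A (fun l γ))))
    where
    σ : Fin (2 + length Γ) → Fin (5 + length Γ)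
    σ zero          = suc zero
    σ (suc zero)    = zero
    σ (suc (suc i)) = suc (suc (suc (suc (suc i))))
    module _ (f : ⟦ B ⟧ → ⟦ A ⟧ → ⟦ B ⟧) where
      pop : List ⟦ A ⟧ × ⟦ B ⟧ → List ⟦ A ⟧ × ⟦ B ⟧
      pop st = listcase (proj₁ st) st (λ a as → as , f (proj₂ st) a)
      rotate : ∀ n st → natrec st (λ _ → pop) (suc n) ≡ natrec (pop st) (λ _ → pop) n
      rotate zero    st = refl
      rotate (suc n) st = cong pop (rotate n st)
      run : ∀ n l b → length l ≤ n → natrec (l , b) (λ _ → pop) n ≡ ([] , foldl f b l)
      run n       []       b p       = natrec-idle-at n
        where
        natrec-idle-at : ∀ n → natrec ([] , b) (λ _ → pop) n ≡ ([] , b)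
        natrec-idle-at zero    = refl
        natrec-idle-at (suc n) rewrite natrec-idle-at n = refl
      run (suc n) (a ∷ as) b (s≤s p) = trans (rotate n (a ∷ as , b)) (run n as (f b a) p)

-- Mealy machines on data words

module _ {nΣ nΓ : ℕ} where

  isLabel : Fin nΣ → Sym nΣ → Bool
  isLabel a (lt b) = toℕ a ≡ᵇ toℕ b
  isLabel a one    = false
  isLabel a sep    = false

  isOne : Sym nΣ → Bool
  isOne one    = true
  isOne (lt _) = false
  isOne sep    = false

  skip : Prog nΣ nΓ
  skip = while (input (λ _ → false)) adv

  -- The head stays on the label while the alternatives are tried in order; slot 1 counts the failed
  -- ones and so ends up holding the number of the label.
  readLabel : ∀ m → (Fin m → Fin nΣ) → Prog nΣ nΓ
  readLabel zero    f = skip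
  readLabel (suc m) f = branch (input (isLabel (f zero))) skip (inc 1 ⨾ readLabel m (f ∘ suc))

  readData : Prog nΣ nΓ
  readData = while (input isOne) (inc 2 ⨾ adv)

  -- Slot 1 holds the label plus one and is counted down through the alternatives, so it is 0 again
  -- when the label is written.
  writeLabel : ∀ m → (Fin m → Fin nΓ) → Prog nΣ nΓ
  writeLabel zero    f = skip
  writeLabel (suc m) f = dec 1 ⨾ branch (positive 1) (writeLabel m (f ∘ suc)) (write (lt (f zero)))

  writeData : Prog nΣ nΓ
  writeData = while (positive 2) (dec 2 ⨾ write one)

  module _ (K : ℕ) (u : ℕ → Sym nΣ) where

    private
      _↝⟨_⟩_ : World {nΣ} {nΓ} K → Prog nΣ nΓ → World {nΣ} {nΓ} K → Set
      w ↝⟨ p ⟩ w' = Exec K u p w w'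

    skip-ok : ∀ w → w ↝⟨ skip ⟩ w
    skip-ok w with exec-while K u {input (λ _ → false)} {adv} (λ n w' → n ≡ 0 × w' ≡ w)
                     (λ { .0 _ (refl , _) → refl }) (λ { n _ (() , _) }) 0 w (refl , refl)
    ... | _ , ex , _ , refl = ex

    readLabel-ok : ∀ {m} (f : Fin m → Fin nΣ) → (∀ {i j} → f i ≡ f j → i ≡ j) → ∀ i s po ou → u po ≡ lt (f i) →
      ∃ λ s' → (world s po ou ↝⟨ readLabel m f ⟩ world s' po ou) × Upd 1 (toℕ i + s 1) s s'
    readLabel-ok {suc m} f inj zero s po ou e =
      s , exec-branch-true K u {q = inc 1 ⨾ readLabel m (f ∘ suc)} (trans (cong (isLabel (f zero)) e) (≡ᵇ-refl (toℕ (f zero)))) (skip-ok _) , refl , λ _ _ → refl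
    readLabel-ok {suc m} f inj (suc i) s po ou e
      with upd-Upd s 1 (suc (s 1))
    ... | e₁ , f₁ with readLabel-ok (f ∘ suc) (λ h → Data.Fin.Properties.suc-injective (inj h)) i (upd s 1 (suc (s 1))) po ou e
    ...   | s' , ex , e₂ , f₂ =
      s' ,
      exec-branch-false K u {p = skip}
        (trans (cong (isLabel (f zero)) e)
               (≡ᵇ-false (toℕ (f zero)) (toℕ (f (suc i))) (λ h → 0≢1+i (inj (toℕ-injective h)))))
        (exec-⨾ K u {inc 1} {readLabel m (f ∘ suc)} (exec-inc K u 1 (e₁ , f₁)) ex) ,
      trans e₂ (+-suc (toℕ i) (s 1)) , λ x x≢1 → trans (f₂ x x≢1) (f₁ x x≢1)
      where
      0≢1+i : ∀ {n} {i : Fin n} → Fin.zero ≡ Fin.suc i → ⊥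
      0≢1+i ()

    readData-ok : ∀ d s po ou → s 2 ≡ 0 → (∀ m → m < d → u (m + po) ≡ one) → u (d + po) ≡ sep →
      ∃ λ s' → (world s po ou ↝⟨ readData ⟩ world s' (d + po) ou) × Upd 2 d s s'
    readData-ok d s po ou s2 ones end
      with exec-while K u {input isOne} {inc 2 ⨾ adv} Inv cond body d (world s po ou)
             (s , 0 , refl , refl , (s2 , λ _ _ → refl))
      where
      Inv : ℕ → World K → Set
      Inv n w = ∃ λ s' → ∃ λ m → m + n ≡ d × w ≡ world s' (m + po) ou × Upd 2 m s s'
      cond : ∀ n w → Inv n w → testW K u (input isOne) w ≡ (0 <ᵇ n)
      cond zero    _ (s' , m , e , refl , _) = cong isOne (subst (λ k → u (k + po) ≡ sep) (trans (sym e) (+-identityʳ m)) end)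
      cond (suc n) _ (s' , m , e , refl , _) = cong isOne (ones m (subst (m <_) e (m<m+n m (s≤s z≤n))))
      body : ∀ n w → Inv (suc n) w → ∃ λ w' → (w ↝⟨ inc 2 ⨾ adv ⟩ w') × Inv n w'
      body n _ (s' , m , e , refl , e₁ , f₁) with upd-Upd s' 2 (suc (s' 2))
      ... | e₂ , f₂ =
        world (upd s' 2 (suc (s' 2))) (suc m + po) ou , exec-⨾ K u {inc 2} {adv} (exec-inc K u 2 (e₂ , f₂)) (exec-adv K u) ,
        upd s' 2 (suc (s' 2)) , suc m , trans (sym (+-suc m n)) e , refl ,
        trans e₂ (cong suc e₁) , λ x p → trans (f₂ x p) (f₁ x p)
    ... | _ , ex , s' , m , e , refl , up with trans (sym (+-identityʳ m)) e
    ...   | refl = s' , ex , up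

    writeLabel-ok : ∀ {m} (f : Fin m → Fin nΓ) → ∀ i s po ou → s 1 ≡ suc (toℕ i) →
      ∃ λ s' → (world s po ou ↝⟨ writeLabel m f ⟩ world s' po (ou ∷ʳ lt (f i))) × Upd 1 0 s s'
    writeLabel-ok {suc m} f zero s po ou e with upd-Upd s 1 0
    ... | e₁ , f₁ = upd s 1 0 ,
      exec-⨾ K u {dec 1} (exec-dec K u 1 0 e (e₁ , f₁)) (exec-branch-false K u {p = writeLabel m (f ∘ suc)} refl (exec-write K u (lt (f zero)))) , e₁ , f₁
    writeLabel-ok {suc m} f (suc i) s po ou e with upd-Upd s 1 (suc (toℕ i))
    ... | e₁ , f₁ with writeLabel-ok (f ∘ suc) i (upd s 1 (suc (toℕ i))) po ou e₁
    ...   | s' , ex , e₂ , f₂ = s' ,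
      exec-⨾ K u {dec 1} (exec-dec K u 1 (suc (toℕ i)) e (e₁ , f₁)) (exec-branch-true K u {q = write (lt (f zero))} refl ex) ,
      e₂ , λ x p → trans (f₂ x p) (f₁ x p)

    writeData-ok : ∀ s po ou → ∃ λ s' → (world s po ou ↝⟨ writeData ⟩ world s' po (ou ++ replicateOne (s 2))) × Upd 2 0 s s'
    writeData-ok s po ou with exec-while K u {positive 2} {dec 2 ⨾ write one} Inv cond body (s 2) (world s po ou)
                                (s , ou , refl , (refl , λ _ _ → refl) , refl)
      where
      Inv : ℕ → World K → Set
      Inv n w = ∃ λ s' → ∃ λ o → w ≡ world s' po o × Upd 2 n s s' × o ++ replicateOne n ≡ ou ++ replicateOne (s 2)
      cond : ∀ n w → Inv n w → testW K u (positive 2) w ≡ (0 <ᵇ n)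
      cond n _ (_ , _ , refl , (e , _) , _) = cong (0 <ᵇ_) e
      body : ∀ n w → Inv (suc n) w → ∃ λ w' → (w ↝⟨ dec 2 ⨾ write one ⟩ w') × Inv n w'
      body n _ (s' , o , refl , (e , f) , h) with upd-Upd s' 2 n
      ... | e₁ , f₁ =
        world (upd s' 2 n) po (o ∷ʳ one) , exec-⨾ K u {dec 2} {write one} (exec-dec K u 2 n e (e₁ , f₁)) (exec-write K u one) ,
        upd s' 2 n , o ∷ʳ one , refl , (e₁ , λ x p → trans (f₁ x p) (f x p)) , trans (++-assoc o (one ∷ []) _) h
    ... | _ , ex , s' , o , refl , up , h with trans (sym (++-identityʳ o)) h
    ...   | refl = s' , ex , up

-- The output label is shifted by one; 0 means that nothing is written.
record Mealy (nΣ nΓ : ℕ) : Set where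
  field
    S         : Ty
    init      : PR [] S
    next      : PR (nat ∷ nat ∷ S ∷ []) S
    outLabel  : PR (S ∷ []) nat
    outData   : PR (S ∷ []) nat

  after : DataWord nΣ → ℕ → ⟦ S ⟧
  after x zero    = fun init _
  after x (suc n) = fun next (proj₂ (x n) , toℕ (proj₁ (x n)) , after x n , _)

  Emits : ⟦ S ⟧ → Maybe (Fin nΓ × ℕ) → Set
  Emits s nothing        = fun outLabel (s , _) ≡ 0
  Emits s (just (γ , e)) = fun outLabel (s , _) ≡ suc (toℕ γ) × fun outData (s , _) ≡ e

emission : {nΓ : ℕ} → Maybe (Fin nΓ × ℕ) → List (Sym nΓ)
emission nothing  = []
emission (just l) = encLetter l

emissions : {nΓ : ℕ} → (ℕ → Maybe (Fin nΓ × ℕ)) → ℕ → List (Sym nΓ)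
emissions ω zero    = []
emissions ω (suc n) = emissions ω n ++ emission (ω n)

-- The Turing machine of a Mealy machine.

module _ {nΣ nΓ : ℕ} (M : Mealy nΣ nΓ) where
  open Mealy M

  private
    -- Slot 0 carries the coded state from round to round, slots 1 and 2 receive the label and the
    -- datum just read. The order matches the context of `next`: datum, label, state.
    stepSlots : Fin 3 → ℕ
    stepSlots zero             = 2
    stepSlots (suc zero)       = 1
    stepSlots (suc (suc zero)) = 0

    stateSlot : Fin 1 → ℕ
    stateSlot _ = 0

    noSlots : Fin 0 → ℕ
    noSlots ()

    reading writing computing printing : Prog nΣ nΓ
    reading   = readLabel nΣ id ⨾ adv ⨾ readData ⨾ adv
    computing = compile (code next) stepSlots 3 ⨾ clear 1 ⨾ clear 2 ⨾ clear 0 ⨾ move 3 0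
    printing  = writeLabel nΓ id ⨾ writeData ⨾ write sep
    writing   = compile (code outLabel) stateSlot 1 ⨾ compile (code outData) stateSlot 2 ⨾ branch (positive 1) printing (clear 2)

    pre body : Prog nΣ nΓ
    pre  = compile (code init) noSlots 0
    body = reading ⨾ computing ⨾ writing

  mealyTM : TM nΣ nΓ
  mealyTM = machine pre body

  private module Round (K : ℕ) (x : DataWord nΣ) (ω : ℕ → Maybe (Fin nΓ × ℕ)) (emits : ∀ n → Emits (after x (suc n)) (ω n)) where

    u : ℕ → Sym nΣ
    u = enc x

    stateStore : ℕ → Store
    stateStore v = upd (λ _ → 0) 0 v

    L : ℕ → ℕ
    L n = length (encPrefix x n)

    L-suc : ∀ n → L (suc n) ≡ suc (proj₂ (x n) + suc (L n))
    L-suc n = trans (length-++ (encPrefix x n))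
      (trans (cong (λ k → L n + suc k) (ones-length {nΣ} (proj₂ (x n))))
        (trans (+-comm (L n) _) (cong suc (sym (+-suc (proj₂ (x n)) (L n))))))

    symbol : ∀ n m {y} → nth (encLetter (x n)) m ≡ just y → u (m + L n) ≡ y
    symbol n m {y} e = trans (cong u (+-comm m (L n))) (just-injective
      (trans (enc-letter x n m (nth-<length (encLetter (x n)) m e)) e))

    at : ℕ → World {nΣ} {nΓ} K
    at n = world (stateStore (gödel S (after x n))) (L n) (emissions ω n)

    reading-ok : ∀ n → ∃ λ s' →
      Exec K u reading (at n) (world s' (L (suc n)) (emissions ω n)) ×
      s' 0 ≡ gödel S (after x n) × s' 1 ≡ toℕ (proj₁ (x n)) × s' 2 ≡ proj₂ (x n) × (∀ r → 3 ≤ r → s' r ≡ 0)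
    reading-ok n with readLabel-ok {nΣ} {nΓ} K u id id (proj₁ (x n)) (World.store (at n)) (L n) (emissions ω n) (symbol n 0 refl)
    ... | s₁ , ex₁ , e₁ , f₁ with readData-ok {nΣ} {nΓ} K u (proj₂ (x n)) s₁ (suc (L n)) (emissions ω n) (f₁ 2 (λ ()))
            (λ m m<d → trans (cong u (+-suc m (L n))) (symbol n (suc m) (ones-nth (proj₂ (x n)) m m<d)))
            (trans (cong u (+-suc (proj₂ (x n)) (L n))) (symbol n (suc (proj₂ (x n))) (ones-sep (proj₂ (x n)))))
    ...   | s₂ , ex₂ , e₂ , f₂ =
      s₂ ,
      subst (λ k → Exec K u reading (at n) (world s₂ k (emissions ω n))) (sym (L-suc n))
        (exec-⨾ K u {readLabel nΣ id} ex₁ (exec-⨾ K u {adv} {readData ⨾ adv} (exec-adv K u)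
          (exec-⨾ K u {readData} {adv} ex₂ (exec-adv K u)))) ,
      trans (f₂ 0 (λ ())) (f₁ 0 (λ ())) ,
      trans (f₂ 1 (λ ())) (trans e₁ (+-identityʳ _)) ,
      e₂ ,
      λ { 1 (s≤s ()) ; 2 (s≤s (s≤s ())) ; (suc (suc (suc r))) _ → trans (f₂ (3 + r) (λ ())) (f₁ (3 + r) (λ ())) }

    computing-ok : ∀ n po ou s → s 0 ≡ gödel S (after x n) → s 1 ≡ toℕ (proj₁ (x n)) → s 2 ≡ proj₂ (x n) →
      (∀ r → 3 ≤ r → s r ≡ 0) →
      ∃ λ s' → Exec K u computing (world s po ou) (world s' po ou) ×
               s' 0 ≡ gödel S (after x (suc n)) × (∀ r → 1 ≤ r → s' r ≡ 0)
    computing-ok n po ou s h₀ h₁ h₂ h₃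
      with compile-ok K u po ou (code next) stepSlots
             (s ∘ stepSlots) 3 s
             record { below = λ { zero → ≤-refl ; (suc zero) → s≤s (s≤s z≤n) ; (suc (suc zero)) → s≤s z≤n }
                    ; agree = λ _ → refl ; free = h₃ }
    ... | s₁ , ex₁ , e₁ , f₁ with clear-ok K u po ou 1 s₁
    ...   | s₂ , ex₂ , e₂ , f₂ with clear-ok K u po ou 2 s₂
    ...     | s₃ , ex₃ , e₃ , f₃ with replace-ok K u po ou 3 0 s₃ (λ ())
    ...       | s₄ , ex₄ , e₄ , e₀ , f₄ =
      s₄ , exec-⨾ K u {compile (code next) stepSlots 3} ex₁ (exec-⨾ K u {clear 1} ex₂ (exec-⨾ K u {clear 2} {clear 0 ⨾ move 3 0} ex₃ ex₄)) ,
      trans e₀ (trans (f₃ 3 (λ ())) (trans (f₂ 3 (λ ())) (trans e₁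
        (ok next (proj₂ (x n) , toℕ (proj₁ (x n)) , after x n , _) (s ∘ stepSlots) (h₂ , h₁ , h₀ , _))))) ,
      λ { 1 _ → trans (f₄ 1 (λ ()) (λ ())) (trans (f₃ 1 (λ ())) e₂)
        ; 2 _ → trans (f₄ 2 (λ ()) (λ ())) e₃
        ; 3 _ → e₄
        ; (suc (suc (suc (suc r)))) _ → trans (f₄ (4 + r) (λ ()) (λ ())) (trans (f₃ (4 + r) (λ ()))
            (trans (f₂ (4 + r) (λ ())) (trans (f₁ (4 + r) (λ ())) (h₃ (4 + r) (s≤s (s≤s (s≤s z≤n))))))) }

    finishing : ∀ (st : ⟦ S ⟧) o → Emits st o → ∀ po ou s → s 0 ≡ gödel S st →
      s 1 ≡ fun outLabel (st , _) → s 2 ≡ fun outData (st , _) → (∀ r → 3 ≤ r → s r ≡ 0) →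
      ∃ λ s' → Exec K u (branch (positive 1) printing (clear 2)) (world s po ou) (world s' po (ou ++ emission o)) ×
               (∀ r → s' r ≡ stateStore (gödel S st) r)
    finishing st nothing em po ou s h₀ h₁ h₂ h₃ with clear-ok K u po ou 2 s
    ... | s' , ex , e , f =
      s' , subst (λ o → Exec K u (branch (positive 1) printing (clear 2)) (world s po ou) (world s' po o)) (sym (++-identityʳ ou))
             (exec-branch-false K u {p = printing} (cong (0 <ᵇ_) (trans h₁ em)) ex) ,
      λ { 0 → trans (f 0 (λ ())) h₀ ; 1 → trans (f 1 (λ ())) (trans h₁ em) ; 2 → e
        ; (suc (suc (suc r))) → trans (f (3 + r) (λ ())) (h₃ (3 + r) (s≤s (s≤s (s≤s z≤n)))) }
    finishing st (just (γ , e)) (eγ , ee) po ou s h₀ h₁ h₂ h₃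
      with writeLabel-ok {nΣ} {nΓ} K u id γ s po ou (trans h₁ eγ)
    ... | s₁ , ex₁ , e₁ , f₁ with writeData-ok K u s₁ po (ou ∷ʳ lt γ)
    ...   | s₂ , ex₂ , e₂ , f₂ =
      s₂ , subst (λ o → Exec K u (branch (positive 1) printing (clear 2)) (world s po ou) (world s₂ po o)) written
             (exec-branch-true K u {q = clear 2} (cong (0 <ᵇ_) (trans h₁ eγ))
               (exec-⨾ K u {writeLabel nΓ id} ex₁ (exec-⨾ K u {writeData} {write sep} ex₂ (exec-write K u sep)))) ,
      λ { 0 → trans (f₂ 0 (λ ())) (trans (f₁ 0 (λ ())) h₀) ; 1 → trans (f₂ 1 (λ ())) e₁ ; 2 → e₂
        ; (suc (suc (suc r))) → trans (f₂ (3 + r) (λ ())) (trans (f₁ (3 + r) (λ ())) (h₃ (3 + r) (s≤s (s≤s (s≤s z≤n))))) }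
      where
      written : ((ou ∷ʳ lt γ) ++ replicateOne (s₁ 2)) ∷ʳ sep ≡ ou ++ encLetter (γ , e)
      written = trans (cong (λ k → ((ou ∷ʳ lt γ) ++ replicateOne k) ∷ʳ sep) (trans (f₁ 2 (λ ())) (trans h₂ ee)))
        (trans (++-assoc (ou ∷ʳ lt γ) (replicateOne e) (sep ∷ [])) (++-assoc ou (lt γ ∷ []) _))

    writing-ok : ∀ n po ou s → s 0 ≡ gödel S (after x (suc n)) → (∀ r → 1 ≤ r → s r ≡ 0) →
      ∃ λ s' → Exec K u writing (world s po ou) (world s' po (ou ++ emission (ω n))) ×
               (∀ r → s' r ≡ stateStore (gödel S (after x (suc n))) r)
    writing-ok n po ou s h₀ h₁
      with compile-ok K u po ou (code outLabel) stateSlot (λ _ → s 0) 1 s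
             record { below = λ _ → s≤s z≤n ; agree = λ _ → refl ; free = h₁ }
    ... | s₁ , ex₁ , e₁ , f₁
      with compile-ok K u po ou (code outData) stateSlot (λ _ → s 0) 2 s₁
             record { below = λ _ → s≤s z≤n ; agree = λ _ → f₁ 0 (λ ())
                    ; free = λ { (suc (suc r)) _ → trans (f₁ (2 + r) (λ ())) (h₁ (2 + r) (s≤s z≤n)) ; 1 (s≤s ()) } }
    ...   | s₂ , ex₂ , e₂ , f₂
      with finishing (after x (suc n)) (ω n) (emits n) po ou s₂
             (trans (f₂ 0 (λ ())) (trans (f₁ 0 (λ ())) h₀))
             (trans (f₂ 1 (λ ())) (trans e₁ (ok outLabel (after x (suc n) , _) _ (h₀ , _))))
             (trans e₂ (ok outData (after x (suc n) , _) _ (h₀ , _)))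
             (λ { 1 (s≤s ()) ; 2 (s≤s (s≤s ())) ; (suc (suc (suc r))) _ → trans (f₂ (3 + r) (λ ())) (trans (f₁ (3 + r) (λ ())) (h₁ (3 + r) (s≤s z≤n))) })
    ...     | s₃ , ex₃ , h =
      s₃ , exec-⨾ K u {compile (code outLabel) stateSlot 1} ex₁ (exec-⨾ K u {compile (code outData) stateSlot 2} ex₂ ex₃) , h

    round : ∀ n → Exec K u body (at n) (at (suc n))
    round n =
      let (s₁ , ex₁ , a₀ , a₁ , a₂ , a₃) = reading-ok n
          (s₂ , ex₂ , b₀ , b₁)           = computing-ok n (L (suc n)) (emissions ω n) s₁ a₀ a₁ a₂ a₃
          (s₃ , ex₃ , h)                 = writing-ok n (L (suc n)) (emissions ω n) s₂ b₀ b₁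
      in exec-cong K u {body} {at n} {world s₃ (L (suc n)) (emissions ω (suc n))} {at (suc n)} h refl refl
           (exec-⨾ K u {reading} {computing ⨾ writing} {at n} {world s₁ (L (suc n)) (emissions ω n)}
             {world s₃ (L (suc n)) (emissions ω (suc n))} ex₁
             (exec-⨾ K u {computing} {writing} {world s₁ (L (suc n)) (emissions ω n)} {world s₂ (L (suc n)) (emissions ω n)}
               {world s₃ (L (suc n)) (emissions ω (suc n))} ex₂ ex₃))

    start : Exec K u pre (world (λ _ → 0) 0 []) (at 0)
    start with compile-ok K u 0 [] (code init) noSlots noSlots 0 (λ _ → 0)
                 record { below = λ () ; agree = λ () ; free = λ _ _ → refl }
    ... | s' , ex , e , f = exec-cong K u {pre} {w'' = at 0} agree refl refl ex
      where
      agree : ∀ r → s' r ≡ stateStore (gödel S (fun init _)) r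
      agree zero    = trans e (ok init _ noSlots _)
      agree (suc r) = f (suc r) (λ ())

  mealyTM-outs : (x : DataWord nΣ) (ω : ℕ → Maybe (Fin nΓ × ℕ)) → (∀ n → Emits (after x (suc n)) (ω n)) →
    ∀ n → ∃ λ k → Config.otape (conf mealyTM (enc x) k) ≡ emissions ω n
  mealyTM-outs x ω emits = machine-outs pre body (enc x) at start round
    where open Round _ x ω emits

  record Transduces (x : DataWord nΣ) (y : DataWord nΓ) : Set where
    field
      emitted   : ℕ → Maybe (Fin nΓ × ℕ)
      emits     : ∀ n → Emits (after x (suc n)) (emitted n)
      written   : ℕ → ℕ
      prefixes  : ∀ n → emissions emitted n ≡ encPrefix y (written n)
      unbounded : ∀ m → ∃ λ n → m ≤ written n

  mealy⇒computable : (G : DataWord nΣ → DataWord nΓ → Set) → (∀ x y → G x y → Transduces x y) → Computable G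
  mealy⇒computable G transduces = mealyTM , λ x y Gxy → converges (transduces x y Gxy)
    where
    converges : ∀ {x y} → Transduces x y → ∀ i → ∃ λ k₀ → ∀ k → k₀ ≤ k → OutAgree mealyTM x k i (enc y)
    converges {x} {y} T i = let (n , i≤) = unbounded i in
      eventually-OutAgree mealyTM x
        (≤-trans i≤ (encPrefix-length y (written n)) ,
         λ m m<i → enc-encPrefix y (written n) m (<-≤-trans m<i (≤-trans i≤ (encPrefix-length y (written n)))))
        (subst (λ l → ∃ λ t → Config.otape (conf mealyTM (enc x) t) ≡ l) (prefixes n) (mealyTM-outs x emitted emits n))
      where open Transduces T

-- The search for a refuting lasso

Letter : Ty
Letter = nat ⊗ nat

module _ {X : Set} where

  -- The list operations are phrased as left folds, the form computed by `foldᵖ`. Collected lists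
  -- serve as finite sets, so their order is immaterial; `push []` is also used to reverse a word.
  push : List X → List X → List X
  push ys xs = foldl (λ acc x → x ∷ acc) ys xs

  collect : {Y : Set} → (X → List Y) → List X → List Y
  collect f xs = foldl (λ acc x → foldl (λ acc' y → y ∷ acc') acc (f x)) [] xs

  exists : (X → Bool) → List X → Bool
  exists p xs = foldl (λ b x → if p x then true else b) false xs

below : ℕ → List ℕ
below = natrec [] (λ i l → i ∷ l)

dataSum : List (ℕ × ℕ) → ℕ
dataSum = foldl (λ s l → s + proj₂ l) 0

len : {X : Set} → List X → ℕ
len = foldl (λ n _ → suc n) 0

rest : {X : Set} → List X → List X
rest l = listcase l [] (λ _ t → t)

module _ {Γ : List Ty} where

  private variable
    A B : Ty

  pushᵖ : PR Γ (list A) → PR Γ (list A) → PR Γ (list A)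
  pushᵖ ys xs = foldᵖ xs ys (consᵖ v₀ v₁)

  collectᵖ : PR (A ∷ Γ) (list B) → PR Γ (list A) → PR Γ (list B)
  collectᵖ f xs = foldᵖ xs nilᵖ (foldᵖ (wk₁ f) v₁ (consᵖ v₀ v₁))

  existsᵖ : PR (A ∷ Γ) bool → PR Γ (list A) → PR Γ bool
  existsᵖ p xs = foldᵖ xs falseᵖ (ifᵖ (wk₁ p) trueᵖ v₁)

  belowᵖ : PR Γ nat → PR Γ (list nat)
  belowᵖ n = recᵖ n nilᵖ (consᵖ v₁ v₀)

  dataSumᵖ : PR Γ (list Letter) → PR Γ nat
  dataSumᵖ l = foldᵖ l zeroᵖ (addᵖ v₁ (sndᵖ v₀))

  lenᵖ : PR Γ (list A) → PR Γ nat
  lenᵖ l = foldᵖ l zeroᵖ (sucᵖ v₁)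

  powᵖ : PR Γ nat → (n : ℕ) → PR Γ nat
  powᵖ t zero    = litᵖ 1
  powᵖ t (suc n) = mulᵖ t (powᵖ t n)

  powᵖ-fun : ∀ t n γ → fun (powᵖ t n) γ ≡ fun t γ ^ n
  powᵖ-fun t zero    γ = refl
  powᵖ-fun t (suc n) γ = cong (fun t γ *_) (powᵖ-fun t n γ)

-- Tuples carry one dummy component at the end, so that tup 0 needs no unit type.
tup : ℕ → Ty
tup zero    = nat
tup (suc k) = nat ⊗ tup k

look : ∀ {k} → ⟦ tup k ⟧ → Fin k → ℕ
look (a , t) zero    = a
look (a , t) (suc r) = look t r

tab : ∀ {k} → (Fin k → ℕ) → ⟦ tup k ⟧
tab {zero}  f = 0
tab {suc k} f = f zero , tab (f ∘ suc)

module _ {Γ : List Ty} where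

  lookᵖ : ∀ {k} → PR Γ (tup k) → Fin k → PR Γ nat
  lookᵖ t zero    = fstᵖ t
  lookᵖ t (suc r) = lookᵖ (sndᵖ t) r

  lookᵖ-fun : ∀ {k} (t : PR Γ (tup k)) r γ → fun (lookᵖ t r) γ ≡ look (fun t γ) r
  lookᵖ-fun t zero    γ = refl
  lookᵖ-fun t (suc r) γ = lookᵖ-fun (sndᵖ t) r γ

  tabᵖ : ∀ {k} → (Fin k → PR Γ nat) → PR Γ (tup k)
  tabᵖ {zero}  f = zeroᵖ
  tabᵖ {suc k} f = pairᵖ (f zero) (tabᵖ (f ∘ suc))

  tabᵖ-fun : ∀ {k} (f : Fin k → PR Γ nat) (g : Fin k → ℕ) γ → (∀ r → fun (f r) γ ≡ g r) → fun (tabᵖ f) γ ≡ tab g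
  tabᵖ-fun {zero}  f g γ h = refl
  tabᵖ-fun {suc k} f g γ h = cong₂ _,_ (h zero) (tabᵖ-fun (f ∘ suc) (g ∘ suc) γ (h ∘ suc))

  satᵖ : ∀ {k} → PR Γ (tup k) → PR Γ nat → Test k → PR Γ bool
  satᵖ τ d tt        = trueᵖ
  satᵖ τ d ff        = falseᵖ
  satᵖ τ d (req r)   = eqᵖ (lookᵖ τ r) d
  satᵖ τ d (rneq r)  = ifᵖ (eqᵖ (lookᵖ τ r) d) falseᵖ trueᵖ
  satᵖ τ d (neg φ)   = ifᵖ (satᵖ τ d φ) falseᵖ trueᵖ
  satᵖ τ d (and φ ψ) = ifᵖ (satᵖ τ d φ) (satᵖ τ d ψ) falseᵖ
  satᵖ τ d (or φ ψ)  = ifᵖ (satᵖ τ d φ) trueᵖ (satᵖ τ d ψ)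

  private
    if-not : ∀ b → (if b then false else true) ≡ not b
    if-not false = refl
    if-not true  = refl

    if-and : ∀ b c → (if b then c else false) ≡ b ∧ c
    if-and false c = refl
    if-and true  c = refl

    if-or : ∀ b c → (if b then true else c) ≡ b ∨ c
    if-or false c = refl
    if-or true  c = refl

  satᵖ-fun : ∀ {k} (τ : PR Γ (tup k)) d φ γ → fun (satᵖ τ d φ) γ ≡ sat (look (fun τ γ)) (fun d γ) φ
  satᵖ-fun τ d tt        γ = refl
  satᵖ-fun τ d ff        γ = refl
  satᵖ-fun τ d (req r)   γ = cong (_≡ᵇ fun d γ) (lookᵖ-fun τ r γ)
  satᵖ-fun τ d (rneq r)  γ = trans (if-not _) (cong (λ n → not (n ≡ᵇ fun d γ)) (lookᵖ-fun τ r γ))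
  satᵖ-fun τ d (neg φ)   γ = trans (if-not _) (cong not (satᵖ-fun τ d φ γ))
  satᵖ-fun τ d (and φ ψ) γ = trans (if-and (fun (satᵖ τ d φ) γ) _) (cong₂ _∧_ (satᵖ-fun τ d φ γ) (satᵖ-fun τ d ψ γ))
  satᵖ-fun τ d (or φ ψ)  γ = trans (if-or (fun (satᵖ τ d φ) γ) _) (cong₂ _∨_ (satᵖ-fun τ d φ γ) (satᵖ-fun τ d ψ γ))

module Search {nΣ nΓ : ℕ} (A : NRT nΣ nΓ) (d₀ : ℕ) where
  open NRT A

  Transition : Set
  Transition = Trans nΣ nΓ nQ k

  -- A node consists of a state, a position in the target w, and a register valuation.  The position is the number
  -- of letters of w matched by the output so far, or suc (len w) once the output has deviated from w.
  Node : Ty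
  Node = tup (2 + k)

  -- Dropping `i` letters leaves nothing both when `w` is fully matched and when a deviation is
  -- recorded, so the positions `len w` and `suc (len w)` are absorbing.
  track : List (ℕ × ℕ) → ℕ → ℕ × ℕ → ℕ
  track w i l = listcase (natrec w (λ _ → rest) i) i
                  (λ c _ → if gödel Letter c ≡ᵇ gödel Letter l then suc i else suc (len w))

  assign : Transition → ℕ → ⟦ tup k ⟧ → ⟦ tup k ⟧
  assign t d τ = tab (λ r → if Trans.asgn t r then d else look τ r)

  trackAll : List (ℕ × ℕ) → ⟦ tup k ⟧ → ℕ → List (Fin nΓ × Fin k) → ℕ
  trackAll w τ i []            = i
  trackAll w τ i ((γ , r) ∷ o) = trackAll w τ (track w i (toℕ γ , look τ r)) o

  fire : List (ℕ × ℕ) → Transition → ℕ → ⟦ Node ⟧ → ⟦ Node ⟧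
  fire w t d (q , i , τ) = toℕ (Trans.tgt t) , trackAll w (assign t d τ) i (Trans.out t) , assign t d τ

  enabled : Transition → ℕ × ℕ → ⟦ Node ⟧ → Bool
  enabled t (a , d) (q , i , τ) =
    if q ≡ᵇ toℕ (Trans.src t) then (if a ≡ᵇ toℕ (Trans.lab t) then sat (look τ) d (Trans.test t) else false) else false

  moves : List (ℕ × ℕ) → List Transition → ℕ × ℕ → ⟦ Node ⟧ → List ⟦ Node ⟧
  moves w []       l n = []
  moves w (t ∷ ts) l n = if enabled t l n then fire w t (proj₂ l) n ∷ moves w ts l n else moves w ts l n

  succs : List (ℕ × ℕ) → List (ℕ × ℕ) → ⟦ Node ⟧ → List ⟦ Node ⟧
  succs w L n = collect (λ l → moves w Δ l n) L

  start : ⟦ Node ⟧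
  start = toℕ i₀ , 0 , tab (λ _ → d₀)

  readWord : List (ℕ × ℕ) → List (ℕ × ℕ) → List ⟦ Node ⟧
  readWord w u = foldl (λ ns l → collect (succs w (l ∷ [])) ns) (start ∷ []) u

  -- A strict bound on `d₀` and on all data of `u` and `w`, the values that a renaming must not
  -- touch. Sums stand in for maxima, since only an upper bound is wanted.
  constants : List (ℕ × ℕ) → List (ℕ × ℕ) → ℕ
  constants w u = suc (d₀ + (dataSum u + dataSum w))

  values : List (ℕ × ℕ) → List (ℕ × ℕ) → ℕ
  values w u = constants w u + suc k

  -- One common bound for states, positions (at most `suc (len w)`) and register values, so that
  -- nodes can be counted as tuples over a single range.
  entries : List (ℕ × ℕ) → List (ℕ × ℕ) → ℕ
  entries w u = values w u + (nQ + suc (suc (len w)))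

  -- The exponent counts the state, the position, the `k` registers and the dummy component of the
  -- tuple.
  nodes : List (ℕ × ℕ) → List (ℕ × ℕ) → ℕ
  nodes w u = entries w u ^ (3 + k)

  letters : ℕ → List (ℕ × ℕ)
  letters B = collect (λ a → collect (λ d → (a , d) ∷ []) (below B)) (below nΣ)

  close : List (ℕ × ℕ) → List (ℕ × ℕ) → ℕ → List ⟦ Node ⟧ → List ⟦ Node ⟧
  close w L N ns = natrec ns (λ _ ns → push ns (collect (succs w L) ns)) N

  accepting : List (Fin nQ) → ℕ → Bool
  accepting []       q = false
  accepting (p ∷ ps) q = if acc p then (if q ≡ᵇ toℕ p then true else accepting ps q) else accepting ps q

  member : ⟦ Node ⟧ → List ⟦ Node ⟧ → Bool
  member n ns = exists (λ n' → gödel Node n ≡ᵇ gödel Node n') ns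

  -- Starting from the successors forces the cycle to have at least one edge. A recorded deviation
  -- persists, so it is constant along a cycle and may be demanded at the accepting node.
  onLasso : List (ℕ × ℕ) → List (ℕ × ℕ) → ℕ → ⟦ Node ⟧ → Bool
  onLasso w L N n =
    if accepting (allFin nQ) (proj₁ n) then
      (if proj₁ (proj₂ n) ≡ᵇ suc (len w) then member n (close w L N (succs w L n)) else false)
    else false

  -- Some accepting run over an extension of u deviates from w.
  refuted : List (ℕ × ℕ) → List (ℕ × ℕ) → Bool
  refuted w u =
    exists (onLasso w (letters (values w u)) (nodes w u)) (close w (letters (values w u)) (nodes w u) (readWord w u))

  -- The length of `u` bounds the data tried; it grows with the input, so no datum is missed
  -- forever. Both words are stored with the latest letter first and are reversed before the search.
  candidates : List (ℕ × ℕ) → List (ℕ × ℕ) → List (ℕ × ℕ)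
  candidates v u = collect (λ γ → collect (λ e →
    if refuted (push [] ((γ , e) ∷ v)) (push [] u) then [] else (γ , e) ∷ []) (below (len u))) (below nΓ)

  module _ {Γ : List Ty} where

    trackᵖ : PR Γ (list Letter) → PR Γ nat → PR Γ Letter → PR Γ nat
    trackᵖ w i l = caseᵖ (recᵖ i w (caseᵖ v₀ nilᵖ v₁)) i
                     (ifᵖ (eqᵖ v₀ (wk (wk l))) (sucᵖ (wk (wk i))) (sucᵖ (lenᵖ (wk (wk w)))))

    assignᵖ : Transition → PR Γ nat → PR Γ (tup k) → PR Γ (tup k)
    assignᵖ t d τ = as (tabᵖ (λ r → if Trans.asgn t r then d else lookᵖ τ r)) (λ γ → assign t (fun d γ) (fun τ γ))
                       (λ γ → tabᵖ-fun _ _ γ (component γ))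
      where
      component : ∀ γ r → fun (if Trans.asgn t r then d else lookᵖ τ r) γ ≡ (if Trans.asgn t r then fun d γ else look (fun τ γ) r)
      component γ r with Trans.asgn t r
      ... | true  = refl
      ... | false = lookᵖ-fun τ r γ

    trackAllᵖ : PR Γ (list Letter) → PR Γ (tup k) → PR Γ nat → List (Fin nΓ × Fin k) → PR Γ nat
    trackAllᵖ w τ i []            = i
    trackAllᵖ w τ i ((γ , r) ∷ o) = trackAllᵖ w τ (trackᵖ w i (pairᵖ (litᵖ (toℕ γ)) (lookᵖ τ r))) o

    trackAllᵖ-fun : ∀ w τ i o γ → fun (trackAllᵖ w τ i o) γ ≡ trackAll (fun w γ) (fun τ γ) (fun i γ) o
    trackAllᵖ-fun w τ i []            γ = refl
    trackAllᵖ-fun w τ i ((a , r) ∷ o) γ =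
      trans (trackAllᵖ-fun w τ _ o γ)
            (cong (λ n → trackAll (fun w γ) (fun τ γ) (track (fun w γ) (fun i γ) (toℕ a , n)) o) (lookᵖ-fun τ r γ))

    fireᵖ : PR Γ (list Letter) → Transition → PR Γ nat → PR Γ Node → PR Γ Node
    fireᵖ w t d n = as
      (pairᵖ (litᵖ (toℕ (Trans.tgt t)))
        (pairᵖ (trackAllᵖ w (assignᵖ t d (sndᵖ (sndᵖ n))) (fstᵖ (sndᵖ n)) (Trans.out t)) (assignᵖ t d (sndᵖ (sndᵖ n)))))
      (λ γ → fire (fun w γ) t (fun d γ) (fun n γ))
      (λ γ → cong (λ i → toℕ (Trans.tgt t) , i , assign t (fun d γ) (proj₂ (proj₂ (fun n γ))))
               (trackAllᵖ-fun w (assignᵖ t d (sndᵖ (sndᵖ n))) (fstᵖ (sndᵖ n)) (Trans.out t) γ))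

    enabledᵖ : Transition → PR Γ Letter → PR Γ Node → PR Γ bool
    enabledᵖ t l n = as
      (ifᵖ (eqᵖ (fstᵖ n) (litᵖ (toℕ (Trans.src t))))
        (ifᵖ (eqᵖ (fstᵖ l) (litᵖ (toℕ (Trans.lab t)))) (satᵖ (sndᵖ (sndᵖ n)) (sndᵖ l) (Trans.test t)) falseᵖ) falseᵖ)
      (λ γ → enabled t (fun l γ) (fun n γ))
      (λ γ → cong (λ b → if proj₁ (fun n γ) ≡ᵇ toℕ (Trans.src t) then (if proj₁ (fun l γ) ≡ᵇ toℕ (Trans.lab t) then b else false) else false)
               (satᵖ-fun (sndᵖ (sndᵖ n)) (sndᵖ l) (Trans.test t) γ))

    movesᵖ : PR Γ (list Letter) → List Transition → PR Γ Letter → PR Γ Node → PR Γ (list Node)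
    movesᵖ w []       l n = nilᵖ
    movesᵖ w (t ∷ ts) l n = ifᵖ (enabledᵖ t l n) (consᵖ (fireᵖ w t (sndᵖ l) n) (movesᵖ w ts l n)) (movesᵖ w ts l n)

    movesᵖ-fun : ∀ w ts l n γ → fun (movesᵖ w ts l n) γ ≡ moves (fun w γ) ts (fun l γ) (fun n γ)
    movesᵖ-fun w []       l n γ = refl
    movesᵖ-fun w (t ∷ ts) l n γ =
      cong (λ ns → if enabled t (fun l γ) (fun n γ) then fire (fun w γ) t (proj₂ (fun l γ)) (fun n γ) ∷ ns else ns)
           (movesᵖ-fun w ts l n γ)

    acceptingᵖ : List (Fin nQ) → PR Γ nat → PR Γ bool
    acceptingᵖ []       q = falseᵖ
    acceptingᵖ (p ∷ ps) q = if acc p then ifᵖ (eqᵖ q (litᵖ (toℕ p))) trueᵖ (acceptingᵖ ps q) else acceptingᵖ ps q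

    acceptingᵖ-fun : ∀ ps q γ → fun (acceptingᵖ ps q) γ ≡ accepting ps (fun q γ)
    acceptingᵖ-fun []       q γ = refl
    acceptingᵖ-fun (p ∷ ps) q γ with acc p
    ... | true  = cong (if fun q γ ≡ᵇ toℕ p then true else_) (acceptingᵖ-fun ps q γ)
    ... | false = acceptingᵖ-fun ps q γ

  module _ {Γ : List Ty} where

    succsᵖ : PR Γ (list Letter) → PR Γ (list Letter) → PR Γ Node → PR Γ (list Node)
    succsᵖ w L n = collectᵖ (as (movesᵖ (wk w) Δ v₀ (wk n)) (λ { (l , γ) → moves (fun w γ) Δ l (fun n γ) })
                              (λ γ → movesᵖ-fun (wk w) Δ v₀ (wk n) γ)) L

  module _ {Γ : List Ty} where

    readWordᵖ : PR Γ (list Letter) → PR Γ (list Letter) → PR Γ (list Node)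
    readWordᵖ w u = as
      (foldᵖ u (consᵖ (pairᵖ (litᵖ (toℕ i₀)) (pairᵖ zeroᵖ (tabᵖ (λ _ → litᵖ d₀)))) nilᵖ)
        (collectᵖ (succsᵖ (wk (wk (wk w))) (consᵖ (wk v₀) nilᵖ) v₀) v₁))
      (λ γ → readWord (fun w γ) (fun u γ))
      (λ γ → cong (λ τ → foldl (λ ns l → collect (succs (fun w γ) (l ∷ [])) ns) ((toℕ i₀ , 0 , τ) ∷ []) (fun u γ))
               (tabᵖ-fun _ _ γ (λ _ → refl)))

    closeᵖ : PR Γ (list Letter) → PR Γ (list Letter) → PR Γ nat → PR Γ (list Node) → PR Γ (list Node)
    closeᵖ w L N ns = recᵖ N ns (pushᵖ v₀ (collectᵖ (succsᵖ (wk (wk (wk w))) (wk (wk (wk L))) v₀) v₀))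

    constantsᵖ valuesᵖ entriesᵖ nodesᵖ : PR Γ (list Letter) → PR Γ (list Letter) → PR Γ nat
    constantsᵖ w u = sucᵖ (addᵖ (litᵖ d₀) (addᵖ (dataSumᵖ u) (dataSumᵖ w)))
    valuesᵖ w u    = addᵖ (constantsᵖ w u) (litᵖ (suc k))
    entriesᵖ w u   = addᵖ (valuesᵖ w u) (addᵖ (litᵖ nQ) (sucᵖ (sucᵖ (lenᵖ w))))
    nodesᵖ w u     = as (powᵖ (entriesᵖ w u) (3 + k)) (λ γ → nodes (fun w γ) (fun u γ)) (powᵖ-fun (entriesᵖ w u) (3 + k))

    lettersᵖ : PR Γ nat → PR Γ (list Letter)
    lettersᵖ B = collectᵖ (collectᵖ (consᵖ (pairᵖ v₁ v₀) nilᵖ) (belowᵖ (wk B))) (belowᵖ (litᵖ nΣ))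

    memberᵖ : PR Γ Node → PR Γ (list Node) → PR Γ bool
    memberᵖ n ns = existsᵖ (eqᵖ (wk n) v₀) ns

  module _ {Γ : List Ty} where

    onLassoᵖ : PR Γ (list Letter) → PR Γ (list Letter) → PR Γ nat → PR Γ Node → PR Γ bool
    onLassoᵖ w L N n = as
      (ifᵖ (acceptingᵖ (allFin nQ) (fstᵖ n))
        (ifᵖ (eqᵖ (fstᵖ (sndᵖ n)) (sucᵖ (lenᵖ w))) (memberᵖ n (closeᵖ w L N (succsᵖ w L n))) falseᵖ)
        falseᵖ)
      (λ γ → onLasso (fun w γ) (fun L γ) (fun N γ) (fun n γ))
      (λ γ → cong (λ b → if b then (if proj₁ (proj₂ (fun n γ)) ≡ᵇ suc (len (fun w γ)) then
                member (fun n γ) (close (fun w γ) (fun L γ) (fun N γ) (succs (fun w γ) (fun L γ) (fun n γ))) else false) else false)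
               (acceptingᵖ-fun (allFin nQ) (fstᵖ n) γ))

  module _ {Γ : List Ty} where

    refutedᵖ : PR Γ (list Letter) → PR Γ (list Letter) → PR Γ bool
    refutedᵖ w u = existsᵖ (onLassoᵖ (wk w) (wk L) (wk N) v₀) (closeᵖ w L N (readWordᵖ w u))
      where
      L = lettersᵖ (valuesᵖ w u)
      N = nodesᵖ w u

  module _ {Γ : List Ty} where

    candidatesᵖ : PR Γ (list Letter) → PR Γ (list Letter) → PR Γ (list Letter)
    candidatesᵖ v u = collectᵖ (collectᵖ
        (ifᵖ (refutedᵖ (pushᵖ nilᵖ (consᵖ (pairᵖ v₁ v₀) (wk (wk v)))) (pushᵖ nilᵖ (wk (wk u)))) nilᵖ (consᵖ (pairᵖ v₁ v₀) nilᵖ))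
        (belowᵖ (wk (lenᵖ u))))
      (belowᵖ (litᵖ nΓ))

  -- The state holds the input read so far, the output written so far (both reversed), and the letter written last.
  mealy : Mealy nΣ nΓ
  mealy = record
    { S        = list Letter ⊗ list Letter ⊗ Letter
    ; init     = pairᵖ nilᵖ (pairᵖ nilᵖ (pairᵖ zeroᵖ zeroᵖ))
    ; next     = letᵖ (consᵖ (pairᵖ v₁ v₀) (fstᵖ v₂))
                   (caseᵖ (candidatesᵖ (fstᵖ (sndᵖ (wk v₂))) v₀)
                     (pairᵖ v₀ (pairᵖ (fstᵖ (sndᵖ (wk v₂))) (pairᵖ zeroᵖ zeroᵖ)))
                     (pairᵖ v₂ (pairᵖ (consᵖ v₀ (fstᵖ (sndᵖ (wk (wk (wk v₂)))))) (pairᵖ (sucᵖ (fstᵖ v₀)) (sndᵖ v₀)))))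
    ; outLabel = fstᵖ (sndᵖ (sndᵖ v₀))
    ; outData  = sndᵖ (sndᵖ (sndᵖ v₀))
    }

-- Properties of the search

≡ᵇ-sound : ∀ m n → (m ≡ᵇ n) ≡ true → m ≡ n
≡ᵇ-sound zero    zero    e = refl
≡ᵇ-sound (suc m) (suc n) e = cong suc (≡ᵇ-sound m n e)

if-true : ∀ {b c} → (if b then c else false) ≡ true → b ≡ true × c ≡ true
if-true {true} {true} refl = refl , refl

module _ {X : Set} where

  ∈-push⁺ : ∀ ys xs {z : X} → z ∈ xs ⊎ z ∈ ys → z ∈ push ys xs
  ∈-push⁺ ys []       (inj₂ z∈)           = z∈
  ∈-push⁺ ys (x ∷ xs) (inj₁ (here refl)) = ∈-push⁺ (x ∷ ys) xs (inj₂ (here refl))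
  ∈-push⁺ ys (x ∷ xs) (inj₁ (there z∈))  = ∈-push⁺ (x ∷ ys) xs (inj₁ z∈)
  ∈-push⁺ ys (x ∷ xs) (inj₂ z∈)          = ∈-push⁺ (x ∷ ys) xs (inj₂ (there z∈))

  ∈-push⁻ : ∀ ys xs {z : X} → z ∈ push ys xs → z ∈ xs ⊎ z ∈ ys
  ∈-push⁻ ys []       z∈ = inj₂ z∈
  ∈-push⁻ ys (x ∷ xs) z∈ with ∈-push⁻ (x ∷ ys) xs z∈
  ... | inj₁ p           = inj₁ (there p)
  ... | inj₂ (here refl) = inj₁ (here refl)
  ... | inj₂ (there p)   = inj₂ p

module _ {X : Set} where

  module _ {Y : Set} (f : X → List Y) where

    private
      collectFrom : List Y → List X → List Y
      collectFrom = foldl (λ acc x → foldl (λ acc' y → y ∷ acc') acc (f x))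

      from⁺ : ∀ acc xs {z} → (∃ λ x → x ∈ xs × z ∈ f x) ⊎ z ∈ acc → z ∈ collectFrom acc xs
      from⁺ acc []       (inj₂ z∈)                     = z∈
      from⁺ acc (x ∷ xs) (inj₁ (_ , here refl , z∈))   = from⁺ _ xs (inj₂ (∈-push⁺ acc (f x) (inj₁ z∈)))
      from⁺ acc (x ∷ xs) (inj₁ (x' , there x'∈ , z∈))  = from⁺ _ xs (inj₁ (x' , x'∈ , z∈))
      from⁺ acc (x ∷ xs) (inj₂ z∈)                     = from⁺ _ xs (inj₂ (∈-push⁺ acc (f x) (inj₂ z∈)))

      from⁻ : ∀ acc xs {z} → z ∈ collectFrom acc xs → (∃ λ x → x ∈ xs × z ∈ f x) ⊎ z ∈ acc
      from⁻ acc []       z∈ = inj₂ z∈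
      from⁻ acc (x ∷ xs) z∈ with from⁻ _ xs z∈
      ... | inj₁ (x' , x'∈ , p) = inj₁ (x' , there x'∈ , p)
      ... | inj₂ p with ∈-push⁻ acc (f x) p
      ...   | inj₁ q = inj₁ (x , here refl , q)
      ...   | inj₂ q = inj₂ q

    ∈-collect⁺ : ∀ {xs x z} → x ∈ xs → z ∈ f x → z ∈ collect f xs
    ∈-collect⁺ {xs} x∈ z∈ = from⁺ [] xs (inj₁ (_ , x∈ , z∈))

    ∈-collect⁻ : ∀ xs {z} → z ∈ collect f xs → ∃ λ x → x ∈ xs × z ∈ f x
    ∈-collect⁻ xs z∈ with from⁻ [] xs z∈
    ... | inj₁ p = p

  module _ (p : X → Bool) where

    private
      existsFrom : Bool → List X → Bool
      existsFrom = foldl (λ b x → if p x then true else b)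

      stays : ∀ xs → existsFrom true xs ≡ true
      stays []       = refl
      stays (x ∷ xs) with p x
      ... | true  = stays xs
      ... | false = stays xs

      found : ∀ b xs {x} → x ∈ xs → p x ≡ true → existsFrom b xs ≡ true
      found b (x ∷ xs) (here refl) e rewrite e = stays xs
      found b (x ∷ xs) (there x∈)  e = found _ xs x∈ e

      find : ∀ b xs → existsFrom b xs ≡ true → (∃ λ x → x ∈ xs × p x ≡ true) ⊎ b ≡ true
      find b []       e = inj₂ e
      find b (x ∷ xs) e with p x in eq
      find b (x ∷ xs) e | true  = inj₁ (x , here refl , eq)
      find b (x ∷ xs) e | false with find b xs e
      ... | inj₁ (x' , x'∈ , q) = inj₁ (x' , there x'∈ , q)
      ... | inj₂ q              = inj₂ q

    exists⁺ : ∀ {xs x} → x ∈ xs → p x ≡ true → exists p xs ≡ true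
    exists⁺ {xs} = found false xs

    exists⁻ : ∀ xs → exists p xs ≡ true → ∃ λ x → x ∈ xs × p x ≡ true
    exists⁻ xs e with find false xs e
    ... | inj₁ q = q

  len≡length : (xs : List X) → len xs ≡ length xs
  len≡length xs = trans (go 0 xs) refl
    where
    go : ∀ n (xs : List X) → foldl (λ n _ → suc n) n xs ≡ n + length xs
    go n []       = sym (+-identityʳ n)
    go n (x ∷ xs) = trans (go (suc n) xs) (sym (+-suc n _))

  nth-∈ : ∀ (xs : List X) i {x} → nth xs i ≡ just x → x ∈ xs
  nth-∈ (x ∷ xs) zero    refl = here refl
  nth-∈ (x ∷ xs) (suc i) e    = there (nth-∈ xs i e)

  nth-nothing : ∀ (xs : List X) i → nth xs i ≡ nothing → length xs ≤ i
  nth-nothing []       i       e = z≤n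
  nth-nothing (x ∷ xs) (suc i) e = s≤s (nth-nothing xs i e)

  nth-beyond : ∀ (xs : List X) i → length xs ≤ i → nth xs i ≡ nothing
  nth-beyond []       i       p       = refl
  nth-beyond (x ∷ xs) (suc i) (s≤s p) = nth-beyond xs i p

∈-below⁺ : ∀ {i n} → i < n → i ∈ below n
∈-below⁺ {i} {suc n} i<n with m<1+n⇒m<n∨m≡n i<n
... | inj₁ p    = there (∈-below⁺ p)
... | inj₂ refl = here refl

dataSum-≥ : ∀ {l} xs → l ∈ xs → proj₂ l ≤ dataSum xs
dataSum-≥ {l} xs = go 0 xs
  where
  grows : ∀ s (xs : List (ℕ × ℕ)) → s ≤ foldl (λ s l → s + proj₂ l) s xs
  grows s []       = ≤-refl
  grows s (x ∷ xs) = ≤-trans (m≤m+n s (proj₂ x)) (grows (s + proj₂ x) xs)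
  go : ∀ s xs → l ∈ xs → proj₂ l ≤ foldl (λ s l → s + proj₂ l) s xs
  go s (x ∷ xs) (here refl) = ≤-trans (m≤n+m (proj₂ l) s) (grows (s + proj₂ l) xs)
  go s (x ∷ xs) (there l∈)  = go (s + proj₂ x) xs l∈

look-tab : ∀ {k} (f : Fin k → ℕ) r → look (tab f) r ≡ f r
look-tab f zero    = refl
look-tab f (suc r) = look-tab (f ∘ suc) r

-- Pigeonhole for bounded tuples and shortening of walks.

Bounded : ℕ → ∀ {k} → ⟦ tup k ⟧ → Set
Bounded M {zero}  n       = n < M
Bounded M {suc k} (a , t) = a < M × Bounded M t

bounded-tab : ∀ {M k} (f : Fin k → ℕ) → 0 < M → (∀ r → f r < M) → Bounded M (tab f)
bounded-tab {k = zero}  f 0<M h = 0<M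
bounded-tab {k = suc k} f 0<M h = h zero , bounded-tab (f ∘ suc) 0<M (h ∘ suc)

number : ∀ {M k} (t : ⟦ tup k ⟧) → Bounded M t → Fin (M ^ suc k)
number {M} {zero}  n       p       = combine {M} {1} (fromℕ< p) zero
number {M} {suc k} (a , t) (p , q) = combine {M} {M ^ suc k} (fromℕ< p) (number t q)

number-injective : ∀ {M k} (t t' : ⟦ tup k ⟧) (b : Bounded M t) (b' : Bounded M t') → number t b ≡ number t' b' → t ≡ t'
number-injective {M} {zero}  n n' p p' e = fromℕ<-injective _ _ p p' (proj₁ (combine-injective {M} {1} _ _ _ _ e))
number-injective {M} {suc k} (a , t) (a' , t') (p , q) (p' , q') e =
  let (e₁ , e₂) = combine-injective {M} {M ^ suc k} _ _ _ _ e
  in cong₂ _,_ (fromℕ<-injective _ _ p p' e₁) (number-injective t t' q q' e₂)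

-- The dummy entry counts as well, so there are `M ^ suc k` bounded tuples, one fewer than the
-- indices considered.
repetition : ∀ {M k} (f : ℕ → ⟦ tup k ⟧) → (∀ m → m ≤ M ^ suc k → Bounded M (f m)) →
             ∃₂ λ i j → i < j × j ≤ M ^ suc k × f i ≡ f j
repetition {M} {k} f b with pigeonhole ≤-refl (λ (i : Fin (suc (M ^ suc k))) → number (f (toℕ i)) (b (toℕ i) (s≤s⁻¹ (toℕ<n i))))
... | i , j , i<j , e = toℕ i , toℕ j , i<j , s≤s⁻¹ (toℕ<n j) , number-injective _ _ _ _ e

-- Cutting out the loop between two visits of the same node shortens a walk, as long as it has more than N steps.
module _ {k : ℕ} (R : ⟦ tup k ⟧ → ⟦ tup k ⟧ → Set) (M : ℕ) where

  record Walk (f : ℕ → ⟦ tup k ⟧) (n : ℕ) : Set where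
    field
      edges   : ∀ m → m < n → R (f m) (f (suc m))
      bounded : ∀ m → m ≤ n → Bounded M (f m)
  open Walk

  private
    N = M ^ suc k

    cut : ∀ {f n} → Walk f n → ∀ {i j} → i < j → j ≤ n → f i ≡ f j →
          ∃ λ f' → ∃ λ n' → n' < n × Walk f' n' × f' 0 ≡ f 0 × f' n' ≡ f n
    cut {f} {n} W {i} {j} i<j j≤n e = g , n ∸ δ , shorter , walk , refl , last
      where
      δ = j ∸ i
      jump : ℕ → ℕ
      jump m = if m ≤ᵇ i then m else m + δ
      g : ℕ → ⟦ tup k ⟧
      g m = f (jump m)
      i+δ : i + δ ≡ j
      i+δ = m+[n∸m]≡n (<⇒≤ i<j)
      0<δ : 0 < δ
      0<δ = m<n⇒0<n∸m i<j
      δ≤n : δ ≤ n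
      δ≤n = ≤-trans (m∸n≤m j i) j≤n
      shorter : n ∸ δ < n
      shorter = ∸-monoʳ-< 0<δ δ≤n
      jump-low : ∀ m → m ≤ i → jump m ≡ m
      jump-low m p with m ≤ᵇ i | ≤⇒≤ᵇ p
      ... | true | _ = refl
      jump-high : ∀ m → i < m → jump m ≡ m + δ
      jump-high m p with m ≤ᵇ i in q
      ... | true  = ⊥-elim (<⇒≱ p (≤ᵇ⇒≤ m i (subst T (sym q) _)))
      ... | false = refl
      i≤n∸δ : i ≤ n ∸ δ
      i≤n∸δ = subst (_≤ n ∸ δ) (trans (cong (_∸ δ) (sym i+δ)) (m+n∸n≡m i δ)) (∸-monoˡ-≤ δ j≤n)
      within : ∀ m → m ≤ n ∸ δ → m + δ ≤ n
      within m p = ≤-trans (+-monoˡ-≤ δ p) (≤-reflexive (m∸n+n≡m δ≤n))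
      at-i : f (jump i) ≡ f (i + δ)
      at-i = trans (cong f (jump-low i ≤-refl)) (trans e (cong f (sym i+δ)))
      at-≥ : ∀ m → i ≤ m → g m ≡ f (m + δ)
      at-≥ m p with m≤n⇒m<n∨m≡n p
      ... | inj₁ i<m  = cong f (jump-high m i<m)
      ... | inj₂ refl = at-i
      last : g (n ∸ δ) ≡ f n
      last = trans (at-≥ (n ∸ δ) i≤n∸δ) (cong f (m∸n+n≡m δ≤n))
      walk : Walk g (n ∸ δ)
      edges walk m p with m <? i
      ... | yes m<i = subst₂ R (cong f (sym (jump-low m (<⇒≤ m<i)))) (cong f (sym (jump-low (suc m) m<i)))
                        (edges W m (<-≤-trans p (m∸n≤m n δ)))
      ... | no m≮i  = subst₂ R (sym (at-≥ m (≮⇒≥ m≮i))) (cong f (sym (jump-high (suc m) (s≤s (≮⇒≥ m≮i)))))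
                        (edges W (m + δ) (within (suc m) p))
      bounded walk m p with m ≤? i
      ... | yes m≤i = subst (Bounded M) (cong f (sym (jump-low m m≤i))) (bounded W m (≤-trans p (m∸n≤m n δ)))
      ... | no m≰i  = subst (Bounded M) (sym (at-≥ m (<⇒≤ (≰⇒> m≰i)))) (bounded W (m + δ) (within m p))

  shorten : ∀ n f → Walk f n → ∃ λ f' → ∃ λ n' → n' ≤ N × Walk f' n' × f' 0 ≡ f 0 × f' n' ≡ f n
  shorten = <-rec (λ n → ∀ f → Walk f n → ∃ λ f' → ∃ λ n' → n' ≤ N × Walk f' n' × f' 0 ≡ f 0 × f' n' ≡ f n) go
    where
    go : ∀ n → (∀ {m} → m < n → ∀ f → Walk f m → ∃ λ f' → ∃ λ n' → n' ≤ N × Walk f' n' × f' 0 ≡ f 0 × f' n' ≡ f m) →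
         ∀ f → Walk f n → ∃ λ f' → ∃ λ n' → n' ≤ N × Walk f' n' × f' 0 ≡ f 0 × f' n' ≡ f n
    go n ih f W with n ≤? N
    ... | yes n≤N = f , n , n≤N , W , refl , refl
    ... | no n≰N with repetition f (λ m m≤N → bounded W m (≤-trans m≤N (<⇒≤ (≰⇒> n≰N))))
    ...   | i , j , i<j , j≤N , e with cut W i<j (≤-trans j≤N (<⇒≤ (≰⇒> n≰N))) e
    ...     | f' , n' , n'<n , W' , e₀ , e₁ with ih n'<n f' W'
    ...       | f'' , n'' , n''≤N , W'' , e₂ , e₃ = f'' , n'' , n''≤N , W'' , trans e₂ e₀ , trans e₃ e₁

-- Finite prefixes as coded words, and the specification of the graph search.

letter : ∀ {n} → Fin n × ℕ → ℕ × ℕ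
letter (a , d) = toℕ a , d

letter-injective : ∀ {n} {p q : Fin n × ℕ} → letter p ≡ letter q → p ≡ q
letter-injective {p = a , d} {b , e} h = cong₂ _,_ (toℕ-injective (cong proj₁ h)) (cong proj₂ h)

_≟ₗ_ : (c l : ℕ × ℕ) → Dec (c ≡ l)
_≟ₗ_ = ≡-dec _≟_ _≟_

revs pre : ∀ {n} → DataWord n → ℕ → List (ℕ × ℕ)
revs x zero    = []
revs x (suc n) = letter (x n) ∷ revs x n
pre x zero    = []
pre x (suc n) = pre x n ∷ʳ letter (x n)

push-revs : ∀ {n} (x : DataWord n) ys i → push ys (revs x i) ≡ pre x i ++ ys
push-revs x ys zero    = refl
push-revs x ys (suc i) = trans (push-revs x (letter (x i) ∷ ys) i) (sym (++-assoc (pre x i) _ ys))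

length-pre : ∀ {n} (x : DataWord n) i → length (pre x i) ≡ i
length-pre x zero    = refl
length-pre x (suc i) = trans (length-++ (pre x i)) (trans (+-comm _ 1) (cong suc (length-pre x i)))

nth-pre : ∀ {n} (x : DataWord n) i m ys → m < i → nth (pre x i ++ ys) m ≡ just (letter (x m))
nth-pre x (suc i) m ys m<1+i rewrite ++-assoc (pre x i) (letter (x i) ∷ []) ys
  with m<1+n⇒m<n∨m≡n m<1+i
... | inj₁ m<i  = nth-pre x i m _ m<i
... | inj₂ refl = trans (cong (nth (pre x m ++ letter (x m) ∷ ys)) (sym (trans (+-identityʳ _) (length-pre x m))))
                        (nth-++ʳ (pre x m) _ 0)

∈-pre : ∀ {n} (x : DataWord n) {i m} → m < i → letter (x m) ∈ pre x i
∈-pre x {i} {m} m<i = nth-∈ (pre x i) m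
  (trans (cong (λ l → nth l m) (sym (++-identityʳ (pre x i)))) (nth-pre x i m [] m<i))

module _ {nΣ nΓ : ℕ} (A : NRT nΣ nΓ) (d₀ : ℕ) where
  open NRT A
  open Search A d₀

  private
    rest-nth : ∀ (w : List (ℕ × ℕ)) m → nth (rest w) m ≡ nth w (suc m)
    rest-nth []      m = refl
    rest-nth (x ∷ w) m = refl

    rests-nth : ∀ w i m → nth (natrec w (λ _ → rest) i) m ≡ nth w (i + m)
    rests-nth w zero    m = refl
    rests-nth w (suc i) m = trans (rest-nth (natrec w (λ _ → rest) i) m) (trans (rests-nth w i (suc m)) (cong (nth w) (+-suc i m)))

    rests-head : ∀ w i → nth (natrec w (λ _ → rest) i) 0 ≡ nth w i
    rests-head w i = trans (rests-nth w i 0) (cong (nth w) (+-identityʳ i))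

  track-end : ∀ w i l → nth w i ≡ nothing → track w i l ≡ i
  track-end w i l e with natrec w (λ _ → rest) i | trans (rests-head w i) e
  ... | [] | _ = refl

  track-match : ∀ w i l → nth w i ≡ just l → track w i l ≡ suc i
  track-match w i l e with natrec w (λ _ → rest) i | trans (rests-head w i) e
  ... | c ∷ _ | refl rewrite ≡ᵇ-refl (gödel Letter c) = refl

  track-differ : ∀ w i l {c} → nth w i ≡ just c → c ≢ l → track w i l ≡ suc (len w)
  track-differ w i l e c≢l with natrec w (λ _ → rest) i | trans (rests-head w i) e
  ... | c ∷ _ | refl rewrite ≡ᵇ-false (gödel Letter c) (gödel Letter l) (c≢l ∘ gödel-injective Letter) = refl

  trackOut : List (ℕ × ℕ) → ℕ → List (Fin nΓ × ℕ) → ℕ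
  trackOut w = foldl (λ i p → track w i (letter p))

  trackOut-idle : ∀ w i o → nth w i ≡ nothing → trackOut w i o ≡ i
  trackOut-idle w i []      e = refl
  trackOut-idle w i (p ∷ o) e = trans (cong (λ j → trackOut w j o) (track-end w i (letter p) e)) (trackOut-idle w i o e)

  trackOut-deviated : ∀ w o → trackOut w (suc (len w)) o ≡ suc (len w)
  trackOut-deviated w o = trackOut-idle w _ o (nth-beyond w _ (≤-trans (≤-reflexive (sym (len≡length w))) (n≤1+n _)))

  -- The mismatch at `m` need not be the first one: an earlier mismatch leads to the same absorbing
  -- position, and otherwise the tracking arrives at index `i + m` of `w`.
  deviation⁺ : ∀ w o i m {p c} → nth o m ≡ just p → nth w (i + m) ≡ just c → c ≢ letter p → trackOut w i o ≡ suc (len w)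
  deviation⁺ w (p ∷ o) i m {c = c} eo ew c≢ with nth w i in ei
  ... | nothing = ⊥-elim (<⇒≱ (nth-<length w (i + m) ew) (≤-trans (nth-nothing w i ei) (m≤m+n i m)))
  ... | just c₀ with c₀ ≟ₗ letter p
  ...   | no c₀≢ = trans (cong (λ j → trackOut w j o) (track-differ w i (letter p) ei c₀≢)) (trackOut-deviated w o)
  deviation⁺ w (p ∷ o) i zero {c = c} refl ew c≢ | just c₀ | yes refl =
    ⊥-elim (c≢ (sym (just-injective (trans (sym ei) (trans (cong (nth w) (sym (+-identityʳ i))) ew)))))
  deviation⁺ w (p ∷ o) i (suc m) eo ew c≢ | just c₀ | yes refl =
    trans (cong (λ j → trackOut w j o) (track-match w i (letter p) ei))
          (deviation⁺ w o (suc i) m eo (trans (cong (nth w) (sym (+-suc i m))) ew) c≢)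

  -- The bound on `i` excludes a deviation recorded before `o` begins, so the mismatch has to occur
  -- within `o`.
  deviation⁻ : ∀ w o i → i ≤ len w → trackOut w i o ≡ suc (len w) →
               ∃ λ m → ∃₂ λ p c → nth o m ≡ just p × nth w (i + m) ≡ just c × c ≢ letter p
  deviation⁻ w []      i i≤ e = ⊥-elim (<⇒≱ (≤-reflexive (sym e)) i≤)
  deviation⁻ w (p ∷ o) i i≤ e with nth w i in ei
  ... | nothing = ⊥-elim (<⇒≱ (≤-reflexive (sym (trans (sym (trackOut-idle w i (p ∷ o) ei)) e))) i≤)
  ... | just c with c ≟ₗ letter p
  ...   | no c≢ = 0 , p , c , refl , trans (cong (nth w) (+-identityʳ i)) ei , c≢
  ...   | yes refl with deviation⁻ w o (suc i) (subst (i <_) (sym (len≡length w)) (nth-<length w i ei))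
                          (trans (cong (λ j → trackOut w j o) (sym (track-match w i (letter p) ei))) e)
  ...     | m , p' , c' , eo , ew , c≢ = suc m , p' , c' , eo , trans (cong (nth w) (+-suc i m)) ew , c≢

  track-≤ : ∀ w i l → i ≤ suc (len w) → track w i l ≤ suc (len w)
  track-≤ w i l i≤ with nth w i in ei
  ... | nothing = subst (_≤ suc (len w)) (sym (track-end w i l ei)) i≤
  ... | just c with c ≟ₗ l
  ...   | yes refl = subst (_≤ suc (len w)) (sym (track-match w i l ei))
                       (≤-trans (nth-<length w i ei) (≤-trans (≤-reflexive (sym (len≡length w))) (n≤1+n _)))
  ...   | no c≢    = ≤-reflexive (track-differ w i l ei c≢)

  trackOut-≤ : ∀ w i o → i ≤ suc (len w) → trackOut w i o ≤ suc (len w)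
  trackOut-≤ w i []      i≤ = i≤
  trackOut-≤ w i (p ∷ o) i≤ = trackOut-≤ w _ o (track-≤ w i (letter p) i≤)

  Fires : List (ℕ × ℕ) → ℕ × ℕ → ⟦ Node ⟧ → ⟦ Node ⟧ → Set
  Fires w l n n' = ∃ λ t → t ∈ Δ × enabled t l n ≡ true × n' ≡ fire w t (proj₂ l) n

  ∈-moves⁺ : ∀ w ts l n {t} → t ∈ ts → enabled t l n ≡ true → fire w t (proj₂ l) n ∈ moves w ts l n
  ∈-moves⁺ w (t ∷ ts) l n (here refl) e rewrite e = here refl
  ∈-moves⁺ w (t ∷ ts) l n (there t'∈) e with enabled t l n
  ... | true  = there (∈-moves⁺ w ts l n t'∈ e)
  ... | false = ∈-moves⁺ w ts l n t'∈ e

  ∈-moves⁻ : ∀ w ts l n {z} → z ∈ moves w ts l n → ∃ λ t → t ∈ ts × enabled t l n ≡ true × z ≡ fire w t (proj₂ l) n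
  ∈-moves⁻ w (t ∷ ts) l n z∈ with enabled t l n in e
  ∈-moves⁻ w (t ∷ ts) l n (here refl) | true = t , here refl , e , refl
  ∈-moves⁻ w (t ∷ ts) l n (there z∈)  | true with ∈-moves⁻ w ts l n z∈
  ... | t' , t'∈ , p = t' , there t'∈ , p
  ∈-moves⁻ w (t ∷ ts) l n z∈ | false with ∈-moves⁻ w ts l n z∈
  ... | t' , t'∈ , p = t' , there t'∈ , p

  ∈-succs⁺ : ∀ w L {l n n'} → l ∈ L → Fires w l n n' → n' ∈ succs w L n
  ∈-succs⁺ w L {l} {n} l∈ (t , t∈ , e , refl) = ∈-collect⁺ (λ l → moves w Δ l n) l∈ (∈-moves⁺ w Δ l n t∈ e)

  ∈-succs⁻ : ∀ w L {n n'} → n' ∈ succs w L n → ∃ λ l → l ∈ L × Fires w l n n'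
  ∈-succs⁻ w L {n} n'∈ with ∈-collect⁻ (λ l → moves w Δ l n) L n'∈
  ... | l , l∈ , p = l , l∈ , ∈-moves⁻ w Δ l n p

  close-mono : ∀ w L {N N' ns z} → N ≤ N' → z ∈ close w L N ns → z ∈ close w L N' ns
  close-mono w L {N} {N'} {ns} N≤N' z∈ with m≤n⇒∃[o]m+o≡n N≤N'
  ... | d , refl = go d
    where
    go : ∀ d → _ ∈ close w L (N + d) ns
    go zero    rewrite +-identityʳ N = z∈
    go (suc d) rewrite +-suc N d = ∈-push⁺ _ (collect (succs w L) (close w L (N + d) ns)) (inj₂ (go d))

  close⁺ : ∀ w L ns (f : ℕ → ⟦ Node ⟧) n → f 0 ∈ ns → (∀ m → m < n → f (suc m) ∈ succs w L (f m)) → f n ∈ close w L n ns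
  close⁺ w L ns f zero    f0 h = f0
  close⁺ w L ns f (suc n) f0 h = ∈-push⁺ (close w L n ns) _ (inj₁ (∈-collect⁺ (succs w L)
    (close⁺ w L ns f n f0 (λ m m<n → h m (m<n⇒m<1+n m<n))) (h n ≤-refl)))

  -- A walk through bounded nodes may be longer than the number of rounds, but the shortened walk
  -- with the same ends is not, and `close` reaches its end.
  close-Walk : ∀ w L M ns f n → f 0 ∈ ns → Walk (λ n n' → n' ∈ succs w L n) M f n → f n ∈ close w L (M ^ (3 + k)) ns
  close-Walk w L M ns f n f0 W with shorten (λ n n' → n' ∈ succs w L n) M n f W
  ... | f' , n' , n'≤N , W' , e₀ , e₁ =
    subst (_∈ close w L (M ^ (3 + k)) ns) e₁
      (close-mono w L {ns = ns} n'≤N (close⁺ w L ns f' n' (subst (_∈ ns) (sym e₀) f0) (Walk.edges W')))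

  accepting⁺ : ∀ ps q → q ∈ ps → acc q ≡ true → accepting ps (toℕ q) ≡ true
  accepting⁺ (p ∷ ps) q (here refl) e rewrite e | ≡ᵇ-refl (toℕ p) = refl
  accepting⁺ (p ∷ ps) q (there q∈)  e with acc p
  ... | false = accepting⁺ ps q q∈ e
  ... | true with toℕ q ≡ᵇ toℕ p
  ...   | true  = refl
  ...   | false = accepting⁺ ps q q∈ e

  accepting⁻ : ∀ ps n → accepting ps n ≡ true → ∃ λ q → acc q ≡ true × n ≡ toℕ q
  accepting⁻ (p ∷ ps) n e with acc p in ep
  ... | false = accepting⁻ ps n e
  ... | true with n ≡ᵇ toℕ p in eq
  ...   | true  = p , ep , ≡ᵇ-sound n (toℕ p) eq
  ...   | false = accepting⁻ ps n e

  member⁺ : ∀ {n ns} → n ∈ ns → member n ns ≡ true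
  member⁺ {n} n∈ = exists⁺ _ n∈ (≡ᵇ-refl (gödel Node n))

  member⁻ : ∀ n ns → member n ns ≡ true → n ∈ ns
  member⁻ n ns e with exists⁻ _ ns e
  ... | n' , n'∈ , eq = subst (_∈ ns) (sym (gödel-injective Node (≡ᵇ-sound _ _ eq))) n'∈

  onLasso⁺ : ∀ w L N n → accepting (allFin nQ) (proj₁ n) ≡ true → proj₁ (proj₂ n) ≡ suc (len w) →
             n ∈ close w L N (succs w L n) → onLasso w L N n ≡ true
  onLasso⁺ w L N (q , i , τ) a refl c rewrite a | ≡ᵇ-refl (len w) = member⁺ c

  onLasso⁻ : ∀ w L N n → onLasso w L N n ≡ true → accepting (allFin nQ) (proj₁ n) ≡ true ×
             proj₁ (proj₂ n) ≡ suc (len w) × n ∈ close w L N (succs w L n)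
  onLasso⁻ w L N n e with if-true {accepting (allFin nQ) (proj₁ n)} e
  ... | a , e' with if-true {proj₁ (proj₂ n) ≡ᵇ suc (len w)} e'
  ...   | p , m = a , ≡ᵇ-sound _ _ p , member⁻ n (close w L N (succs w L n)) m

  enabled⁺ : ∀ t d n → proj₁ n ≡ toℕ (Trans.src t) → sat (look (proj₂ (proj₂ n))) d (Trans.test t) ≡ true →
             enabled t (toℕ (Trans.lab t) , d) n ≡ true
  enabled⁺ t d (q , i , τ) refl e rewrite ≡ᵇ-refl (toℕ (Trans.src t)) | ≡ᵇ-refl (toℕ (Trans.lab t)) = e

  enabled⁻ : ∀ t l n → enabled t l n ≡ true →
             proj₁ n ≡ toℕ (Trans.src t) × proj₁ l ≡ toℕ (Trans.lab t) × sat (look (proj₂ (proj₂ n))) (proj₂ l) (Trans.test t) ≡ true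
  enabled⁻ t l n e with if-true {proj₁ n ≡ᵇ toℕ (Trans.src t)} e
  ... | a , e' with if-true {proj₁ l ≡ᵇ toℕ (Trans.lab t)} e'
  ...   | b , s = ≡ᵇ-sound _ _ a , ≡ᵇ-sound _ _ b , s

  readWord-∷ʳ : ∀ w u l → readWord w (u ∷ʳ l) ≡ collect (succs w (l ∷ [])) (readWord w u)
  readWord-∷ʳ w u l = foldl-++ _ _ u (l ∷ [])

  refuted⁺ : ∀ w u n → n ∈ close w (letters (values w u)) (nodes w u) (readWord w u) →
             onLasso w (letters (values w u)) (nodes w u) n ≡ true → refuted w u ≡ true
  refuted⁺ w u n n∈ e =
    exists⁺ (onLasso w (letters (values w u)) (nodes w u)) {close w (letters (values w u)) (nodes w u) (readWord w u)} n∈ e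

  refuted⁻ : ∀ w u → refuted w u ≡ true → ∃ λ n → n ∈ close w (letters (values w u)) (nodes w u) (readWord w u) ×
             onLasso w (letters (values w u)) (nodes w u) n ≡ true
  refuted⁻ w u e =
    exists⁻ (onLasso w (letters (values w u)) (nodes w u)) (close w (letters (values w u)) (nodes w u) (readWord w u)) e

  letters⁺ : ∀ {a d B} → a < nΣ → d < B → (a , d) ∈ letters B
  letters⁺ {a} {d} {B} a< d< =
    ∈-collect⁺ (λ a → collect (λ d → (a , d) ∷ []) (below B)) (∈-below⁺ a<)
      (∈-collect⁺ (λ d → (a , d) ∷ []) (∈-below⁺ d<) (here refl))

-- A deviating run yields a lasso

infix 3 _↔_

_↔_ : Set → Set → Set
X ↔ Y = (X → Y) × (Y → X)

↔-≡ᵇ : ∀ {a b c d} → (a ≡ b ↔ c ≡ d) → (a ≡ᵇ b) ≡ (c ≡ᵇ d)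
↔-≡ᵇ {a} {b} {c} {d} (f , g) with a ≟ b
... | yes refl rewrite f refl = trans (≡ᵇ-refl a) (sym (≡ᵇ-refl d))
... | no a≢b = trans (≡ᵇ-false a b a≢b) (sym (≡ᵇ-false c d (a≢b ∘ g)))

Bounded-mono : ∀ {M M'} → M ≤ M' → ∀ {k} (t : ⟦ tup k ⟧) → Bounded M t → Bounded M' t
Bounded-mono M≤ {zero}  n       p       = <-≤-trans p M≤
Bounded-mono M≤ {suc k} (a , t) (p , q) = <-≤-trans p M≤ , Bounded-mono M≤ t q

look-bounded : ∀ {M k} (t : ⟦ tup k ⟧) → Bounded M t → ∀ r → look t r < M
look-bounded (a , t) (p , q) zero    = p
look-bounded (a , t) (p , q) (suc r) = look-bounded t q r

-- Data values below B₀ are constants; the others may be renamed, and suc k names above the constants suffice.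
module Renaming (k B₀ : ℕ) where

  B : ℕ
  B = B₀ + suc k

  record SameConstants (d d' : ℕ) : Set where
    constructor sameConstants
    field same : ∀ c → c < B₀ → (d ≡ c ↔ d' ≡ c)
  open SameConstants public

  record Similar (τ τ' : Fin k → ℕ) : Set where
    field
      equalities : ∀ r s → (τ r ≡ τ s ↔ τ' r ≡ τ' s)
      constants  : ∀ r → SameConstants (τ r) (τ' r)
      small      : ∀ r → τ' r < B
  open Similar public

  record Match (τ τ' : Fin k → ℕ) (d d' : ℕ) : Set where
    field
      equalities : ∀ r → (τ r ≡ d ↔ τ' r ≡ d')
      constants  : SameConstants d d'
      small      : d' < B

  -- If all `suc k` names were held by the `k` registers, two different names would share a
  -- register.
  fresh : (τ : Fin k → ℕ) → ∃ λ (i : Fin (suc k)) → ∀ r → τ r ≢ B₀ + toℕ i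
  fresh τ with any? (λ i → all? (λ r → ¬? (τ r ≟ B₀ + toℕ i)))
  ... | yes p = p
  ... | no ¬p = ⊥-elim (<⇒≢ (proj₁ (proj₂ (proj₂ clash))) (toℕ≡ (proj₂ (proj₂ (proj₂ clash)))))
    where
    holder : ∀ (i : Fin (suc k)) → ∃ λ r → τ r ≡ B₀ + toℕ i
    holder i with ¬∀⟶∃¬ k _ (λ r → ¬? (τ r ≟ B₀ + toℕ i)) (λ h → ¬p (i , h))
    ... | r , h = r , decidable-stable (τ r ≟ B₀ + toℕ i) h
    clash = pigeonhole ≤-refl (λ i → proj₁ (holder i))
    toℕ≡ : ∀ {i j} → proj₁ (holder i) ≡ proj₁ (holder j) → toℕ i ≡ toℕ j
    toℕ≡ {i} {j} e = +-cancelˡ-≡ B₀ _ _ (trans (sym (proj₂ (holder i))) (trans (cong τ e) (proj₂ (holder j))))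

  -- A constant stays, a value held by some register follows that register, and any other value gets
  -- a name held by no register. In the last case neither the old nor the new value is a constant,
  -- so the constants are respected vacuously.
  rename : ∀ {τ τ'} → Similar τ τ' → ∀ d → ∃ λ d' → Match τ τ' d d'
  rename {τ} {τ'} S d with d <? B₀
  ... | yes d<B₀ = d , record
    { equalities = λ r → same (constants S r) d d<B₀
    ; constants  = sameConstants λ _ _ → id , id
    ; small      = <-≤-trans d<B₀ (m≤m+n _ _) }
  ... | no d≮B₀ with any? (λ r → τ r ≟ d)
  ...   | yes (r , refl) = τ' r , record
    { equalities = λ s → equalities S s r ; constants = constants S r ; small = small S r }
  ...   | no none with fresh τ'
  ...     | i , new = B₀ + toℕ i , record
    { equalities = λ r → (λ e → ⊥-elim (none (r , e))) , (λ e → ⊥-elim (new r e))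
    ; constants  = sameConstants λ { c c<B₀ → (λ { refl → ⊥-elim (d≮B₀ c<B₀) }) , (λ { refl → ⊥-elim (<⇒≱ c<B₀ (m≤m+n _ _)) }) }
    ; small      = +-monoʳ-< B₀ (toℕ<n i) }

  Similar-cong : ∀ {τ₁ τ₂ τ₁' τ₂'} → (∀ r → τ₁ r ≡ τ₂ r) → (∀ r → τ₁' r ≡ τ₂' r) → Similar τ₁ τ₁' → Similar τ₂ τ₂'
  equalities (Similar-cong e e' S) r s =
    (λ h → trans (sym (e' r)) (trans (proj₁ (equalities S r s) (trans (e r) (trans h (sym (e s))))) (e' s))) ,
    (λ h → trans (sym (e r)) (trans (proj₂ (equalities S r s) (trans (e' r) (trans h (sym (e' s))))) (e s)))
  same (constants (Similar-cong e e' S) r) c p =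
    (λ h → trans (sym (e' r)) (proj₁ (same (constants S r) c p) (trans (e r) h))) ,
    (λ h → trans (sym (e r)) (proj₂ (same (constants S r) c p) (trans (e' r) h)))
  small (Similar-cong e e' S) r = subst (_< B) (e' r) (small S r)

  Similar-assign : ∀ {τ τ' d d'} → Similar τ τ' → Match τ τ' d d' → (as : Fin k → Bool) →
                   Similar (λ r → if as r then d else τ r) (λ r → if as r then d' else τ' r)
  equalities (Similar-assign S m as) r s with as r | as s
  ... | true  | true  = (λ _ → refl) , (λ _ → refl)
  ... | true  | false = (λ e → sym (proj₁ (Match.equalities m s) (sym e))) , (λ e → sym (proj₂ (Match.equalities m s) (sym e)))
  ... | false | true  = Match.equalities m r
  ... | false | false = equalities S r s
  constants (Similar-assign S m as) r with as r
  ... | true  = Match.constants m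
  ... | false = constants S r
  small (Similar-assign S m as) r with as r
  ... | true  = Match.small m
  ... | false = small S r

  sat-Match : ∀ {τ τ' d d'} → Match τ τ' d d' → ∀ φ → sat τ d φ ≡ sat τ' d' φ
  sat-Match m tt        = refl
  sat-Match m ff        = refl
  sat-Match m (req r)   = ↔-≡ᵇ (Match.equalities m r)
  sat-Match m (rneq r)  = cong not (↔-≡ᵇ (Match.equalities m r))
  sat-Match m (neg φ)   = cong not (sat-Match m φ)
  sat-Match m (and φ ψ) = cong₂ _∧_ (sat-Match m φ) (sat-Match m ψ)
  sat-Match m (or φ ψ)  = cong₂ _∨_ (sat-Match m φ) (sat-Match m ψ)

module Soundness {nΣ nΓ : ℕ} (A : NRT nΣ nΓ) (d₀ : ℕ) (x : DataWord nΣ) (y : DataWord nΓ)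
  (ρ : Run A d₀ x) (accepts : Run.Accepting ρ) (produces : Run.Produces ρ y)
  (w : List (ℕ × ℕ)) (j : ℕ) where

  open NRT A
  open Run ρ
  open Search A d₀

  private
    u = pre x j
    B₀ = constants w u
    L = letters (values w u)
    M = entries w u
    open module R = Renaming k B₀ using (B; Similar; Match; SameConstants)

    d₀<B₀ : d₀ < B₀
    d₀<B₀ = s≤s (m≤m+n d₀ _)

    u<B₀ : ∀ {m} → m < j → proj₂ (x m) < B₀
    u<B₀ m<j = s≤s (≤-trans (dataSum-≥ u (∈-pre x m<j)) (≤-trans (m≤m+n _ _) (m≤n+m _ d₀)))

    w<B₀ : ∀ {c} → c ∈ w → proj₂ c < B₀
    w<B₀ c∈ = s≤s (≤-trans (dataSum-≥ w c∈) (≤-trans (m≤n+m _ (dataSum u)) (m≤n+m _ d₀)))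

    -- All data of `w` are constants, and renaming preserves which constant a value equals, so
    -- comparison with a letter of `w` cannot tell the two values apart.
    track-same : ∀ i a {e e'} → SameConstants e e' → track w i (a , e') ≡ track w i (a , e)
    track-same i a {e} {e'} S with nth w i in ei
    ... | nothing = trans (track-end A d₀ w i (a , e') ei) (sym (track-end A d₀ w i (a , e) ei))
    ... | just c with c ≟ₗ (a , e)
    ...   | yes refl = trans (track-match A d₀ w i (a , e') (trans ei (cong (λ z → just (a , z)) (sym
                         (proj₁ (R.same S e (w<B₀ (nth-∈ w i ei))) refl)))))
                         (sym (track-match A d₀ w i (a , e) ei))
    ...   | no c≢ = trans (track-differ A d₀ w i (a , e') ei (λ { refl → c≢ (cong (a ,_) (sym
                         (proj₂ (R.same S e' (w<B₀ (nth-∈ w i ei))) refl))) }))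
                         (sym (track-differ A d₀ w i (a , e) ei c≢))

    trackAll-same : ∀ {τ : Fin k → ℕ} {t} → Similar τ (look t) → ∀ i o →
      trackAll w t i o ≡ trackOut A d₀ w i (map (λ p → proj₁ p , τ (proj₂ p)) o)
    trackAll-same S i []            = refl
    trackAll-same {τ} {t} S i ((γ , r) ∷ o) =
      trans (cong (λ i' → trackAll w t i' o) (track-same i (toℕ γ) (R.constants S r))) (trackAll-same S _ o)

    record Simulates (n : ℕ) (nd : ⟦ Node ⟧) : Set where
      field
        state    : proj₁ nd ≡ toℕ (st n)
        position : proj₁ (proj₂ nd) ≡ trackOut A d₀ w 0 (outPrefix n)
        similar  : Similar (reg n) (look (proj₂ (proj₂ nd)))
        bounded  : Bounded B (proj₂ (proj₂ nd))
    open Simulates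

    0<B : 0 < B
    0<B = ≤-trans (s≤s z≤n) (m≤n+m (suc k) B₀)

    -- The renamed run is built step by step because each name is chosen relative to the registers
    -- at that moment. Names no longer held are reused, so no single renaming of data values need
    -- underlie the whole run.
    hat : ∀ n → ∃ (Simulates n)
    data' : ∀ n → ∃ λ d' → Match (reg n) (look (proj₂ (proj₂ (proj₁ (hat n))))) (proj₂ (x n)) d'
    data' n = R.rename (similar (proj₂ (hat n))) (proj₂ (x n))
    hat zero = start , record
      { state    = cong toℕ (sym st0)
      ; position = refl
      ; similar  = R.Similar-cong (λ r → sym (reg0 r)) (λ r → sym (look-tab (λ _ → d₀) r)) (record
          { equalities = λ _ _ → (λ _ → refl) , (λ _ → refl)
          ; constants  = λ _ → R.sameConstants λ _ _ → id , id
          ; small      = λ _ → <-≤-trans d₀<B₀ (m≤m+n _ _) })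
      ; bounded  = bounded-tab {k = k} _ 0<B (λ _ → <-≤-trans d₀<B₀ (m≤m+n _ _)) }
    hat (suc n) = fire w (tr n) (proj₁ (data' n)) (proj₁ (hat n)) , record
      { state    = cong toℕ (trTgt n)
      ; position = trans (trackAll-same sim _ (Trans.out (tr n)))
          (trans (cong (λ i → trackOut A d₀ w i (stepOut n)) (position (proj₂ (hat n))))
                 (sym (foldl-++ _ 0 (outPrefix n) (stepOut n))))
      ; similar  = sim
      ; bounded  = bounded-tab {k = k} _ 0<B (R.small assigned) }
      where
      assigned = R.Similar-assign (similar (proj₂ (hat n))) (proj₂ (data' n)) (Trans.asgn (tr n))
      sim : Similar (reg (suc n)) (look (assign (tr n) (proj₁ (data' n)) (proj₂ (proj₂ (proj₁ (hat n))))))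
      sim = R.Similar-cong (λ r → sym (trReg n r)) (λ r → sym (look-tab {k} _ r)) assigned

    h : ℕ → ⟦ Node ⟧
    h n = proj₁ (hat n)

    h-fires : ∀ n → Fires A d₀ w (toℕ (proj₁ (x n)) , proj₁ (data' n)) (h n) (h (suc n))
    h-fires n = tr n , trΔ n , is-enabled , refl
      where
      is-enabled : enabled (tr n) (toℕ (proj₁ (x n)) , proj₁ (data' n)) (h n) ≡ true
      is-enabled = subst (λ a → enabled (tr n) (toℕ a , proj₁ (data' n)) (h n) ≡ true) (trLab n)
        (enabled⁺ A d₀ (tr n) (proj₁ (data' n)) (h n)
          (trans (state (proj₂ (hat n))) (cong toℕ (sym (trSrc n))))
          (trans (sym (R.sat-Match (proj₂ (data' n)) (Trans.test (tr n)))) (Equivalence.to T-≡ (trTest n))))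

    -- The data of `u` are constants and survive the renaming, so the renamed run still reads `u`
    -- itself.
    h-reads : ∀ n → n < j → h (suc n) ∈ succs w (letter (x n) ∷ []) (h n)
    h-reads n n<j = ∈-succs⁺ A d₀ w (letter (x n) ∷ []) {n = h n} (here (cong (toℕ (proj₁ (x n)) ,_)
      (proj₁ (R.same (Match.constants (proj₂ (data' n))) (proj₂ (x n)) (u<B₀ n<j)) refl))) (h-fires n)

    h-moves : ∀ n → h (suc n) ∈ succs w L (h n)
    h-moves n = ∈-succs⁺ A d₀ w L {n = h n}
      (letters⁺ A d₀ (toℕ<n (proj₁ (x n))) (Match.small (proj₂ (data' n)))) (h-fires n)

    h-read : ∀ n → n ≤ j → h n ∈ readWord w (pre x n)
    h-read zero    _   = here refl
    h-read (suc n) n<j = subst (h (suc n) ∈_) (sym (readWord-∷ʳ A d₀ w (pre x n) (letter (x n))))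
      (∈-collect⁺ (succs w (letter (x n) ∷ [])) (h-read n (<⇒≤ n<j)) (h-reads n n<j))

    h-bounded : ∀ n → Bounded M (h n)
    h-bounded n =
      subst (_< M) (sym (state (proj₂ (hat n)))) (<-≤-trans (toℕ<n (st n)) (≤-trans (m≤m+n nQ _) (m≤n+m _ B))) ,
      <-≤-trans (s≤s (subst (_≤ suc (len w)) (sym (position (proj₂ (hat n)))) (trackOut-≤ A d₀ w 0 (outPrefix n) z≤n)))
                (≤-trans (m≤n+m _ nQ) (m≤n+m _ B)) ,
      Bounded-mono (m≤m+n B _) _ (bounded (proj₂ (hat n)))

    h-close : ∀ a b ns → a ≤ b → h a ∈ ns → h b ∈ close w L (nodes w u) ns
    h-close a b ns a≤b ha = subst (λ m → h m ∈ close w L (nodes w u) ns) (m+[n∸m]≡n a≤b)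
      (close-Walk A d₀ w L M ns (λ m → h (a + m)) (b ∸ a) (subst (λ m → h m ∈ ns) (sym (+-identityʳ a)) ha) record
        { edges   = λ m _ → subst (λ m' → h m' ∈ succs w L (h (a + m))) (sym (+-suc a m)) (h-moves (a + m))
        ; bounded = λ m _ → h-bounded (a + m) })

    outPrefix-+ : ∀ n d → ∃ λ o → outPrefix (d + n) ≡ outPrefix n ++ o
    outPrefix-+ n zero = [] , sym (++-identityʳ _)
    outPrefix-+ n (suc d) with outPrefix-+ n d
    ... | o , e = o ++ stepOut (d + n) , trans (cong (_++ stepOut (d + n)) e) (++-assoc (outPrefix n) o _)

  module _ (p : ℕ) (c : ℕ × ℕ) (ec : nth w p ≡ just c) (c≢ : c ≢ letter (y p)) where

    private
      n₁ : ℕ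
      -- By step `n₁` at least `length w` letters have been output, hence also the one at the
      -- mismatch `p`.
      n₁ = proj₁ (produces (length w))

      deviated : ∀ n → n₁ ≤ n → trackOut A d₀ w 0 (outPrefix n) ≡ suc (len w)
      deviated n n₁≤n =
        let (d , n₁+d≡n) = m≤n⇒∃[o]m+o≡n n₁≤n
            (o , e)      = outPrefix-+ n₁ d
        in trans (cong (trackOut A d₀ w 0) (trans (cong outPrefix (trans (sym n₁+d≡n) (+-comm n₁ d))) e))
          (trans (foldl-++ _ 0 (outPrefix n₁) o)
          (trans (cong (λ i → trackOut A d₀ w i o)
                   (deviation⁺ A d₀ w (outPrefix n₁) 0 p (proj₂ (proj₂ (produces (length w))) p (nth-<length w p ec)) ec c≢))
                 (trackOut-deviated A d₀ w o)))

      -- Accepting times are taken only after `u` has been read and after the deviation has been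
      -- recorded, so a repeated node among them closes a cycle of the required kind.
      visit : ℕ → ℕ
      visit zero    = proj₁ (accepts (j ⊔ n₁))
      visit (suc i) = proj₁ (accepts (suc (visit i)))

      visit-accepts : ∀ i → acc (st (visit i)) ≡ true
      visit-accepts zero    = Equivalence.to T-≡ (proj₂ (proj₂ (accepts (j ⊔ n₁))))
      visit-accepts (suc i) = Equivalence.to T-≡ (proj₂ (proj₂ (accepts (suc (visit i)))))

      visit-suc : ∀ i → visit i < visit (suc i)
      visit-suc i = proj₁ (proj₂ (accepts (suc (visit i))))

      visit-< : ∀ {a b} → a < b → visit a < visit b
      visit-< {a} {suc b} a<b with m<1+n⇒m<n∨m≡n a<b
      ... | inj₁ p    = <-trans (visit-< p) (visit-suc b)
      ... | inj₂ refl = visit-suc b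

      visit-≥ : ∀ i → j ⊔ n₁ ≤ visit i
      visit-≥ zero    = proj₁ (proj₂ (accepts (j ⊔ n₁)))
      visit-≥ (suc i) = ≤-trans (visit-≥ i) (<⇒≤ (visit-suc i))

      -- The run from step `j` to the first visit is the stem of the lasso and the run between the
      -- two visits is its cycle. Both may be long; `h-close` brings them within the bounded number
      -- of rounds.
      repeat-refutes : ∀ {a b} → a < b → h (visit a) ≡ h (visit b) → refuted w u ≡ true
      repeat-refutes {a} {b} a<b e = refuted⁺ A d₀ w u (h (visit a))
        (h-close j (visit a) (readWord w u) (≤-trans (m≤m⊔n j n₁) (visit-≥ a)) (h-read j ≤-refl))
        (onLasso⁺ A d₀ w L (nodes w u) (h (visit a))
          (trans (cong (accepting (allFin nQ)) (state (proj₂ (hat (visit a)))))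
                 (accepting⁺ A d₀ (allFin nQ) (st (visit a)) (∈-allFin (st (visit a))) (visit-accepts a)))
          (trans (position (proj₂ (hat (visit a)))) (deviated (visit a) (≤-trans (m≤n⊔m j n₁) (visit-≥ a))))
          (subst (_∈ close w L (nodes w u) (succs w L (h (visit a)))) (sym e)
            (h-close (suc (visit a)) (visit b) (succs w L (h (visit a))) (visit-< a<b) (h-moves (visit a)))))

    deviation-refutes : refuted w u ≡ true
    deviation-refutes = let (a , b , a<b , _ , e) = repetition {M} {2 + k} (h ∘ visit) (λ m _ → h-bounded (visit m))
                        in repeat-refutes a<b e

  soundness : refuted w u ≡ false → ∀ p c → nth w p ≡ just c → c ≡ letter (y p)
  soundness ok p c ec = decidable-stable (c ≟ₗ letter (y p))
    (λ c≢ → false≢true (trans (sym ok) (deviation-refutes p c ec c≢)))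
    where
    false≢true : false ≡ true → ⊥
    false≢true ()

-- A lasso yields a deviating run

module _ {nΣ nΓ : ℕ} (A : NRT nΣ nΓ) (d₀ : ℕ) where

  open NRT A

  outPrefix-prefix : ∀ {x} (ρ : Run A d₀ x) m n → m ≤ n → ∃ λ o → Run.outPrefix ρ n ≡ Run.outPrefix ρ m ++ o
  outPrefix-prefix ρ m n m≤n =
    let (d , m+d≡n) = m≤n⇒∃[o]m+o≡n m≤n
        (o , e)     = go d
    in o , trans (cong (Run.outPrefix ρ) (trans (sym m+d≡n) (+-comm m d))) e
    where
    go : ∀ d → ∃ λ o → Run.outPrefix ρ (d + m) ≡ Run.outPrefix ρ m ++ o
    go zero = [] , sym (++-identityʳ _)
    go (suc d) with go d
    ... | o , e = o ++ Run.stepOut ρ (d + m) ,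
                  trans (cong (_++ Run.stepOut ρ (d + m)) e) (++-assoc (Run.outPrefix ρ m) o _)

  output : ∀ {x} (ρ : Run A d₀ x) → Run.InfiniteOutput ρ → DataWord nΓ
  output ρ inf m = proj₁ (nth-just (Run.outPrefix ρ (proj₁ (inf (suc m)))) m (proj₂ (inf (suc m))))

  output-nth : ∀ {x} (ρ : Run A d₀ x) (inf : Run.InfiniteOutput ρ) n m → m < length (Run.outPrefix ρ n) →
               nth (Run.outPrefix ρ n) m ≡ just (output ρ inf m)
  output-nth ρ inf n m m<l = both (≤-total n n')
    where
    n' = proj₁ (inf (suc m))
    O  = Run.outPrefix ρ
    e' : nth (O n') m ≡ just (output ρ inf m)
    e' = proj₂ (nth-just (O n') m (proj₂ (inf (suc m))))
    both : n ≤ n' ⊎ n' ≤ n → nth (O n) m ≡ just (output ρ inf m)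
    both (inj₁ p) = let (o , e) = outPrefix-prefix ρ n n' p in
      trans (sym (nth-++ˡ (O n) o m m<l)) (trans (cong (λ l → nth l m) (sym e)) e')
    both (inj₂ p) = let (o , e) = outPrefix-prefix ρ n' n p in
      trans (cong (λ l → nth l m) e) (trans (nth-++ˡ (O n') o m (proj₂ (inf (suc m)))) e')

  output-Produces : ∀ {x} (ρ : Run A d₀ x) (inf : Run.InfiniteOutput ρ) → Run.Produces ρ (output ρ inf)
  output-Produces ρ inf i = proj₁ (inf i) , proj₂ (inf i) ,
    λ m m<i → output-nth ρ inf (proj₁ (inf i)) m (<-≤-trans m<i (proj₂ (inf i)))

module Unrolling {nΣ nΓ : ℕ} (A : NRT nΣ nΓ) (d₀ : ℕ) (w : List (ℕ × ℕ)) where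

  open NRT A
  open Search A d₀

  record Edge (n n' : ⟦ Node ⟧) : Set where
    field
      tr    : Transition
      datum : ℕ
      tr∈Δ  : tr ∈ Δ
      src   : proj₁ n ≡ toℕ (Trans.src tr)
      holds : sat (look (proj₂ (proj₂ n))) datum (Trans.test tr) ≡ true
      next  : n' ≡ fire w tr datum n
    read : Fin nΣ × ℕ
    read = Trans.lab tr , datum
  open Edge

  data Path : ⟦ Node ⟧ → ⟦ Node ⟧ → Set where
    []  : ∀ {n} → Path n n
    _∷_ : ∀ {n n' n''} → Edge n n' → Path n' n'' → Path n n''

  _⊕_ : ∀ {n n' n''} → Path n n' → Path n' n'' → Path n n''
  []      ⊕ q = q
  (e ∷ p) ⊕ q = e ∷ (p ⊕ q)

  inputs : ∀ {n n'} → Path n n' → List (Fin nΣ × ℕ)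
  inputs []      = []
  inputs (e ∷ p) = read e ∷ inputs p

  inputs-⊕ : ∀ {n n' n''} (p : Path n n') (q : Path n' n'') → inputs (p ⊕ q) ≡ inputs p ++ inputs q
  inputs-⊕ []      q = refl
  inputs-⊕ (e ∷ p) q = cong (read e ∷_) (inputs-⊕ p q)

  succs-Edge : ∀ L {n n'} → n' ∈ succs w L n → ∃ λ (e : Edge n n') → letter (read e) ∈ L
  succs-Edge L {n} n'∈ with ∈-succs⁻ A d₀ w L n'∈
  ... | l , l∈ , t , t∈ , en , eq with enabled⁻ A d₀ t l n en
  ...   | s , a , h = record { tr = t ; datum = proj₂ l ; tr∈Δ = t∈ ; src = s ; holds = h ; next = eq } ,
                      subst (λ a → (a , proj₂ l) ∈ L) a l∈

  close-Path : ∀ L N ns {z} → z ∈ close w L N ns → ∃ λ s → s ∈ ns × Path s z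
  close-Path L zero    ns z∈ = _ , z∈ , []
  close-Path L (suc N) ns z∈ with ∈-push⁻ (close w L N ns) (collect (succs w L) (close w L N ns)) z∈
  ... | inj₂ p = close-Path L N ns p
  ... | inj₁ p with ∈-collect⁻ (succs w L) (close w L N ns) p
  ...   | z' , z'∈ , q with close-Path L N ns z'∈
  ...     | s , s∈ , path = s , s∈ , path ⊕ (proj₁ (succs-Edge L q) ∷ [])

  letters-of : DataWord nΣ → ℕ → List (Fin nΣ × ℕ)
  letters-of x zero    = []
  letters-of x (suc n) = letters-of x n ∷ʳ x n

  nth-letters-of : ∀ x n m ys → m < n → nth (letters-of x n ++ ys) m ≡ just (x m)
  nth-letters-of x n m ys m<n = go n ys m<n
    where
    len-of : ∀ n → length (letters-of x n) ≡ n
    len-of zero    = refl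
    len-of (suc n) = trans (length-++ (letters-of x n)) (trans (+-comm _ 1) (cong suc (len-of n)))
    go : ∀ n ys → m < n → nth (letters-of x n ++ ys) m ≡ just (x m)
    go (suc n) ys m<1+n rewrite ++-assoc (letters-of x n) (x n ∷ []) ys with m<1+n⇒m<n∨m≡n m<1+n
    ... | inj₁ p    = go n _ p
    ... | inj₂ refl = trans (cong (nth (letters-of x m ++ x m ∷ ys)) (sym (trans (+-identityʳ _) (len-of m))))
                            (nth-++ʳ (letters-of x m) _ 0)

  readWord-Path : ∀ x n {z} → z ∈ readWord w (pre x n) → ∃ λ (p : Path start z) → inputs p ≡ letters-of x n
  readWord-Path x zero    (here refl) = [] , refl
  readWord-Path x (suc n) {z} z∈
    with ∈-collect⁻ (succs w (letter (x n) ∷ [])) (readWord w (pre x n)) (subst (z ∈_) (readWord-∷ʳ A d₀ w (pre x n) (letter (x n))) z∈)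
  ... | z' , z'∈ , q with readWord-Path x n z'∈ | succs-Edge (letter (x n) ∷ []) q
  ...   | p , ep | e , here el = p ⊕ (e ∷ []) , trans (inputs-⊕ p (e ∷ [])) (cong₂ _∷ʳ_ ep (letter-injective el))

  fire-position : ∀ {t d n n'} → n' ≡ fire w t d n →
    proj₁ (proj₂ n') ≡ trackOut A d₀ w (proj₁ (proj₂ n)) (map (λ p → proj₁ p , look (proj₂ (proj₂ n')) (proj₂ p)) (Trans.out t))
  fire-position {t} {d} {n} refl = go (proj₁ (proj₂ n)) (Trans.out t)
    where
    τ = assign t d (proj₂ (proj₂ n))
    go : ∀ i o → trackAll w τ i o ≡ trackOut A d₀ w i (map (λ p → proj₁ p , look τ (proj₂ p)) o)
    go i []            = refl
    go i ((γ , r) ∷ o) = go _ o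

  module _ {mid n₁ : ⟦ Node ⟧} (turn : Edge mid n₁) (back : Path n₁ mid) (stem : Path start mid) where

    private
      Ahead : Set
      Ahead = ∃ λ n → Path n mid

      -- The unrolling remembers the path still to be walked to `mid`. When it is used up, the cycle
      -- `turn` followed by `back` is started anew, so `mid` recurs forever.
      advance : (s : Ahead) → ∃ λ (s' : Ahead) → Edge (proj₁ s) (proj₁ s')
      advance (_ , [])    = (n₁ , back) , turn
      advance (_ , e ∷ p) = (_ , p) , e

      ahead : ℕ → Ahead
      ahead zero    = start , stem
      ahead (suc m) = proj₁ (advance (ahead m))

      node : ℕ → ⟦ Node ⟧
      node m = proj₁ (ahead m)

      edge : ∀ m → Edge (node m) (node (suc m))
      edge m = proj₂ (advance (ahead m))

    word : DataWord nΣ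
    word m = read (edge m)

    private
      word-inputs : ∀ {n} (p : Path n mid) m → ahead m ≡ (n , p) → ∀ i → i < length (inputs p) → nth (inputs p) i ≡ just (word (i + m))
      word-inputs (e ∷ p) m eq zero    _       = cong (λ s → just (read (proj₂ (advance s)))) (sym eq)
      word-inputs (e ∷ p) m eq (suc i) (s≤s q) =
        trans (word-inputs p (suc m) (cong (λ s → proj₁ (advance s)) eq) i q) (cong (just ∘ word) (+-suc i m))

      revisits : ∀ {n} (p : Path n mid) m → ahead m ≡ (n , p) → ∃ λ i → m ≤ i × node i ≡ mid
      revisits []      m eq = m , ≤-refl , cong proj₁ eq
      revisits (e ∷ p) m eq with revisits p (suc m) (cong (λ s → proj₁ (advance s)) eq)
      ... | i , m<i , q = i , <⇒≤ m<i , q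

      visits : ∀ m → ∃ λ i → m ≤ i × node i ≡ mid
      visits m = revisits (proj₂ (ahead m)) m refl

    word-stem : ∀ i → i < length (inputs stem) → nth (inputs stem) i ≡ just (word i)
    word-stem i p = trans (word-inputs stem 0 refl i p) (cong (just ∘ word) (+-identityʳ i))

    unrolled : Run A d₀ word
    unrolled = record
      -- Nodes store states as plain numbers, so the state is taken from the next transition, where
      -- it is an element of `Fin nQ`.
      { st     = λ m → Trans.src (tr (edge m))
      ; reg    = λ m → look (proj₂ (proj₂ (node m)))
      ; tr     = λ m → tr (edge m)
      ; st0    = toℕ-injective (sym (src (edge 0)))
      ; reg0   = look-tab (λ _ → d₀)
      ; trΔ    = λ m → tr∈Δ (edge m)
      ; trSrc  = λ _ → refl
      ; trLab  = λ _ → refl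
      ; trTest = λ m → Equivalence.from T-≡ (holds (edge m))
      ; trReg  = λ m r → trans (cong (λ n → look (proj₂ (proj₂ n)) r) (next (edge m))) (look-tab {k} _ r)
      ; trTgt  = λ m → toℕ-injective (trans (sym (cong proj₁ (next (edge m)))) (src (edge (suc m))))
      }

    unrolled-position : ∀ m → proj₁ (proj₂ (node m)) ≡ trackOut A d₀ w 0 (Run.outPrefix unrolled m)
    unrolled-position zero    = refl
    unrolled-position (suc m) = trans (fire-position {tr (edge m)} {datum (edge m)} {node m} (next (edge m)))
      (trans (cong (λ i → trackOut A d₀ w i (Run.stepOut unrolled m)) (unrolled-position m))
             (sym (foldl-++ _ 0 (Run.outPrefix unrolled m) (Run.stepOut unrolled m))))

    unrolled-accepting : accepting (allFin nQ) (proj₁ mid) ≡ true → Run.Accepting unrolled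
    unrolled-accepting a m with visits m | accepting⁻ A d₀ (allFin nQ) (proj₁ mid) a
    ... | i , m≤i , e | q , acc-q , eq = i , m≤i ,
      Equivalence.from T-≡ (trans (cong acc (toℕ-injective (trans (sym (src (edge i))) (trans (cong proj₁ e) eq)))) acc-q)

    -- The position stored at a visit of `mid` is the result of tracking the output prefix written
    -- so far, so that prefix contains a mismatch, and the infinite output extends it.
    unrolled-deviates : proj₁ (proj₂ mid) ≡ suc (len w) → (inf : Run.InfiniteOutput unrolled) →
      ∃₂ λ p c → nth w p ≡ just c × c ≢ letter (output A d₀ unrolled inf p)
    unrolled-deviates pos inf with visits 0
    ... | i , _ , e with deviation⁻ A d₀ w (Run.outPrefix unrolled i) 0 z≤n
                           (trans (sym (unrolled-position i)) (trans (cong (proj₁ ∘ proj₂) e) pos))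
    ...   | m , p , c , eo , ew , c≢ = m , c , ew , λ c≡ → c≢ (trans c≡ (cong letter (just-injective
      (trans (sym (output-nth A d₀ unrolled inf i m (nth-<length (Run.outPrefix unrolled i) m eo))) eo))))

  Disagreement : DataWord nΣ → ℕ → Set
  Disagreement x j =
    ∃₂ λ x' y' → Graph A d₀ x' y' × (∀ m → m < j → x m ≡ x' m) × ∃₂ λ p c → nth w p ≡ just c × c ≢ letter (y' p)

  -- The standing assumption gives the unrolled run an infinite output and so makes it a point of
  -- the graph. The stem begins with the part that reads `pre x j`, whence the agreement with `x`.
  lasso-disagrees : AcceptingRunsInfinite A d₀ → ∀ x j L N mid → mid ∈ close w L N (readWord w (pre x j)) →
    onLasso w L N mid ≡ true → Disagreement x j
  lasso-disagrees infinite x j L N mid mid∈ lasso =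
    let (a , pos , returns) = onLasso⁻ A d₀ w L N mid lasso
        (s , s∈ , stem₂)    = close-Path L N (readWord w (pre x j)) mid∈
        (stem₁ , ins)       = readWord-Path x j s∈
        (n₁ , n₁∈ , back)   = close-Path L N (succs w L mid) returns
        (turn , _)          = succs-Edge L n₁∈
        ρ                   = unrolled turn back (stem₁ ⊕ stem₂)
        accepts             = unrolled-accepting turn back (stem₁ ⊕ stem₂) a
        inf                 = infinite _ ρ accepts
    in word turn back (stem₁ ⊕ stem₂) , output A d₀ ρ inf , (ρ , accepts , output-Produces A d₀ ρ inf) ,
       agrees turn back stem₁ stem₂ ins , unrolled-deviates turn back (stem₁ ⊕ stem₂) pos inf
    where
    agrees : ∀ {s mid n₁} (turn : Edge mid n₁) (back : Path n₁ mid) (stem₁ : Path start s) (stem₂ : Path s mid) →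
      inputs stem₁ ≡ letters-of x j → ∀ m → m < j → x m ≡ word turn back (stem₁ ⊕ stem₂) m
    agrees turn back stem₁ stem₂ ins m m<j = just-injective (trans (sym at-m)
      (word-stem turn back (stem₁ ⊕ stem₂) m (nth-<length (inputs (stem₁ ⊕ stem₂)) m at-m)))
      where
      at-m : nth (inputs (stem₁ ⊕ stem₂)) m ≡ just (x m)
      at-m = trans (cong (λ l → nth l m) (trans (inputs-⊕ stem₁ stem₂) (cong (_++ inputs stem₂) ins)))
                   (nth-letters-of x j m (inputs stem₂) m<j)

  completeness : AcceptingRunsInfinite A d₀ → ∀ x j → refuted w (pre x j) ≡ true → Disagreement x j
  completeness infinite x j r =
    let (mid , mid∈ , lasso) = refuted⁻ A d₀ w (pre x j) r
    in lasso-disagrees infinite x j (letters (values w (pre x j))) (nodes w (pre x j)) mid mid∈ lasso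

-- Correctness of the written output

unless⁻ : {X : Set} {b : Bool} {c z : X} → z ∈ (if b then [] else c ∷ []) → b ≡ false × z ≡ c
unless⁻ {b = false} (here e) = refl , e

unless⁺ : {X : Set} {b : Bool} {c : X} → b ≡ false → c ∈ (if b then [] else c ∷ [])
unless⁺ refl = here refl

module _ {nΣ nΓ : ℕ} (A : NRT nΣ nΓ) (d₀ : ℕ) where

  open Search A d₀

  candidates⁻ : ∀ v u {c} → c ∈ candidates v u → refuted (push [] (c ∷ v)) (push [] u) ≡ false
  candidates⁻ v u {c} c∈ =
    let (γ , _ , c∈γ) = ∈-collect⁻ byLabel (below nΓ) c∈
        (e , _ , c∈e) = ∈-collect⁻ (byDatum γ) (below (len u)) c∈γ
        (ok , c≡)     = unless⁻ c∈e
    in subst (λ c → refuted (push [] (c ∷ v)) (push [] u) ≡ false) (sym c≡) ok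
    where
    byDatum : ℕ → ℕ → List (ℕ × ℕ)
    byDatum γ e = if refuted (push [] ((γ , e) ∷ v)) (push [] u) then [] else (γ , e) ∷ []
    byLabel : ℕ → List (ℕ × ℕ)
    byLabel γ = collect (byDatum γ) (below (len u))

  candidates⁺ : ∀ v u c → proj₁ c < nΓ → proj₂ c < len u → refuted (push [] (c ∷ v)) (push [] u) ≡ false →
                c ∈ candidates v u
  candidates⁺ v u (γ , e) γ< e< ok =
    ∈-collect⁺ byLabel (∈-below⁺ γ<) (∈-collect⁺ (byDatum γ) (∈-below⁺ e<) (unless⁺ ok))
    where
    byDatum : ℕ → ℕ → List (ℕ × ℕ)
    byDatum γ e = if refuted (push [] ((γ , e) ∷ v)) (push [] u) then [] else (γ , e) ∷ []
    byLabel : ℕ → List (ℕ × ℕ)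
    byLabel γ = collect (byDatum γ) (below (len u))

  module _ (infinite : AcceptingRunsInfinite A d₀) (x : DataWord nΣ) (y : DataWord nΓ) (Gxy : Graph A d₀ x y) where

    open Mealy mealy using (after; Emits)

    private
      offers : ℕ → ℕ → List (ℕ × ℕ)
      offers i n = candidates (revs y i) (revs x n)

      target : ∀ (c : ℕ × ℕ) i → push [] (c ∷ revs y i) ≡ pre y i ∷ʳ c
      target c i = push-revs y (c ∷ []) i

      source : ∀ n → push [] (revs x n) ≡ pre x n
      source n = trans (push-revs x [] n) (++-identityʳ (pre x n))

      target-y : ∀ i → push [] (letter (y i) ∷ revs y i) ≡ pre y (suc i)
      target-y i = target (letter (y i)) i

      -- For any other letter the accepting run on `x` itself would deviate at index `i` and refute
      -- the offer. All offers therefore coincide, and taking the first one on the list is no loss.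
      offers-sound : ∀ i n {c} → c ∈ offers i n → c ≡ letter (y i)
      offers-sound i n {c} c∈ =
        Soundness.soundness A d₀ x y (proj₁ Gxy) (proj₁ (proj₂ Gxy)) (proj₂ (proj₂ Gxy)) (pre y i ∷ʳ c) n
          (subst₂ (λ w u → refuted w u ≡ false) (target c i) (source n) (candidates⁻ (revs y i) (revs x n) c∈))
          i c (trans (cong (nth (pre y i ∷ʳ c)) (sym (trans (+-identityʳ _) (length-pre y i)))) (nth-++ʳ (pre y i) (c ∷ []) 0))

      bump : List (ℕ × ℕ) → ℕ → ℕ
      bump cs i = listcase cs i (λ _ _ → suc i)

      says : List (ℕ × ℕ) → ℕ → Maybe (Fin nΓ × ℕ)
      says cs i = listcase cs nothing (λ _ _ → just (y i))

      written : ℕ → ℕ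
      written zero    = 0
      written (suc n) = bump (offers (written n) (suc n)) (written n)

      emitted : ℕ → Maybe (Fin nΓ × ℕ)
      emitted n = says (offers (written n) (suc n)) (written n)

      Shows : ℕ × ℕ → Maybe (Fin nΓ × ℕ) → Set
      Shows o nothing        = proj₁ o ≡ 0
      Shows o (just (γ , e)) = proj₁ o ≡ suc (toℕ γ) × proj₂ o ≡ e

      Shows-Emits : ∀ u v o m → Shows o m → Emits (u , v , o) m
      Shows-Emits u v o nothing  p = p
      Shows-Emits u v o (just _) p = p

      extend : ∀ cs i (u : List (ℕ × ℕ)) → (∀ {c} → c ∈ cs → c ≡ letter (y i)) →
        ∃ λ o → listcase cs (u , revs y i , 0 , 0) (λ c _ → u , c ∷ revs y i , suc (proj₁ c) , proj₂ c) ≡ (u , revs y (bump cs i) , o) ×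
                Shows o (says cs i)
      extend []       i u h = (0 , 0) , refl , refl
      extend (c ∷ cs) i u h with h (here refl)
      ... | refl = _ , refl , refl , refl

      after-ok : ∀ n → ∃ λ o → after x n ≡ (revs x n , revs y (written n) , o)
      after-suc : ∀ n → ∃ λ o → after x (suc n) ≡ (revs x (suc n) , revs y (written (suc n)) , o) × Shows o (emitted n)

      after-ok zero    = (0 , 0) , refl
      after-ok (suc n) = let (o , e , _) = after-suc n in o , e

      after-suc n =
        let (o , e)      = after-ok n
            (o' , e' , s) = extend (offers (written n) (suc n)) (written n) (revs x (suc n)) (offers-sound (written n) (suc n))
        in o' , trans (cong (λ st → fun (Mealy.next mealy) (proj₂ (x n) , toℕ (proj₁ (x n)) , st , _)) e) e' , s

      emits : ∀ n → Emits (after x (suc n)) (emitted n)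
      emits n = let (o , e , s) = after-suc n in
        subst (λ st → Emits st (emitted n)) (sym e) (Shows-Emits (revs x (suc n)) (revs y (written (suc n))) o (emitted n) s)

      emissions-ok : ∀ n → emissions emitted n ≡ encPrefix y (written n)
      emissions-ok zero    = refl
      emissions-ok (suc n) = trans (cong (_++ emission (emitted n)) (emissions-ok n)) (go (offers (written n) (suc n)) (written n))
        where
        go : ∀ cs i → encPrefix y i ++ emission (says cs i) ≡ encPrefix y (bump cs i)
        go []       i = ++-identityʳ (encPrefix y i)
        go (c ∷ cs) i = refl

      bump-≥ : ∀ cs i → i ≤ bump cs i
      bump-≥ []       i = ≤-refl
      bump-≥ (c ∷ cs) i = n≤1+n i

      bump-∈ : ∀ {c} cs i → c ∈ cs → bump cs i ≡ suc i
      bump-∈ (c ∷ cs) i c∈ = refl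

      written-mono : ∀ n d → written n ≤ written (d + n)
      written-mono n zero    = ≤-refl
      written-mono n (suc d) = ≤-trans (written-mono n d) (bump-≥ (offers (written (d + n)) (suc (d + n))) (written (d + n)))

    module _ (continuous : Continuous (Graph A d₀)) where

      private
        -- By completeness a refutation would yield an input sharing `j` letters with `x` whose
        -- output differs from `y` within `suc m` letters, against the modulus `j`.
        determined : ∀ m j → (∀ x' y' → Graph A d₀ x' y' → (∀ i → i < j → x i ≡ x' i) → ∀ i → i < suc m → y i ≡ y' i) →
          refuted (pre y (suc m)) (pre x j) ≡ false
        determined m j h = decide _ refl
          where
          agreement : Unrolling.Disagreement A d₀ (pre y (suc m)) x j → ⊥
          agreement (x' , y' , G' , eq , p , c , ec , c≢) = c≢ (trans c≡yp (cong letter (h x' y' G' eq p p<1+m)))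
            where
            p<1+m : p < suc m
            p<1+m = subst (p <_) (length-pre y (suc m)) (nth-<length (pre y (suc m)) p ec)
            c≡yp : c ≡ letter (y p)
            c≡yp = just-injective (trans (sym ec) (trans (cong (λ l → nth l p) (sym (++-identityʳ (pre y (suc m)))))
                     (nth-pre y (suc m) p [] p<1+m)))
          decide : ∀ b → refuted (pre y (suc m)) (pre x j) ≡ b → refuted (pre y (suc m)) (pre x j) ≡ false
          decide false e = e
          decide true  e = ⊥-elim (agreement (Unrolling.completeness A d₀ (pre y (suc m)) infinite x j e))

        offered : ∀ m n → proj₂ (y m) < n → refuted (pre y (suc m)) (pre x n) ≡ false → letter (y m) ∈ offers m n
        offered m n e<n ok = candidates⁺ (revs y m) (revs x n) (letter (y m)) (toℕ<n (proj₁ (y m)))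
          (subst (proj₂ (y m) <_) (sym (trans (len≡length (revs x n)) (length-revs n))) e<n)
          (subst₂ (λ w u → refuted w u ≡ false) (sym (target-y m)) (sym (source n)) ok)
          where
          length-revs : ∀ n → length (revs x n) ≡ n
          length-revs zero    = refl
          length-revs (suc n) = cong suc (length-revs n)

        grows : ∀ m n → written n ≡ m → ∃ λ n' → suc m ≤ written n'
        grows m n eq =
          let (j , cont) = continuous x y Gxy (suc m)
              -- `N` lies beyond the modulus `j`, the datum of `y m` and the round `n`. If letter
              -- `m` is still missing after `N` input letters, the next round offers it.
              N = (j + suc (proj₂ (y m))) + n
          in grow N (m≤n⇒m<n∨m≡n (subst (_≤ written N) eq (written-mono n (j + suc (proj₂ (y m))))))
               (λ _ → offered m (suc N) (m<n⇒m<1+n (≤-trans (m≤n+m _ j) (m≤m+n _ n)))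
                 (determined m (suc N) (λ x' y' G' same → cont x' y' G'
                   (λ i i<j → same i (m<n⇒m<1+n (<-≤-trans i<j (≤-trans (m≤m+n j _) (m≤m+n _ n))))))))
          where
          grow : ∀ N → m < written N ⊎ m ≡ written N → (m ≡ written N → letter (y m) ∈ offers m (suc N)) → ∃ λ n' → suc m ≤ written n'
          grow N (inj₁ p) h = N , p
          grow N (inj₂ p) h = suc N , ≤-reflexive (sym (trans (cong (λ i → bump (offers i (suc N)) i) (sym p))
            (bump-∈ (offers m (suc N)) m (h p))))

        unbounded : ∀ m → ∃ λ n → m ≤ written n
        unbounded zero    = 0 , z≤n
        unbounded (suc m) with unbounded m
        ... | n , m≤ with m≤n⇒m<n∨m≡n m≤
        ...   | inj₁ p = n , p
        ...   | inj₂ p = grows m n (sym p)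

      transduces : Transduces mealy x y
      transduces = record
        { emitted = emitted ; emits = emits ; written = written ; prefixes = emissions-ok ; unbounded = unbounded }

theorem5 : (nΣ nΓ d₀ : ℕ) (A : NRT nΣ nΓ) →
    AcceptingRunsInfinite A d₀ →
    Functional (Graph A d₀) →
    (Continuous (Graph A d₀) ⇔ Computable (Graph A d₀))
theorem5 nΣ nΓ d₀ A infinite functional = mk⇔
  (λ continuous → mealy⇒computable (Search.mealy A d₀) (Graph A d₀)
                    (λ x y Gxy → transduces A d₀ infinite x y Gxy continuous))
  (computable⇒continuous (Graph A d₀))
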